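{- Let $r\ge 3$ be an integer, let $\varepsilon>0$ be constant and let $p=\frac{1+\varepsilon}{(r-1)\binom{n-1}{r-1}}$. Let $L_C$ and $L_P$ be the lengths of the longest loose cycle and of the longest loose path, respectively, in $H^r(n,p)$. Then with high probability $$L_C\le L_P+1\le \left(\frac{2\varepsilon^2}{(r-1)^2}+O(\varepsilon^3)\right)\cdot n,$$ where the $O(\varepsilon^3)$ term is bounded in absolute value by $K\varepsilon^3$ for a constant $K=K(r)$ depending only on $r$.
   Context: "With high probability" means with probability tending to $1$ as $n\to\infty$ (with $r,\varepsilon$ fixed). $H^r(n,p)$ is the random $r$-uniform hypergraph on vertex set $[n]$ in which each $r$-subset of $[n]$ is an edge independently with probability $p$. A loose path of length $\ell$ in an $r$-uniform hypergraph is a sequence of distinct vertices $v_1,\dots,v_{\ell(r-1)+1}$ and a sequence of edges $e_1,\dots,e_\ell$ with $e_i=\{v_{(i-1)(r-1)+1},\dots,v_{(i-1)(r-1)+r}\}$ for $i\in[\ell]$. A loose cycle of length $\ell$ is defined similarly, except that $v_{\ell(r-1)+1}=v_1$ (and otherwise all vertices are distinct). -}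

module Defs where

import Algebra.Bundles as B
import Algebra.Properties.AbelianGroup as AbelianGroupProperties
import Algebra.Properties.CommutativeSemigroup as CommutativeSemigroupProperties
open import Data.Bool using (Bool; T; if_then_else_)
open import Data.Fin using (Fin; toℕ; fromℕ; zero)
open import Data.Fin.Subset using (Subset; inside; outside; _∈_; ∣_∣)
open import Data.Integer using (+_)
open import Data.List using (List; []; _∷_; _++_; map; filter; foldr; length; lookup)
open import Data.Nat as ℕ using (ℕ; zero; suc; _∸_)
open import Data.Nat.Combinatorics using (_C_)
import Data.Nat.Properties as ℕₚ
open import Data.Product using (Σ; ∃-syntax; _×_; _,_)
open import Data.Rational as ℚ using (ℚ; 0ℚ; 1ℚ; ½)
import Data.Rational.Properties as ℚₚ
open import Data.Sum using (inj₁; inj₂)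
open import Data.Vec using ([]; _∷_)
open import Function using (_⇔_)
open import Relation.Binary.PropositionalEquality using (_≡_; refl; sym; trans; cong; cong₂; subst; subst₂)

------------------------------------------------------------------------
-- Real numbers: Cauchy sequences of rationals.  Two sequences represent the
-- same real when x ≤ℝ y and y ≤ℝ x; everything below respects this.

record ℝ : Set where
  constructor mkℝ
  field
    seq    : ℕ → ℚ
    cauchy : ∀ (q : ℚ) → 0ℚ ℚ.< q →
             ∃[ N ] ∀ m n → N ℕ.≤ m → N ℕ.≤ n → ℚ.∣ seq m ℚ.- seq n ∣ ℚ.≤ q

open ℝ public

infix  4 _≤ℝ_ _<ℝ_
infixl 6 _+ℝ_ _-ℝ_
infixl 7 _*ℝ_

_≤ℝ_ : ℝ → ℝ → Set
x ≤ℝ y = ∀ (q : ℚ) → 0ℚ ℚ.< q → ∃[ N ] ∀ n → N ℕ.≤ n → seq x n ℚ.≤ seq y n ℚ.+ q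

_<ℝ_ : ℝ → ℝ → Set
x <ℝ y = ∃[ q ] 0ℚ ℚ.< q × ∃[ N ] ∀ n → N ℕ.≤ n → seq x n ℚ.+ q ℚ.≤ seq y n

fromℚ : ℚ → ℝ
fromℚ a = mkℝ (λ _ → a) λ q 0<q → 0 , λ _ _ _ _ →
  subst (ℚ._≤ q) (cong ℚ.∣_∣ (sym (ℚₚ.+-inverseʳ a))) (ℚₚ.<⇒≤ 0<q)

fromℕℝ : ℕ → ℝ
fromℕℝ n = fromℚ (+ n ℚ./ 1)

0ℝ 1ℝ : ℝ
0ℝ = fromℚ 0ℚ
1ℝ = fromℚ 1ℚ

-- The real 1/d, totalised by 1/0 = 0.
recip : ℕ → ℝ
recip zero    = 0ℝ
recip (suc k) = fromℚ (+ 1 ℚ./ suc k)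

private
  module +ᴳ = AbelianGroupProperties ℚₚ.+-0-abelianGroup
  module +ˢ = CommutativeSemigroupProperties
    (B.CommutativeMonoid.commutativeSemigroup ℚₚ.+-0-commutativeMonoid)
  module *ˢ = CommutativeSemigroupProperties
    (B.CommutativeMonoid.commutativeSemigroup ℚₚ.*-1-commutativeMonoid)

  b+[a-b]≡a : ∀ a b → b ℚ.+ (a ℚ.- b) ≡ a
  b+[a-b]≡a a b = trans (sym (ℚₚ.+-assoc b a (ℚ.- b))) (+ᴳ.xyx⁻¹≈y b a)

  [a-b]+[c-d] : ∀ a b c d → (a ℚ.- b) ℚ.+ (c ℚ.- d) ≡ (a ℚ.+ c) ℚ.- (b ℚ.+ d)
  [a-b]+[c-d] a b c d = trans (+ˢ.interchange a (ℚ.- b) c (ℚ.- d))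
    (cong (a ℚ.+ c ℚ.+_) (+ᴳ.⁻¹-∙-comm b d))

  b-a≡[-a]-[-b] : ∀ a b → b ℚ.- a ≡ ℚ.- a ℚ.- ℚ.- b
  b-a≡[-a]-[-b] a b = trans (ℚₚ.+-comm b (ℚ.- a))
    (cong (ℚ.- a ℚ.+_) (sym (+ᴳ.⁻¹-involutive b)))

  p[q-r] : ∀ p q r → p ℚ.* (q ℚ.- r) ≡ p ℚ.* q ℚ.- p ℚ.* r
  p[q-r] p q r = trans (ℚₚ.*-distribˡ-+ p q (ℚ.- r))
    (cong (p ℚ.* q ℚ.+_) (sym (ℚₚ.neg-distribʳ-* p r)))

  telescope : ∀ u w z → (u ℚ.- w) ℚ.+ (w ℚ.- z) ≡ u ℚ.- z
  telescope u w z = trans (ℚₚ.+-assoc u (ℚ.- w) (w ℚ.- z)) (cong (u ℚ.+_)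
    (trans (sym (ℚₚ.+-assoc (ℚ.- w) w (ℚ.- z)))
      (trans (cong (ℚ._- z) (ℚₚ.+-inverseˡ w)) (ℚₚ.+-identityˡ (ℚ.- z)))))

  ac-bd : ∀ a b c d → a ℚ.* (c ℚ.- d) ℚ.+ d ℚ.* (a ℚ.- b) ≡ a ℚ.* c ℚ.- b ℚ.* d
  ac-bd a b c d = trans
    (cong₂ ℚ._+_ (p[q-r] a c d)
      (trans (p[q-r] d a b) (cong₂ ℚ._-_ (ℚₚ.*-comm d a) (ℚₚ.*-comm d b))))
    (telescope (a ℚ.* c) (a ℚ.* d) (b ℚ.* d))

  halve : ∀ {q} → 0ℚ ℚ.< q → 0ℚ ℚ.< ½ ℚ.* q
  halve {q} 0<q = ℚₚ.positive⁻¹ (½ ℚ.* q) {{ℚₚ.pos*pos⇒pos ½ q {{ℚ.positive 0<q}}}}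

  halves : ∀ q → ½ ℚ.* q ℚ.+ ½ ℚ.* q ≡ q
  halves q = trans (sym (ℚₚ.*-distribʳ-+ q ½ ½)) (ℚₚ.*-identityˡ q)

  ∣p∣≤ : ∀ {p c} → p ℚ.≤ c → ℚ.- p ℚ.≤ c → ℚ.∣ p ∣ ℚ.≤ c
  ∣p∣≤ {p} {c} p≤c -p≤c with ℚₚ.∣p∣≡p∨∣p∣≡-p p
  ... | inj₁ eq = subst (ℚ._≤ c) (sym eq) p≤c
  ... | inj₂ eq = subst (ℚ._≤ c) (sym eq) -p≤c

  ∣a∣≤∣b∣+∣a-b∣ : ∀ a b → ℚ.∣ a ∣ ℚ.≤ ℚ.∣ b ∣ ℚ.+ ℚ.∣ a ℚ.- b ∣
  ∣a∣≤∣b∣+∣a-b∣ a b = subst (λ z → ℚ.∣ z ∣ ℚ.≤ ℚ.∣ b ∣ ℚ.+ ℚ.∣ a ℚ.- b ∣)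
    (b+[a-b]≡a a b) (ℚₚ.∣p+q∣≤∣p∣+∣q∣ b (a ℚ.- b))

  ∣a-b∣≡∣b-a∣ : ∀ a b → ℚ.∣ a ℚ.- b ∣ ≡ ℚ.∣ b ℚ.- a ∣
  ∣a-b∣≡∣b-a∣ a b = trans (sym (ℚₚ.∣-p∣≡∣p∣ (a ℚ.- b)))
    (cong ℚ.∣_∣ (+ᴳ.⁻¹-anti-homo‿- a b))

  ∣a∣-∣b∣≤∣a-b∣ : ∀ a b → ℚ.∣ a ∣ ℚ.- ℚ.∣ b ∣ ℚ.≤ ℚ.∣ a ℚ.- b ∣
  ∣a∣-∣b∣≤∣a-b∣ a b = subst (ℚ.∣ a ∣ ℚ.- ℚ.∣ b ∣ ℚ.≤_)
    (+ᴳ.xyx⁻¹≈y ℚ.∣ b ∣ ℚ.∣ a ℚ.- b ∣)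
    (ℚₚ.+-monoˡ-≤ (ℚ.- ℚ.∣ b ∣) (∣a∣≤∣b∣+∣a-b∣ a b))

  ∣∣a∣-∣b∣∣≤∣a-b∣ : ∀ a b → ℚ.∣ ℚ.∣ a ∣ ℚ.- ℚ.∣ b ∣ ∣ ℚ.≤ ℚ.∣ a ℚ.- b ∣
  ∣∣a∣-∣b∣∣≤∣a-b∣ a b = ∣p∣≤ (∣a∣-∣b∣≤∣a-b∣ a b)
    (subst₂ ℚ._≤_ (sym (+ᴳ.⁻¹-anti-homo‿- ℚ.∣ a ∣ ℚ.∣ b ∣))
      (∣a-b∣≡∣b-a∣ b a) (∣a∣-∣b∣≤∣a-b∣ b a))

  -- A uniform bound on a tail of a Cauchy sequence.
  bounded : ∀ x → ∃[ B ] (0ℚ ℚ.≤ B) × ∃[ N ] ∀ n → N ℕ.≤ n → ℚ.∣ seq x n ∣ ℚ.≤ B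
  bounded x with cauchy x 1ℚ (ℚₚ.positive⁻¹ 1ℚ)
  ... | N , close =
    ℚ.∣ seq x N ∣ ℚ.+ 1ℚ ,
    ℚₚ.+-mono-≤ (ℚₚ.0≤∣p∣ (seq x N)) (ℚₚ.nonNegative⁻¹ 1ℚ) ,
    N , λ n N≤n → ℚₚ.≤-trans (∣a∣≤∣b∣+∣a-b∣ (seq x n) (seq x N))
      (ℚₚ.+-monoʳ-≤ (ℚ.∣ seq x N ∣) (close n N N≤n ℕₚ.≤-refl))

  ∣*∣-mono : ∀ {a b c d} → 0ℚ ℚ.≤ c → ℚ.∣ a ∣ ℚ.≤ c → ℚ.∣ b ∣ ℚ.≤ d → ℚ.∣ a ℚ.* b ∣ ℚ.≤ c ℚ.* d
  ∣*∣-mono {a} {b} {c} {d} 0≤c a≤c b≤d = subst (ℚ._≤ c ℚ.* d) (sym (ℚₚ.∣p*q∣≡∣p∣*∣q∣ a b))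
    (ℚₚ.≤-trans (ℚₚ.*-monoʳ-≤-nonNeg (ℚ.∣ b ∣) {{ℚₚ.∣-∣-nonNeg b}} a≤c)
                (ℚₚ.*-monoˡ-≤-nonNeg c {{ℚ.nonNegative 0≤c}} b≤d))

_+ℝ_ : ℝ → ℝ → ℝ
seq    (x +ℝ y) n = seq x n ℚ.+ seq y n
cauchy (x +ℝ y) q 0<q with cauchy x (½ ℚ.* q) (halve 0<q) | cauchy y (½ ℚ.* q) (halve 0<q)
... | M , cx | N , cy = M ℕ.⊔ N , λ m n p p′ →
  subst₂ ℚ._≤_
    (cong ℚ.∣_∣ ([a-b]+[c-d] (seq x m) (seq x n) (seq y m) (seq y n)))
    (halves q)
    (ℚₚ.≤-trans (ℚₚ.∣p+q∣≤∣p∣+∣q∣ (seq x m ℚ.- seq x n) (seq y m ℚ.- seq y n))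
      (ℚₚ.+-mono-≤
        (cx m n (ℕₚ.m⊔n≤o⇒m≤o M N p) (ℕₚ.m⊔n≤o⇒m≤o M N p′))
        (cy m n (ℕₚ.m⊔n≤o⇒n≤o M N p) (ℕₚ.m⊔n≤o⇒n≤o M N p′))))

-ℝ_ : ℝ → ℝ
seq    (-ℝ x) n = ℚ.- seq x n
cauchy (-ℝ x) q 0<q with cauchy x q 0<q
... | N , cx = N , λ m n p p′ →
  subst (ℚ._≤ q)
    (cong ℚ.∣_∣ (b-a≡[-a]-[-b] (seq x m) (seq x n)))
    (cx n m p′ p)

_-ℝ_ : ℝ → ℝ → ℝ
x -ℝ y = x +ℝ (-ℝ y)

∣_∣ℝ : ℝ → ℝ
seq    ∣ x ∣ℝ n = ℚ.∣ seq x n ∣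
cauchy ∣ x ∣ℝ q 0<q with cauchy x q 0<q
... | N , cx = N , λ m n p p′ → ℚₚ.≤-trans (∣∣a∣-∣b∣∣≤∣a-b∣ (seq x m) (seq x n)) (cx m n p p′)

_*ℝ_ : ℝ → ℝ → ℝ
seq    (x *ℝ y) n = seq x n ℚ.* seq y n
cauchy (x *ℝ y) q 0<q with bounded x | bounded y
... | A , 0≤A , Nx , ∣x∣≤A | B , 0≤B , Ny , ∣y∣≤B = result
  where
  D : ℚ
  D = (A ℚ.+ B) ℚ.+ 1ℚ
  instance
    D-pos : ℚ.Positive D
    D-pos = ℚₚ.nonNeg+pos⇒pos (A ℚ.+ B) {{ℚ.nonNegative (ℚₚ.+-mono-≤ 0≤A 0≤B)}} 1ℚ
    D-nonZero : ℚ.NonZero D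
    D-nonZero = ℚₚ.pos⇒nonZero D
  δ : ℚ
  δ = q ℚ.* ℚ.1/ D
  0<δ : 0ℚ ℚ.< δ
  0<δ = ℚₚ.positive⁻¹ δ
    {{ℚₚ.pos*pos⇒pos q {{ℚ.positive 0<q}} (ℚ.1/ D) {{ℚₚ.1/pos⇒pos D}}}}
  D*δ≡q : D ℚ.* δ ≡ q
  D*δ≡q = trans (*ˢ.x∙yz≈y∙xz D q (ℚ.1/ D))
    (trans (cong (q ℚ.*_) (ℚₚ.*-inverseʳ D)) (ℚₚ.*-identityʳ q))
  Aδ+Bδ≤q : A ℚ.* δ ℚ.+ B ℚ.* δ ℚ.≤ q
  Aδ+Bδ≤q = subst₂ ℚ._≤_ (ℚₚ.*-distribʳ-+ δ A B) D*δ≡q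
    (ℚₚ.*-monoʳ-≤-nonNeg δ {{ℚ.nonNegative (ℚₚ.<⇒≤ 0<δ)}}
      (subst (ℚ._≤ D) (ℚₚ.+-identityʳ (A ℚ.+ B)) (ℚₚ.+-monoʳ-≤ (A ℚ.+ B) (ℚₚ.nonNegative⁻¹ 1ℚ))))
  result : ∃[ N ] ∀ m n → N ℕ.≤ m → N ℕ.≤ n →
           ℚ.∣ seq x m ℚ.* seq y m ℚ.- seq x n ℚ.* seq y n ∣ ℚ.≤ q
  result with cauchy x δ 0<δ | cauchy y δ 0<δ
  ... | Mx , cx | My , cy = (Nx ℕ.⊔ Ny) ℕ.⊔ (Mx ℕ.⊔ My) , λ m n p p′ →
    let a = seq x m ; b = seq x n ; c = seq y m ; d = seq y n
        N≤m = ℕₚ.m⊔n≤o⇒m≤o (Nx ℕ.⊔ Ny) (Mx ℕ.⊔ My) p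
        N≤n = ℕₚ.m⊔n≤o⇒m≤o (Nx ℕ.⊔ Ny) (Mx ℕ.⊔ My) p′
        M≤m = ℕₚ.m⊔n≤o⇒n≤o (Nx ℕ.⊔ Ny) (Mx ℕ.⊔ My) p
        M≤n = ℕₚ.m⊔n≤o⇒n≤o (Nx ℕ.⊔ Ny) (Mx ℕ.⊔ My) p′
    in subst (ℚ._≤ q)
      (cong ℚ.∣_∣ (ac-bd a b c d))
      (ℚₚ.≤-trans (ℚₚ.∣p+q∣≤∣p∣+∣q∣ (a ℚ.* (c ℚ.- d)) (d ℚ.* (a ℚ.- b)))
        (ℚₚ.≤-trans
          (ℚₚ.+-mono-≤
            (∣*∣-mono {a} {c ℚ.- d} 0≤A (∣x∣≤A m (ℕₚ.m⊔n≤o⇒m≤o Nx Ny N≤m))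
              (cy m n (ℕₚ.m⊔n≤o⇒n≤o Mx My M≤m) (ℕₚ.m⊔n≤o⇒n≤o Mx My M≤n)))
            (∣*∣-mono {d} {a ℚ.- b} 0≤B (∣y∣≤B n (ℕₚ.m⊔n≤o⇒n≤o Nx Ny N≤n))
              (cx m n (ℕₚ.m⊔n≤o⇒m≤o Mx My M≤m) (ℕₚ.m⊔n≤o⇒m≤o Mx My M≤n))))
          Aδ+Bδ≤q))

infixr 8 _^ℝ_

_^ℝ_ : ℝ → ℕ → ℝ
x ^ℝ zero  = 1ℝ
x ^ℝ suc k = x *ℝ x ^ℝ k

------------------------------------------------------------------------
-- r-uniform hypergraphs

allSubsets : ∀ n → List (Subset n)
allSubsets zero    = [] ∷ []
allSubsets (suc n) = map (inside ∷_) (allSubsets n) ++ map (outside ∷_) (allSubsets n)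

rSubsets : ∀ r n → List (Subset n)
rSubsets r n = filter (λ e → ∣ e ∣ ℕ.≟ r) (allSubsets n)

-- An r-uniform hypergraph on Fin n is a set of positions in the list of all
-- r-subsets (each r-subset occurs there exactly once).
Hypergraph : ℕ → ℕ → Set
Hypergraph r n = Subset (length (rSubsets r n))

IsEdge : ∀ r n → Hypergraph r n → Subset n → Set
IsEdge r n H e = ∃[ i ] i ∈ H × lookup (rSubsets r n) i ≡ e

-- e = {v_{i(r-1)}, …, v_{i(r-1)+r-1}}, with vertices and edges indexed from 0.
IsSegment : ∀ r {n m} → (Fin m → Fin n) → ℕ → Subset n → Set
IsSegment r v i e = ∀ x → (x ∈ e) ⇔
  (∃[ k ] (i ℕ.* (r ∸ 1) ℕ.≤ toℕ k) × (toℕ k ℕ.< i ℕ.* (r ∸ 1) ℕ.+ r) × v k ≡ x)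

record LoosePath (r n : ℕ) (H : Hypergraph r n) (ℓ : ℕ) : Set where
  field
    vertex   : Fin (suc (ℓ ℕ.* (r ∸ 1))) → Fin n
    edge     : Fin ℓ → Subset n
    distinct : ∀ j k → vertex j ≡ vertex k → j ≡ k
    isEdge   : ∀ i → IsEdge r n H (edge i)
    segment  : ∀ i → IsSegment r vertex (toℕ i) (edge i)

-- Length 0 is the degenerate single-vertex cycle, so a hypergraph without
-- proper loose cycles has longest cycle length 0.  Length 1 never occurs for
-- r ≥ 2, since the only segment would have r-1 elements.
record LooseCycle (r n : ℕ) (H : Hypergraph r n) (ℓ : ℕ) : Set where
  field
    vertex   : Fin (suc (ℓ ℕ.* (r ∸ 1))) → Fin n
    edge     : Fin ℓ → Subset n
    closed   : vertex (fromℕ (ℓ ℕ.* (r ∸ 1))) ≡ vertex zero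
    distinct : ∀ j k → toℕ j ℕ.< ℓ ℕ.* (r ∸ 1) → toℕ k ℕ.< ℓ ℕ.* (r ∸ 1) →
               vertex j ≡ vertex k → j ≡ k
    isEdge   : ∀ i → IsEdge r n H (edge i)
    segment  : ∀ i → IsSegment r vertex (toℕ i) (edge i)

IsGreatest : (ℕ → Set) → ℕ → Set
IsGreatest P L = P L × (∀ ℓ → P ℓ → ℓ ℕ.≤ L)

------------------------------------------------------------------------
-- The binomial random hypergraph H^r(n,p)

-- p^|S| (1-p)^(N-|S|)
weight : ∀ {N} → ℝ → Subset N → ℝ
weight p []            = 1ℝ
weight p (inside  ∷ S) = p *ℝ weight p S
weight p (outside ∷ S) = (1ℝ -ℝ p) *ℝ weight p S

Pr : ∀ r n → ℝ → (Hypergraph r n → Bool) → ℝ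
Pr r n p A = foldr _+ℝ_ 0ℝ
  (map (λ H → if A H then weight p H else 0ℝ) (allSubsets (length (rSubsets r n))))

-- P(E) ≥ a.  The order on ℝ is not decidable, so an event defined through it
-- need not have an indicator function.  On this finite space P(E) is the
-- maximum of P(A) over the decidable events A ⊆ E, hence the witness A.
PrAtLeast : ∀ r n → ℝ → (Hypergraph r n → Set) → ℝ → Set
PrAtLeast r n p E a =
  Σ (Hypergraph r n → Bool) λ A → (∀ H → T (A H) → E H) × a ≤ℝ Pr r n p A

-- P(E n) → 1 as n → ∞, in H^r(n, p n).
WithHighProbability : ∀ r → (ℕ → ℝ) → (∀ n → Hypergraph r n → Set) → Set
WithHighProbability r p E = ∀ (δ : ℝ) → 0ℝ <ℝ δ →
  ∃[ N ] ∀ n → N ℕ.≤ n → PrAtLeast r n (p n) (E n) (1ℝ -ℝ δ)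

-- (1+ε) / ((r-1) binom(n-1,r-1)); the denominator vanishes only for n < r when
-- r ≥ 2, which is irrelevant as n → ∞ (as are the finitely many n where the
-- value exceeds 1).
edgeProbability : ℕ → ℝ → ℕ → ℝ
edgeProbability r ε n = (1ℝ +ℝ ε) *ℝ recip ((r ∸ 1) ℕ.* ((n ∸ 1) C (r ∸ 1)))

-- Everything is done for a rational p, since the probability of an event is evaluated pointwise along the Cauchy
-- sequence of p.  Write d = r - 1.
--
-- Let W k v be the event that a walk of k distinct edges leaves v.  By Harris' inequality and the van den Berg–Kesten
-- (BK) inequality, P(W (k+1) v) is at most 1 - (1 - p (1 - (1 - u)^d))^C(n-1,d) when u bounds P(W k v).  This recursion
-- starts at 1 and decreases to its fixed point 2ε/d + O(ε²), so a constant k gives P(W k v) ≤ 2ε/d + O(ε²).  Call an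
-- edge a centre if two of its vertices are left by edge-disjoint such walks; by BK the expected number of centres is at
-- most (n/r)·C(n-1,d)·p·C(r,2)·(2ε/d + O(ε²))² = (2ε²/d² + O(ε³)) n.
--
-- All but O(1) edges of a loose path are centres, and positions far apart on it are centres disjointly.  So a path of
-- length ℓ yields (ℓ - O(1))^j tuples of j disjointly occurring centres, while BK bounds the expected number of such
-- tuples by the j-th power of the expected number of centres.  Markov's inequality with a large constant j finishes the
-- proof for small ε; no variance has to be estimated.  For ε bounded below, K ε³ ≥ 1 and the bound is trivial.

module Submission where

-- The term `K * ε ^ 3` tolerates a relative error of order ε everywhere, and the proof spends it
-- three times. The walk recursion need not reach its fixed point: it is followed down to a level
-- `T` that is larger by a relative amount of order ε, and above `T` every step contracts by the
-- fixed factor `1 - T * T`, so the number of steps depends on r and ε alone. The threshold `X` for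
-- the number of centres exceeds the bound on its expectation by at least the factor `1 / (1 - b)`;
-- taking j-th powers turns this gap into `(1 - b) ^ j`, as small as desired. Finally, the real ε is
-- enclosed by rationals `a` and `b` with `b ≤ a + a * a`: probabilities are bounded through `b`,
-- the permitted length through `a`. The enclosure is needed because the Boolean event that
-- witnesses `PrAtLeast` must be the same for all terms of the Cauchy sequence of p. The constant
-- number of positions lost at the ends of a path and around the chosen centres is paid for by
-- `a * a * a * n` once n is large.

-- Ordered-field inequalities, powers and finite sums of rationals.

module Rationals where

  open import Algebra.Bundles using (CommutativeRing)
  import Algebra.Properties.CommutativeMonoid.Sum as CommutativeMonoidSum
  import Algebra.Properties.Semiring.Exp as SemiringExp
  import Algebra.Properties.Semiring.Sum as SemiringSum
  open import Data.Fin using (Fin; zero; suc; punchOut)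
  import Data.Fin.Properties as Finₚ
  open import Data.Integer as ℤ using (-[1+_])
  import Data.Integer.Properties as ℤₚ
  open import Data.Maybe using (just; nothing)
  open import Data.Nat as ℕ using (ℕ; zero; suc; z≤n; s≤s)
  import Data.Nat.Properties as ℕₚ
  open import Data.Product using (∃-syntax; _,_)
  open import Data.Rational
  open import Data.Rational.Properties
  import Data.Rational.Unnormalised as ℚᵘ
  import Data.Rational.Unnormalised.Properties as ℚᵘₚ
  open import Data.Vec.Functional using (removeAt)
  open import Function using (_∘_)
  open import Relation.Binary.PropositionalEquality using (_≡_; _≢_; refl; sym; trans; cong; subst; subst₂)
  open import Relation.Nullary using (yes; no; contradiction)
  open import Tactic.RingSolver using (solve-∀)
  open import Tactic.RingSolver.Core.AlmostCommutativeRing using (AlmostCommutativeRing; fromCommutativeRing)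

  open CommutativeRing +-*-commutativeRing public using (semiring; +-commutativeMonoid)
  open SemiringExp semiring public using (_^_)
  open CommutativeMonoidSum +-commutativeMonoid public using (sum; sum-cong-≗; sum-remove; ∑-comm; ∑-distrib-+)
  open SemiringSum semiring public using (*-distribˡ-sum)

  ℚ-ring : AlmostCommutativeRing _ _
  ℚ-ring = fromCommutativeRing +-*-commutativeRing λ q → isZero q
    where
    isZero : ∀ q → _
    isZero q with 0ℚ ≟ q
    ... | yes 0≡q = just 0≡q
    ... | no  _   = nothing

  0≤1 : 0ℚ ≤ 1ℚ
  0≤1 = nonNegative⁻¹ 1ℚ

  0<1 : 0ℚ < 1ℚ
  0<1 = positive⁻¹ 1ℚ

  0≤+ : ∀ {a b} → 0ℚ ≤ a → 0ℚ ≤ b → 0ℚ ≤ a + b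
  0≤+ = +-mono-≤

  0≤* : ∀ {a b} → 0ℚ ≤ a → 0ℚ ≤ b → 0ℚ ≤ a * b
  0≤* {a} {b} 0≤a 0≤b = nonNegative⁻¹ (a * b)
    {{nonNeg*nonNeg⇒nonNeg a {{nonNegative 0≤a}} b {{nonNegative 0≤b}}}}

  0<* : ∀ {a b} → 0ℚ < a → 0ℚ < b → 0ℚ < a * b
  0<* {a} {b} 0<a 0<b = positive⁻¹ (a * b) {{pos*pos⇒pos a {{positive 0<a}} b {{positive 0<b}}}}

  ≤⇒0≤- : ∀ {a b} → a ≤ b → 0ℚ ≤ b - a
  ≤⇒0≤- {a} {b} a≤b = subst (_≤ b - a) (+-inverseʳ a) (+-monoˡ-≤ (- a) a≤b)

  slack : ∀ {a b} c → 0ℚ ≤ c → a + c ≡ b → a ≤ b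
  slack {a} c 0≤c a+c≡b = subst₂ _≤_ (+-identityʳ a) a+c≡b (+-monoʳ-≤ a 0≤c)

  0≤-⇒≤ : ∀ {a b} → 0ℚ ≤ b - a → a ≤ b
  0≤-⇒≤ {a} {b} 0≤b-a = slack (b - a) 0≤b-a (lem a b)
    where
    lem : ∀ a b → a + (b - a) ≡ b
    lem = solve-∀ ℚ-ring

  1-antitone : ∀ {a b} → a ≤ b → 1ℚ - b ≤ 1ℚ - a
  1-antitone a≤b = +-monoʳ-≤ 1ℚ (neg-antimono-≤ a≤b)

  *-monoˡ : ∀ {a b} c → 0ℚ ≤ c → a ≤ b → c * a ≤ c * b
  *-monoˡ c 0≤c = *-monoˡ-≤-nonNeg c {{nonNegative 0≤c}}

  *-monoʳ : ∀ {a b} c → 0ℚ ≤ c → a ≤ b → a * c ≤ b * c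
  *-monoʳ c 0≤c = *-monoʳ-≤-nonNeg c {{nonNegative 0≤c}}

  *-mono : ∀ {a b c d} → 0ℚ ≤ a → 0ℚ ≤ d → a ≤ b → c ≤ d → a * c ≤ b * d
  *-mono {a} {b} {c} {d} 0≤a 0≤d a≤b c≤d = ≤-trans (*-monoˡ a 0≤a c≤d) (*-monoʳ d 0≤d a≤b)

  *-cancelʳ : ∀ {a b} c → 0ℚ < c → a * c ≤ b * c → a ≤ b
  *-cancelʳ c 0<c = *-cancelʳ-≤-pos c {{positive 0<c}}

  0≤^ : ∀ {a} m → 0ℚ ≤ a → 0ℚ ≤ a ^ m
  0≤^ zero    0≤a = 0≤1
  0≤^ (suc m) 0≤a = 0≤* 0≤a (0≤^ m 0≤a)

  ^-mono : ∀ {a b} m → 0ℚ ≤ a → a ≤ b → a ^ m ≤ b ^ m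
  ^-mono zero    0≤a a≤b = ≤-refl
  ^-mono (suc m) 0≤a a≤b = *-mono 0≤a (0≤^ m (≤-trans 0≤a a≤b)) a≤b (^-mono m 0≤a a≤b)

  ^-distrib-* : ∀ a b m → (a * b) ^ m ≡ a ^ m * b ^ m
  ^-distrib-* a b zero    = refl
  ^-distrib-* a b (suc m) = trans (cong (a * b *_) (^-distrib-* a b m)) (lem a b (a ^ m) (b ^ m))
    where
    lem : ∀ a b x y → a * b * (x * y) ≡ a * x * (b * y)
    lem = solve-∀ ℚ-ring

  ^-≤1 : ∀ {a} m → 0ℚ ≤ a → a ≤ 1ℚ → a ^ m ≤ 1ℚ
  ^-≤1 zero    0≤a a≤1 = ≤-refl
  ^-≤1 (suc m) 0≤a a≤1 = *-mono 0≤a 0≤1 a≤1 (^-≤1 m 0≤a a≤1)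

  ^-antitone-exponent : ∀ {a m n} → 0ℚ ≤ a → a ≤ 1ℚ → m ℕ.≤ n → a ^ n ≤ a ^ m
  ^-antitone-exponent {n = n} 0≤a a≤1 z≤n       = ^-≤1 n 0≤a a≤1
  ^-antitone-exponent {a}     0≤a a≤1 (s≤s m≤n) = *-monoˡ a 0≤a (^-antitone-exponent 0≤a a≤1 m≤n)

  fromℕ : ℕ → ℚ
  fromℕ n = ℤ.+ n / 1

  private
    toℚᵘ-fromℕ : ∀ n → toℚᵘ (fromℕ n) ℚᵘ.≃ ℚᵘ.mkℚᵘ (ℤ.+ n) 0
    toℚᵘ-fromℕ n = toℚᵘ-fromℚᵘ (ℚᵘ.mkℚᵘ (ℤ.+ n) 0)

  fromℕ-suc : ∀ n → fromℕ (suc n) ≡ 1ℚ + fromℕ n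
  fromℕ-suc n = toℚᵘ-injective (ℚᵘₚ.≃-trans (toℚᵘ-fromℕ (suc n)) (ℚᵘₚ.≃-sym
    (ℚᵘₚ.≃-trans (toℚᵘ-homo-+ 1ℚ (fromℕ n))
      (ℚᵘₚ.≃-trans (ℚᵘₚ.+-congʳ (toℚᵘ 1ℚ) (toℚᵘ-fromℕ n)) (ℚᵘ.*≡* eq)))))
    where
    eq : (ℤ.+ 1 ℤ.* ℤ.+ 1 ℤ.+ ℤ.+ n ℤ.* ℤ.+ 1) ℤ.* ℤ.+ 1 ≡ ℤ.+ suc n ℤ.* (ℤ.+ 1 ℤ.* ℤ.+ 1)
    eq = trans (ℤₚ.*-identityʳ _) (trans (cong (ℤ._+_ (ℤ.+ 1)) (ℤₚ.*-identityʳ (ℤ.+ n)))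
      (sym (ℤₚ.*-identityʳ (ℤ.+ suc n))))

  fromℕ-+ : ∀ m n → fromℕ (m ℕ.+ n) ≡ fromℕ m + fromℕ n
  fromℕ-+ zero    n = sym (+-identityˡ (fromℕ n))
  fromℕ-+ (suc m) n = trans (fromℕ-suc (m ℕ.+ n)) (trans (cong (1ℚ +_) (fromℕ-+ m n))
    (trans (sym (+-assoc 1ℚ (fromℕ m) (fromℕ n))) (cong (_+ fromℕ n) (sym (fromℕ-suc m)))))

  fromℕ-* : ∀ m n → fromℕ (m ℕ.* n) ≡ fromℕ m * fromℕ n
  fromℕ-* zero    n = sym (*-zeroˡ (fromℕ n))
  fromℕ-* (suc m) n = trans (fromℕ-+ n (m ℕ.* n)) (trans (cong (fromℕ n +_) (fromℕ-* m n))
    (trans (lem (fromℕ m) (fromℕ n)) (cong (_* fromℕ n) (sym (fromℕ-suc m)))))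
    where
    lem : ∀ x y → y + x * y ≡ (1ℚ + x) * y
    lem = solve-∀ ℚ-ring

  0≤fromℕ : ∀ n → 0ℚ ≤ fromℕ n
  0≤fromℕ zero    = ≤-refl
  0≤fromℕ (suc n) = subst (0ℚ ≤_) (sym (fromℕ-suc n)) (0≤+ 0≤1 (0≤fromℕ n))

  fromℕ-mono : ∀ {m n} → m ℕ.≤ n → fromℕ m ≤ fromℕ n
  fromℕ-mono {m} {n} m≤n = slack (fromℕ (n ℕ.∸ m)) (0≤fromℕ (n ℕ.∸ m))
    (trans (sym (fromℕ-+ m (n ℕ.∸ m))) (cong fromℕ (ℕₚ.m+[n∸m]≡n m≤n)))

  archimedean : ∀ x {y} → 0ℚ < y → ∃[ m ] x ≤ fromℕ m * y
  archimedean x@record{} {y@(mkℚ -[1+ _ ] _ _)} 0<y = contradiction 0<y (<-asym (negative⁻¹ y))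
  archimedean x@record{} {y@(mkℚ (ℤ.+ zero) _ _)} 0<y = contradiction (positive 0<y) λ ()
  archimedean x@record{} {y@(mkℚ (ℤ.+ suc k) d-1 _)} 0<y = m ℕ.* d ,
    subst (x ≤_) (sym (trans (cong (_* y) (fromℕ-* m d)) (*-assoc (fromℕ m) (fromℕ d) y)))
      (≤-trans x≤m (subst (_≤ fromℕ m * (fromℕ d * y)) (*-identityʳ (fromℕ m))
        (*-monoˡ (fromℕ m) (0≤fromℕ m) 1≤dy)))
    where
    m d : ℕ
    m = ℤ.∣ ↥ x ∣
    d = suc d-1
    i≤∣i∣ : ∀ i → i ℤ.≤ ℤ.+ ℤ.∣ i ∣
    i≤∣i∣ (ℤ.+ n)    = ℤₚ.≤-refl
    i≤∣i∣ -[1+ n ] = ℤ.-≤+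
    x≤m : x ≤ fromℕ m
    x≤m = toℚᵘ-cancel-≤ (ℚᵘₚ.≤-respʳ-≃ (ℚᵘₚ.≃-sym (toℚᵘ-fromℕ m)) (ℚᵘ.*≤*
      (ℤₚ.≤-trans (ℤₚ.≤-reflexive (ℤₚ.*-identityʳ (↥ x))) (ℤₚ.≤-trans (i≤∣i∣ (↥ x))
        (subst (ℤ.+ m ℤ.≤_) (ℤₚ.pos-* m (↧ₙ x)) (ℤ.+≤+ (ℕₚ.m≤m*n m (↧ₙ x))))))))
    1≤dy : 1ℚ ≤ fromℕ d * y
    1≤dy = toℚᵘ-cancel-≤ (ℚᵘₚ.≤-respʳ-≃ (ℚᵘₚ.≃-sym (ℚᵘₚ.≃-trans (toℚᵘ-homo-* (fromℕ d) y)
        (ℚᵘₚ.*-congʳ {toℚᵘ y} (toℚᵘ-fromℕ d))))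
      (ℚᵘ.*≤* (subst₂ ℤ._≤_ (sym (ℤₚ.*-identityˡ (ℤ.+ (1 ℕ.* d))))
        (trans (ℤₚ.pos-* d (suc k)) (sym (ℤₚ.*-identityʳ _)))
        (ℤ.+≤+ (subst (ℕ._≤ d ℕ.* suc k) (sym (ℕₚ.*-identityˡ d)) (ℕₚ.m≤m*n d (suc k)))))))

  -- Division-free form of (1 - x)^m ≤ 1/(1 + m x), the estimate of powers behind `^-small`,
  -- `geometric-padé` and `s-lower`. In the induction, (1 - x)(1 + (m + 1) x) falls short of 1 + m x
  -- by (m + 1) x².
  bernoulli : ∀ {x} m → 0ℚ ≤ x → x ≤ 1ℚ → (1ℚ - x) ^ m * (1ℚ + fromℕ m * x) ≤ 1ℚ
  bernoulli {x} zero    0≤x x≤1 = ≤-reflexive (lem x)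
    where
    lem : ∀ x → 1ℚ * (1ℚ + 0ℚ * x) ≡ 1ℚ
    lem = solve-∀ ℚ-ring
  bernoulli {x} (suc m) 0≤x x≤1 = ≤-trans
    (subst (λ z → (1ℚ - x) ^ suc m * (1ℚ + z * x) ≤ a * (1ℚ + fromℕ m * x)) (sym (fromℕ-suc m))
      (slack (a * ((1ℚ + fromℕ m) * (x * x)))
        (0≤* (0≤^ m (≤⇒0≤- x≤1)) (0≤* (0≤+ 0≤1 (0≤fromℕ m)) (0≤* 0≤x 0≤x)))
        (lem x a (fromℕ m))))
    (bernoulli m 0≤x x≤1)
    where
    a : ℚ
    a = (1ℚ - x) ^ m
    lem : ∀ x a k → (1ℚ - x) * a * (1ℚ + (1ℚ + k) * x) + a * ((1ℚ + k) * (x * x)) ≡ a * (1ℚ + k * x)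
    lem = solve-∀ ℚ-ring

  ^-small : ∀ {x δ} → 0ℚ < x → x ≤ 1ℚ → 0ℚ < δ → ∃[ m ] (1ℚ - x) ^ m ≤ δ
  ^-small {x} {δ} 0<x x≤1 0<δ with archimedean 1ℚ (0<* 0<δ 0<x)
  ... | m , 1≤mδx = m , *-cancelʳ (1ℚ + fromℕ m * x)
          (<-≤-trans 0<1 (slack (fromℕ m * x) (0≤* (0≤fromℕ m) 0≤x) refl))
          (≤-trans (bernoulli m 0≤x x≤1) (≤-trans 1≤mδx (slack δ (<⇒≤ 0<δ) (lem δ x (fromℕ m)))))
    where
    0≤x : 0ℚ ≤ x
    0≤x = <⇒≤ 0<x
    lem : ∀ δ x k → k * (δ * x) + δ ≡ δ * (1ℚ + k * x)
    lem = solve-∀ ℚ-ring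

  sum-mono : ∀ {n} {f g : Fin n → ℚ} → (∀ i → f i ≤ g i) → sum f ≤ sum g
  sum-mono {zero}  f≤g = ≤-refl
  sum-mono {suc n} f≤g = +-mono-≤ (f≤g zero) (sum-mono (f≤g ∘ suc))

  0≤sum : ∀ {n} {f : Fin n → ℚ} → (∀ i → 0ℚ ≤ f i) → 0ℚ ≤ sum f
  0≤sum {zero}  0≤f = ≤-refl
  0≤sum {suc n} 0≤f = 0≤+ (0≤f zero) (0≤sum (0≤f ∘ suc))

  sum-const : ∀ n c → sum {n} (λ _ → c) ≡ fromℕ n * c
  sum-const zero    c = sym (*-zeroˡ c)
  sum-const (suc n) c = trans (cong (c +_) (sum-const n c))
    (trans (lem (fromℕ n) c) (cong (_* c) (sym (fromℕ-suc n))))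
    where
    lem : ∀ k c → c + k * c ≡ (1ℚ + k) * c
    lem = solve-∀ ℚ-ring

  sum-injective-≤ : ∀ {m n} (g : Fin m → Fin n) → (∀ i j → g i ≡ g j → i ≡ j) →
                    (f : Fin n → ℚ) → (∀ i → 0ℚ ≤ f i) → sum (f ∘ g) ≤ sum f
  sum-injective-≤ {zero}          g inj f 0≤f = 0≤sum 0≤f
  sum-injective-≤ {suc m} {zero}  g inj f 0≤f with () ← g zero
  sum-injective-≤ {suc m} {suc n} g inj f 0≤f =
    subst₂ _≤_ (cong (f (g zero) +_) (sum-cong-≗ λ i → cong f (Finₚ.punchIn-punchOut (g0≢ i))))
      (sym (sum-remove {i = g zero} f))
      (+-monoʳ-≤ (f (g zero)) (sum-injective-≤ g′ g′-inj (removeAt f (g zero)) λ i → 0≤f _))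
    where
    g0≢ : ∀ i → g zero ≢ g (suc i)
    g0≢ i eq with () ← inj zero (suc i) eq
    g′ : Fin m → Fin n
    g′ i = punchOut (g0≢ i)
    g′-inj : ∀ i j → g′ i ≡ g′ j → i ≡ j
    g′-inj i j eq = Finₚ.suc-injective (inj (suc i) (suc j) (Finₚ.punchOut-injective (g0≢ i) (g0≢ j) eq))

-- The product measure on subsets, with the Harris and BK inequalities.

module RandomSubsets where

  open import Data.Bool using (Bool; true; false; _∧_; _∨_; T; if_then_else_)
  open import Data.Bool.Properties using (T-∨; T-∧; T-≡)
  open import Data.Fin using (Fin; zero; suc)
  open import Data.Fin.Subset using (Subset; inside; outside; _∈_; _⊆_)
  open import Data.Fin.Subset.Properties using (drop-∷-⊆; out⊆; s⊆s; ⊆-refl)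
  open import Data.Bool.ListAction using (any)
  open import Data.List using (List; []; _∷_; length)
  open import Data.List.Membership.Propositional renaming (_∈_ to _∈ˡ_)
  open import Data.List.Relation.Unary.Any using (here; there)
  open import Data.Nat using (ℕ; zero; suc)
  open import Data.Product using (_,_)
  open import Data.Rational using (ℚ; 0ℚ; 1ℚ; _+_; _*_; _-_; -_; _≤_)
  open import Data.Rational.Properties
  open import Data.Sum using (inj₁; inj₂; [_,_])
  open import Data.Vec using ([]; _∷_; lookup; here; there)
  open import Data.Vec.Properties using ([]=⇒lookup; lookup⇒[]=)
  open import Function using (_∘_; Equivalence)
  open import Relation.Binary.PropositionalEquality using (_≡_; refl; sym; trans; cong; cong₂; subst; subst₂)
  open import Relation.Nullary using (¬_; contradiction)
  open import Tactic.RingSolver using (solve-∀)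

  open Rationals
  open Equivalence using (to; from)

  Event : ℕ → Set
  Event N = Subset N → Bool

  𝟙 : Bool → ℚ
  𝟙 b = if b then 1ℚ else 0ℚ

  0≤𝟙 : ∀ b → 0ℚ ≤ 𝟙 b
  0≤𝟙 true  = 0≤1
  0≤𝟙 false = ≤-refl

  𝟙≤1 : ∀ b → 𝟙 b ≤ 1ℚ
  𝟙≤1 true  = ≤-refl
  𝟙≤1 false = 0≤1

  -- Conditioning on the first coordinate is built in, so that Harris and BK become inductions
  -- exposing one coordinate at a time.
  E : ∀ {N} → ℚ → (Subset N → ℚ) → ℚ
  E {zero}  p f = f []
  E {suc N} p f = p * E p (f ∘ (inside ∷_)) + (1ℚ - p) * E p (f ∘ (outside ∷_))

  P : ∀ {N} → ℚ → Event N → ℚ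
  P p A = E p (𝟙 ∘ A)

  infix 4 _⊑_
  _⊑_ : ∀ {N} → Event N → Event N → Set
  A ⊑ B = ∀ S → T (A S) → T (B S)

  Monotone : ∀ {N} → Event N → Set
  Monotone A = ∀ {S S′} → S ⊆ S′ → T (A S) → T (A S′)

  _⋓_ : ∀ {N} → Event N → Event N → Event N
  (A ⋓ B) S = A S ∨ B S

  ∨-map : ∀ a {b} c {d} → (T a → T c) → (T b → T d) → T (a ∨ b) → T (c ∨ d)
  ∨-map a c f g h = from (T-∨ {c}) ([ inj₁ ∘ f , inj₂ ∘ g ] (to (T-∨ {a}) h))

  ⋃ : ∀ {X : Set} {N} → List X → (X → Event N) → Event N
  ⋃ xs A S = any (λ x → A x S) xs

  has : ∀ {N} → Fin N → Event N
  has i S = lookup S i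

  -- The van den Berg–Kesten box A □ B for increasing A and B, by cases on who uses the first coordinate.
  infixr 6 _□_
  _□_ : ∀ {N} → Event N → Event N → Event N
  (A □ B) []            = A [] ∧ B []
  (A □ B) (inside  ∷ S) = (A ∘ (inside ∷_) □ B ∘ (outside ∷_)) S ∨ (A ∘ (outside ∷_) □ B ∘ (inside ∷_)) S
  (A □ B) (outside ∷ S) = (A ∘ (outside ∷_) □ B ∘ (outside ∷_)) S

  section : ∀ {N} {A : Event (suc N)} x → Monotone A → Monotone (A ∘ (x ∷_))
  section x mono S⊆S′ = mono (s⊆s S⊆S′)

  outside⊑inside : ∀ {N} {A : Event (suc N)} → Monotone A → A ∘ (outside ∷_) ⊑ A ∘ (inside ∷_)
  outside⊑inside mono S = mono (out⊆ ⊆-refl)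

  has⇒∈ : ∀ {N} {i : Fin N} {S} → T (has i S) → i ∈ S
  has⇒∈ {i = i} {S} h = lookup⇒[]= i S (to T-≡ h)

  ∈⇒has : ∀ {N} {i : Fin N} {S} → i ∈ S → T (has i S)
  ∈⇒has i∈S = from T-≡ ([]=⇒lookup i∈S)

  has-monotone : ∀ {N} (i : Fin N) → Monotone (has i)
  has-monotone i S⊆S′ h = ∈⇒has (S⊆S′ (has⇒∈ h))

  true-monotone : ∀ {N} → Monotone {N} (λ _ → true)
  true-monotone _ t = t

  ⋓-monotone : ∀ {N} {A B : Event N} → Monotone A → Monotone B → Monotone (A ⋓ B)
  ⋓-monotone {A = A} mA mB S⊆S′ h = ∨-map (A _) (A _) (mA S⊆S′) (mB S⊆S′) h

  ⋃-monotone : ∀ {X : Set} {N} (xs : List X) {A : X → Event N} → (∀ x → Monotone (A x)) → Monotone (⋃ xs A)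
  ⋃-monotone (x ∷ xs) mA = ⋓-monotone (mA x) (⋃-monotone xs mA)

  ∈⇒⋃ : ∀ {X : Set} {N} {xs : List X} {x} (A : X → Event N) → x ∈ˡ xs → A x ⊑ ⋃ xs A
  ∈⇒⋃ A (here refl) S h = from T-∨ (inj₁ h)
  ∈⇒⋃ {xs = y ∷ _} A (there x∈) S h = from (T-∨ {A y S}) (inj₂ (∈⇒⋃ A x∈ S h))

  □-mono : ∀ {N} {A A′ B B′ : Event N} → A ⊑ A′ → B ⊑ B′ → A □ B ⊑ A′ □ B′
  □-mono f g []            h with a , b ← to T-∧ h = from T-∧ (f [] a , g [] b)
  □-mono f g (outside ∷ S) h = □-mono (f ∘ (outside ∷_)) (g ∘ (outside ∷_)) S h
  □-mono {A = A} {A′} {B} {B′} f g (inside ∷ S) h =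
    ∨-map ((A ∘ (inside ∷_) □ B ∘ (outside ∷_)) S) ((A′ ∘ (inside ∷_) □ B′ ∘ (outside ∷_)) S)
      (□-mono (f ∘ (inside ∷_)) (g ∘ (outside ∷_)) S) (□-mono (f ∘ (outside ∷_)) (g ∘ (inside ∷_)) S) h

  -- The passage from the usual disjoint witnesses to the recursive box. A coordinate of `U` outside
  -- `S` is handed to `B` whether or not `S′` contains it, which monotonicity of `B` permits.
  □-intro : ∀ {N} {A B : Event N} → Monotone A → Monotone B → ∀ {S S′ U} →
            T (A S) → T (B S′) → (∀ {i} → i ∈ S → ¬ i ∈ S′) → S ⊆ U → S′ ⊆ U → T ((A □ B) U)
  □-intro mA mB {[]} {[]} {[]} a b _ _ _ = from T-∧ (a , b)
  □-intro mA mB {inside ∷ S} {inside ∷ S′} a b disj _ _ = contradiction here (disj here)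
  □-intro mA mB {inside ∷ S} {_} {outside ∷ U} a b _ S⊆U _ with () ← S⊆U here
  □-intro mA mB {_} {inside ∷ S′} {outside ∷ U} a b _ _ S′⊆U with () ← S′⊆U here
  □-intro mA mB {outside ∷ S} {outside ∷ S′} {outside ∷ U} a b disj S⊆U S′⊆U =
    □-intro (section outside mA) (section outside mB) a b
      (λ i∈S i∈S′ → disj (there i∈S) (there i∈S′)) (drop-∷-⊆ S⊆U) (drop-∷-⊆ S′⊆U)
  □-intro mA mB {inside ∷ S} {outside ∷ S′} {inside ∷ U} a b disj S⊆U S′⊆U = from T-∨ (inj₁
    (□-intro (section inside mA) (section outside mB) a b
      (λ i∈S i∈S′ → disj (there i∈S) (there i∈S′)) (drop-∷-⊆ S⊆U) (drop-∷-⊆ S′⊆U)))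
  □-intro {A = A} {B} mA mB {outside ∷ S} {x ∷ S′} {inside ∷ U} a b disj S⊆U S′⊆U =
    from (T-∨ {(A ∘ (inside ∷_) □ B ∘ (outside ∷_)) U}) (inj₂
    (□-intro (section outside mA) (section inside mB) a (mB (x⊆in x) b)
      (λ i∈S i∈S′ → disj (there i∈S) (there i∈S′)) (drop-∷-⊆ S⊆U) (drop-∷-⊆ S′⊆U)))
    where
    x⊆in : ∀ x → x ∷ S′ ⊆ inside ∷ S′
    x⊆in inside  = ⊆-refl
    x⊆in outside = out⊆ ⊆-refl

  □-monotone : ∀ {N} {A B : Event N} → Monotone A → Monotone B → Monotone (A □ B)
  □-monotone mA mB {[]} {[]} S⊆S′ h = h
  □-monotone mA mB {outside ∷ S} {outside ∷ S′} S⊆S′ h =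
    □-monotone (section outside mA) (section outside mB) (drop-∷-⊆ S⊆S′) h
  □-monotone mA mB {outside ∷ S} {inside ∷ S′} S⊆S′ h = from T-∨ (inj₁
    (□-mono (outside⊑inside mA) (λ _ b → b) S′
      (□-monotone (section outside mA) (section outside mB) (drop-∷-⊆ S⊆S′) h)))
  □-monotone mA mB {inside ∷ S} {outside ∷ S′} S⊆S′ h with () ← S⊆S′ here
  □-monotone {A = A} {B} mA mB {inside ∷ S} {inside ∷ S′} S⊆S′ h =
    ∨-map ((A ∘ (inside ∷_) □ B ∘ (outside ∷_)) S) ((A ∘ (inside ∷_) □ B ∘ (outside ∷_)) S′)
      (□-monotone (section inside mA) (section outside mB) (drop-∷-⊆ S⊆S′))
      (□-monotone (section outside mA) (section inside mB) (drop-∷-⊆ S⊆S′)) h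

  E-const : ∀ {N} p c → E {N} p (λ _ → c) ≡ c
  E-const {zero}  p c = refl
  E-const {suc N} p c = trans (cong (λ x → p * x + (1ℚ - p) * x) (E-const {N} p c)) (lem p c)
    where
    lem : ∀ p c → p * c + (1ℚ - p) * c ≡ c
    lem = solve-∀ ℚ-ring

  E-+ : ∀ {N} p (f g : Subset N → ℚ) → E p (λ S → f S + g S) ≡ E p f + E p g
  E-+ {zero}  p f g = refl
  E-+ {suc N} p f g = trans (cong₂ (λ x y → p * x + (1ℚ - p) * y) 
      (E-+ p (f ∘ (inside ∷_)) (g ∘ (inside ∷_))) (E-+ p (f ∘ (outside ∷_)) (g ∘ (outside ∷_))))
      (lem p (E p (f ∘ (inside ∷_))) (E p (g ∘ (inside ∷_))) (E p (f ∘ (outside ∷_))) (E p (g ∘ (outside ∷_))))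
    where
    lem : ∀ p a b c d → p * (a + b) + (1ℚ - p) * (c + d) ≡ (p * a + (1ℚ - p) * c) + (p * b + (1ℚ - p) * d)
    lem = solve-∀ ℚ-ring

  E-* : ∀ {N} p c (f : Subset N → ℚ) → E p (λ S → c * f S) ≡ c * E p f
  E-* {zero}  p c f = refl
  E-* {suc N} p c f = trans (cong₂ (λ x y → p * x + (1ℚ - p) * y) (E-* p c (f ∘ (inside ∷_))) (E-* p c (f ∘ (outside ∷_))))
      (lem p c (E p (f ∘ (inside ∷_))) (E p (f ∘ (outside ∷_))))
    where
    lem : ∀ p c x y → p * (c * x) + (1ℚ - p) * (c * y) ≡ c * (p * x + (1ℚ - p) * y)
    lem = solve-∀ ℚ-ring

  E-sum : ∀ {N m} p (f : Fin m → Subset N → ℚ) → E p (λ S → sum (λ i → f i S)) ≡ sum (λ i → E p (f i))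
  E-sum {N} {zero} p f = E-const {N} p 0ℚ
  E-sum {N} {suc m} p f = trans (E-+ p (f zero) (λ S → sum (λ i → f (suc i) S))) (cong (E p (f zero) +_) (E-sum p (f ∘ suc)))

  module _ {p : ℚ} (0≤p : 0ℚ ≤ p) (p≤1 : p ≤ 1ℚ) where

    private
      0≤1-p : 0ℚ ≤ 1ℚ - p
      0≤1-p = ≤⇒0≤- p≤1

    E-mono : ∀ {N} {f g : Subset N → ℚ} → (∀ S → f S ≤ g S) → E p f ≤ E p g
    E-mono {zero}  f≤g = f≤g []
    E-mono {suc N} f≤g = +-mono-≤ (*-monoˡ p 0≤p (E-mono (f≤g ∘ (inside ∷_))))
      (*-monoˡ (1ℚ - p) 0≤1-p (E-mono (f≤g ∘ (outside ∷_))))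

    0≤E : ∀ {N} {f : Subset N → ℚ} → (∀ S → 0ℚ ≤ f S) → 0ℚ ≤ E p f
    0≤E {N} {f} 0≤f = subst (_≤ E p f) (E-const {N} p 0ℚ) (E-mono 0≤f)

    0≤P : ∀ {N} (A : Event N) → 0ℚ ≤ P p A
    0≤P A = 0≤E (0≤𝟙 ∘ A)

    P≤1 : ∀ {N} (A : Event N) → P p A ≤ 1ℚ
    P≤1 {N} A = subst (P p A ≤_) (E-const {N} p 1ℚ) (E-mono (𝟙≤1 ∘ A))

    P-mono : ∀ {N} {A B : Event N} → A ⊑ B → P p A ≤ P p B
    P-mono {A = A} {B} A⊑B = E-mono λ S → 𝟙-mono (A S) (B S) (A⊑B S)
      where
      𝟙-mono : ∀ a b → (T a → T b) → 𝟙 a ≤ 𝟙 b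
      𝟙-mono true  true  _ = ≤-refl
      𝟙-mono true  false h with () ← h _
      𝟙-mono false b     _ = 0≤𝟙 b

    -- Inclusion-exclusion with the intersection weakened to any `C` below both events. The empty
    -- `C` yields the union bound; `bk` takes for `C` the box of the two outside sections.
    P-⋓+ : ∀ {N} {A B C : Event N} → C ⊑ A → C ⊑ B → P p (A ⋓ B) + P p C ≤ P p A + P p B
    P-⋓+ {A = A} {B} {C} C⊑A C⊑B = subst₂ _≤_ (E-+ p (𝟙 ∘ (A ⋓ B)) (𝟙 ∘ C)) (E-+ p (𝟙 ∘ A) (𝟙 ∘ B))
      (E-mono λ S → 𝟙-⋓+ (A S) (B S) (C S) (C⊑A S) (C⊑B S))
      where
      𝟙-⋓+ : ∀ a b c → (T c → T a) → (T c → T b) → 𝟙 (a ∨ b) + 𝟙 c ≤ 𝟙 a + 𝟙 b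
      𝟙-⋓+ true  true  c     _ _ = +-monoʳ-≤ 1ℚ (𝟙≤1 c)
      𝟙-⋓+ false true  true  f g with () ← f _
      𝟙-⋓+ true  false true  f g with () ← g _
      𝟙-⋓+ false false true  f g with () ← g _
      𝟙-⋓+ true  false false _ _ = ≤-refl
      𝟙-⋓+ false true  false _ _ = ≤-refl
      𝟙-⋓+ false false false _ _ = ≤-refl

    union-bound : ∀ {X : Set} {N} (xs : List X) (A : X → Event N) {c} → (∀ x → P p (A x) ≤ c) →
                  P p (⋃ xs A) ≤ fromℕ (length xs) * c
    union-bound {N = N} [] A {c} _ = ≤-reflexive (trans (E-const {N} p 0ℚ) (sym (*-zeroˡ c)))
    union-bound {N = N} (x ∷ xs) A {c} A≤c = subst (P p (⋃ (x ∷ xs) A) ≤_) (eq (length xs))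
      (≤-trans
        (subst (_≤ P p (A x) + P p (⋃ xs A))
          (trans (cong (P p (⋃ (x ∷ xs) A) +_) (E-const {N} p 0ℚ)) (+-identityʳ (P p (⋃ (x ∷ xs) A))))
          (P-⋓+ {A = A x} {⋃ xs A} {λ _ → false} (λ _ ()) (λ _ ())))
        (+-mono-≤ (A≤c x) (union-bound xs A A≤c)))
      where
      lem : ∀ c k → c + k * c ≡ (1ℚ + k) * c
      lem = solve-∀ ℚ-ring
      eq : ∀ k → c + fromℕ k * c ≡ fromℕ (suc k) * c
      eq k = trans (lem c (fromℕ k)) (cong (_* c) (sym (fromℕ-suc k)))

    -- Phrased for complements, as `P-⋃` iterates it. After conditioning on the first coordinate the
    -- two sides differ by the covariance `p * (1 - p) * ((a₁ - a₀) * (b₁ - b₀))`, nonnegative for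
    -- increasing events.
    harris : ∀ {N} {A B : Event N} → Monotone A → Monotone B →
             (1ℚ - P p A) * (1ℚ - P p B) ≤ 1ℚ - P p (A ⋓ B)
    harris {zero} {A} {B} mA mB = base (A []) (B [])
      where
      base : ∀ a b → (1ℚ - 𝟙 a) * (1ℚ - 𝟙 b) ≤ 1ℚ - 𝟙 (a ∨ b)
      base true  true  = ≤-refl
      base true  false = ≤-refl
      base false true  = ≤-refl
      base false false = ≤-refl
    harris {suc N} {A} {B} mA mB = ≤-trans
      (slack (p * (1ℚ - p) * ((a₁ - a₀) * (b₁ - b₀)))
        (0≤* (0≤* 0≤p 0≤1-p) (0≤* (≤⇒0≤- (P-mono (outside⊑inside mA))) (≤⇒0≤- (P-mono (outside⊑inside mB)))))
        (lem p a₀ a₁ b₀ b₁))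
      (subst (p * ((1ℚ - a₁) * (1ℚ - b₁)) + (1ℚ - p) * ((1ℚ - a₀) * (1ℚ - b₀)) ≤_) (lem′ p (P p (A₁ ⋓ B₁)) (P p (A₀ ⋓ B₀)))
        (+-mono-≤ (*-monoˡ p 0≤p (harris (section inside mA) (section inside mB)))
                  (*-monoˡ (1ℚ - p) 0≤1-p (harris (section outside mA) (section outside mB)))))
      where
      A₁ A₀ B₁ B₀ : Event N
      A₁ = A ∘ (inside ∷_)
      A₀ = A ∘ (outside ∷_)
      B₁ = B ∘ (inside ∷_)
      B₀ = B ∘ (outside ∷_)
      a₁ a₀ b₁ b₀ : ℚ
      a₁ = P p A₁
      a₀ = P p A₀
      b₁ = P p B₁
      b₀ = P p B₀
      lem : ∀ p a₀ a₁ b₀ b₁ →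
        (1ℚ - (p * a₁ + (1ℚ - p) * a₀)) * (1ℚ - (p * b₁ + (1ℚ - p) * b₀)) + p * (1ℚ - p) * ((a₁ - a₀) * (b₁ - b₀)) ≡
        p * ((1ℚ - a₁) * (1ℚ - b₁)) + (1ℚ - p) * ((1ℚ - a₀) * (1ℚ - b₀))
      lem = solve-∀ ℚ-ring
      lem′ : ∀ p x y → p * (1ℚ - x) + (1ℚ - p) * (1ℚ - y) ≡ 1ℚ - (p * x + (1ℚ - p) * y)
      lem′ = solve-∀ ℚ-ring

    -- The union bound `length xs * c` would not do here: it turns the walk recursion into
    -- multiplication by 1 + ε, which only grows. The second-order saving of the product form is
    -- what creates the nonzero fixed point.
    P-⋃ : ∀ {X : Set} {N} (xs : List X) {A : X → Event N} {c} → c ≤ 1ℚ → (∀ x → Monotone (A x)) →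
          (∀ {x} → x ∈ˡ xs → P p (A x) ≤ c) → P p (⋃ xs A) ≤ 1ℚ - (1ℚ - c) ^ length xs
    P-⋃ {N = N} [] c≤1 mA A≤c = ≤-reflexive (trans (E-const {N} p 0ℚ) (sym (+-inverseʳ 1ℚ)))
    P-⋃ (x ∷ xs) {A} {c} c≤1 mA A≤c = subst (_≤ 1ℚ - (1ℚ - c) ^ suc (length xs)) (lem (P p (⋃ (x ∷ xs) A)))
      (1-antitone (≤-trans
        (*-mono (≤⇒0≤- c≤1) (≤⇒0≤- (P≤1 (⋃ xs A))) (1-antitone (A≤c (here refl)))
          (subst (_≤ 1ℚ - P p (⋃ xs A)) (lem ((1ℚ - c) ^ length xs))
            (1-antitone (P-⋃ xs c≤1 mA (A≤c ∘ there)))))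
        (harris (mA x) (⋃-monotone xs mA))))
      where
      lem : ∀ a → 1ℚ - (1ℚ - a) ≡ a
      lem = solve-∀ ℚ-ring

    -- For p ≤ ½ the BK inequality for increasing events is a one-coordinate induction: P((A₁□B₀) ∪ (A₀□B₁))
    -- gains P(A₀□B₀) from inclusion–exclusion, and the coefficient 1 - 2p left in front of it is nonnegative.
    bk : ∀ {N} {A B : Event N} → p + p ≤ 1ℚ → Monotone A → Monotone B → P p (A □ B) ≤ P p A * P p B
    bk {zero} {A} {B} _ _ _ = base (A []) (B [])
      where
      base : ∀ a b → 𝟙 (a ∧ b) ≤ 𝟙 a * 𝟙 b
      base true  true  = ≤-refl
      base true  false = ≤-refl
      base false true  = ≤-refl
      base false false = ≤-refl
    bk {suc N} {A} {B} 2p≤1 mA mB = ≤-trans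
      (slack (p * (P p (A₁ □ B₀) + P p (A₀ □ B₁) - (P p ((A₁ □ B₀) ⋓ (A₀ □ B₁)) + P p (A₀ □ B₀))))
        (0≤* 0≤p (≤⇒0≤- (P-⋓+ {A = A₁ □ B₀} {A₀ □ B₁} {A₀ □ B₀}
          (□-mono (outside⊑inside mA) (λ _ h → h)) (□-mono (λ _ h → h) (outside⊑inside mB)))))
        (lem₁ p (P p ((A₁ □ B₀) ⋓ (A₀ □ B₁))) (P p (A₁ □ B₀)) (P p (A₀ □ B₁)) (P p (A₀ □ B₀))))
      (≤-trans
        (+-mono-≤
          (*-monoˡ (1ℚ - (p + p)) (≤⇒0≤- 2p≤1) (bk 2p≤1 (section outside mA) (section outside mB)))
          (*-monoˡ p 0≤p (+-mono-≤ (bk 2p≤1 (section inside mA) (section outside mB))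
                                  (bk 2p≤1 (section outside mA) (section inside mB)))))
        (slack (p * p * ((a₁ - a₀) * (b₁ - b₀)))
          (0≤* (0≤* 0≤p 0≤p) (0≤* (≤⇒0≤- (P-mono (outside⊑inside mA))) (≤⇒0≤- (P-mono (outside⊑inside mB)))))
          (lem₂ p a₀ a₁ b₀ b₁)))
      where
      A₁ A₀ B₁ B₀ : Event N
      A₁ = A ∘ (inside ∷_)
      A₀ = A ∘ (outside ∷_)
      B₁ = B ∘ (inside ∷_)
      B₀ = B ∘ (outside ∷_)
      a₁ a₀ b₁ b₀ : ℚ
      a₁ = P p A₁
      a₀ = P p A₀
      b₁ = P p B₁
      b₀ = P p B₀
      lem₁ : ∀ p u x y z → (p * u + (1ℚ - p) * z) + p * (x + y - (u + z)) ≡ (1ℚ - (p + p)) * z + p * (x + y)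
      lem₁ = solve-∀ ℚ-ring
      lem₂ : ∀ p a₀ a₁ b₀ b₁ →
        (1ℚ - (p + p)) * (a₀ * b₀) + p * (a₁ * b₀ + a₀ * b₁) + p * p * ((a₁ - a₀) * (b₁ - b₀)) ≡
        (p * a₁ + (1ℚ - p) * a₀) * (p * b₁ + (1ℚ - p) * b₀)
      lem₂ = solve-∀ ℚ-ring

  P-has : ∀ {N} p (i : Fin N) → P p (has i) ≡ p
  P-has {suc N} p zero    = trans (cong₂ (λ x y → p * x + (1ℚ - p) * y) (E-const {N} p 1ℚ) (E-const {N} p 0ℚ)) (lem p)
    where
    lem : ∀ p → p * 1ℚ + (1ℚ - p) * 0ℚ ≡ p
    lem = solve-∀ ℚ-ring
  P-has {suc N} p (suc i) = trans (cong (λ x → p * x + (1ℚ - p) * x) (P-has p i)) (lem p p)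
    where
    lem : ∀ p c → p * c + (1ℚ - p) * c ≡ c
    lem = solve-∀ ℚ-ring

-- Analysis of the walk recursion near its fixed point.

module Survival where

  open import Data.Nat as ℕ using (ℕ; zero; suc)
  open import Data.Rational
  open import Data.Rational.Properties
  open import Relation.Binary.PropositionalEquality using (_≡_; refl; sym; trans; cong; subst; subst₂)
  open import Tactic.RingSolver using (solve-∀)

  open Rationals

  -- The quotient (1 - (1 - x)^m)/x without division (`geometric-closed`); as a sum of powers of 1 -
  -- x it is visibly decreasing in x.
  geometric : ℕ → ℚ → ℚ
  geometric zero    x = 0ℚ
  geometric (suc m) x = geometric m x + (1ℚ - x) ^ m

  geometric-closed : ∀ m x → x * geometric m x ≡ 1ℚ - (1ℚ - x) ^ m
  geometric-closed zero    x = *-zeroʳ x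
  geometric-closed (suc m) x = trans (*-distribˡ-+ x (geometric m x) ((1ℚ - x) ^ m))
    (trans (cong (_+ x * (1ℚ - x) ^ m) (geometric-closed m x)) (lem x ((1ℚ - x) ^ m)))
    where
    lem : ∀ x a → (1ℚ - a) + x * a ≡ 1ℚ - (1ℚ - x) * a
    lem = solve-∀ ℚ-ring

  0≤geometric : ∀ {x} m → x ≤ 1ℚ → 0ℚ ≤ geometric m x
  0≤geometric zero    x≤1 = ≤-refl
  0≤geometric (suc m) x≤1 = 0≤+ (0≤geometric m x≤1) (0≤^ m (≤⇒0≤- x≤1))

  geometric-antitone : ∀ {x y} m → x ≤ y → y ≤ 1ℚ → geometric m y ≤ geometric m x
  geometric-antitone zero    x≤y y≤1 = ≤-refl
  geometric-antitone (suc m) x≤y y≤1 =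
    +-mono-≤ (geometric-antitone m x≤y y≤1) (^-mono m (≤⇒0≤- y≤1) (1-antitone x≤y))

  2ℚ 4ℚ : ℚ
  2ℚ = 1ℚ + 1ℚ
  4ℚ = 2ℚ + 2ℚ

  -- The Padé bound 1 - e^{-y} ≤ 2y/(2 + y) for y = m x, in polynomial form.
  geometric-padé : ∀ {x} m → 0ℚ ≤ x → x ≤ 1ℚ → geometric (suc m) x * (2ℚ + fromℕ m * x) ≤ 2ℚ * fromℕ (suc m)
  geometric-padé {x} zero    0≤x x≤1 = ≤-reflexive (lem x)
    where
    lem : ∀ x → (0ℚ + 1ℚ) * (2ℚ + 0ℚ * x) ≡ 2ℚ * 1ℚ
    lem = solve-∀ ℚ-ring
  geometric-padé {x} (suc m) 0≤x x≤1 = subst₂ _≤_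
    (trans (cong (λ y → g * (2ℚ + k * x) + y + a * (2ℚ + (1ℚ + k) * x)) (sym (geometric-closed (suc m) x)))
      (trans (lem₁ x g a k) (cong (λ y → (g + a) * (2ℚ + y * x)) (sym (fromℕ-suc m)))))
    (trans (cong (λ z → 2ℚ * z + 1ℚ + 1ℚ) (fromℕ-suc m))
      (trans (lem₃ k) (cong (2ℚ *_) (sym (trans (fromℕ-suc (suc m)) (cong (1ℚ +_) (fromℕ-suc m)))))))
    (≤-trans (≤-reflexive (trans (lem₂ x (g * (2ℚ + k * x)) a k)
        (cong (λ z → g * (2ℚ + k * x) + 1ℚ + a * (1ℚ + z * x)) (sym (fromℕ-suc m)))))
      (+-mono-≤ (+-monoˡ-≤ 1ℚ (geometric-padé m 0≤x x≤1)) (bernoulli (suc m) 0≤x x≤1)))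
    where
    k g a : ℚ
    k = fromℕ m
    g = geometric (suc m) x
    a = (1ℚ - x) ^ suc m
    lem₁ : ∀ x g a k → g * (2ℚ + k * x) + x * g + a * (2ℚ + (1ℚ + k) * x) ≡ (g + a) * (2ℚ + (1ℚ + k) * x)
    lem₁ = solve-∀ ℚ-ring
    lem₂ : ∀ x h a k → h + (1ℚ - a) + a * (2ℚ + (1ℚ + k) * x) ≡ h + 1ℚ + a * (1ℚ + (1ℚ + k) * x)
    lem₂ = solve-∀ ℚ-ring
    lem₃ : ∀ k → 2ℚ * (1ℚ + k) + 1ℚ + 1ℚ ≡ 2ℚ * (1ℚ + (1ℚ + k))
    lem₃ = solve-∀ ℚ-ring

  atLeastOne : ℕ → ℚ → ℚ
  atLeastOne d u = 1ℚ - (1ℚ - u) ^ d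

  0≤atLeastOne : ∀ {u} d → 0ℚ ≤ u → u ≤ 1ℚ → 0ℚ ≤ atLeastOne d u
  0≤atLeastOne {u} d 0≤u u≤1 = ≤⇒0≤- (^-≤1 d (≤⇒0≤- u≤1) (subst (1ℚ - u ≤_) (+-identityʳ 1ℚ) (1-antitone 0≤u)))

  atLeastOne≤1 : ∀ {u} d → u ≤ 1ℚ → atLeastOne d u ≤ 1ℚ
  atLeastOne≤1 {u} d u≤1 = subst (atLeastOne d u ≤_) (+-identityʳ 1ℚ) (1-antitone (0≤^ d (≤⇒0≤- u≤1)))

  atLeastOne-mono : ∀ {u v} d → u ≤ v → v ≤ 1ℚ → atLeastOne d u ≤ atLeastOne d v
  atLeastOne-mono d u≤v v≤1 = 1-antitone (^-mono d (≤⇒0≤- v≤1) (1-antitone u≤v))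

  -- Bounds the probability of a walk of length k + 1, if u bounds that of one of length k.
  step : ℕ → ℕ → ℚ → ℚ → ℚ
  step M d p u = atLeastOne M (p * atLeastOne d u)

  module _ {M d : ℕ} {p : ℚ} (0≤p : 0ℚ ≤ p) (p≤1 : p ≤ 1ℚ) where

    private
      p*atLeastOne≤1 : ∀ {u} → 0ℚ ≤ u → u ≤ 1ℚ → p * atLeastOne d u ≤ 1ℚ
      p*atLeastOne≤1 0≤u u≤1 = *-mono 0≤p 0≤1 p≤1 (atLeastOne≤1 d u≤1)

    -- Only the point T matters, because step M d p u / u is decreasing in u.
    step-contracts : ∀ {T u κ} → 0ℚ ≤ T → T ≤ u → u ≤ 1ℚ →
      p * geometric d T * geometric M (p * atLeastOne d T) ≤ κ → step M d p u ≤ κ * u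
    step-contracts {T} {u} {κ} 0≤T T≤u u≤1 at-T = subst (_≤ κ * u)
      (trans (lem p u (geometric d u) (geometric M (p * atLeastOne d u)))
        (trans (cong (λ s → p * s * geometric M (p * atLeastOne d u)) (geometric-closed d u))
          (geometric-closed M (p * atLeastOne d u))))
      (*-monoʳ u 0≤u (≤-trans
        (*-mono (0≤* 0≤p (0≤geometric d u≤1)) (0≤geometric M (p*atLeastOne≤1 0≤T (≤-trans T≤u u≤1)))
          (*-monoˡ p 0≤p (geometric-antitone d T≤u u≤1))
          (geometric-antitone M (*-monoˡ p 0≤p (atLeastOne-mono d T≤u u≤1)) (p*atLeastOne≤1 0≤u u≤1)))
        at-T))
      where
      0≤u : 0ℚ ≤ u
      0≤u = ≤-trans 0≤T T≤u
      lem : ∀ p u g h → p * g * h * u ≡ p * (u * g) * h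
      lem = solve-∀ ℚ-ring

  16ℚ : ℚ
  16ℚ = 4ℚ * 4ℚ

  -- T = (2b/d)(1 + 16b) lies just above the nonzero fixed point 2b/d + O(b²) of step.
  module _ {m e : ℕ} {p b T : ℚ} where

    private
      M d : ℕ
      M = suc m
      d = suc e
      D κ s x z : ℚ
      D = fromℕ d
      κ = 1ℚ - T * T
      s = atLeastOne d T
      x = p * s
      z = fromℕ m * x

    -- By the two Padé bounds it suffices that 4(1 + b) ≤ κ(2 + eT)(2 + z), which is `main`. Since z
    -- is about T, the product of the brackets is about 4 + 2DT = 4 + 4b + 64b². The surplus 64b²
    -- pays for all second-order losses, among them the factor κ = 1 - T²; any κ below 1 not
    -- depending on n would serve.
    critical : 0ℚ ≤ p → p ≤ 1ℚ → 0ℚ < b → 16ℚ * b ≤ 1ℚ → 2ℚ ≤ D →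
      D * T ≡ 2ℚ * b * (1ℚ + 16ℚ * b) → 0ℚ ≤ T → 1ℚ ≤ fromℕ M * T →
      1ℚ ≤ D * fromℕ M * p → D * fromℕ M * p ≤ 1ℚ + b →
      p * geometric d T * geometric M x ≤ κ
    critical 0≤p p≤1 0<b 16b≤1 2≤D DT≡ 0≤T 1≤MT 1≤y y≤1+b =
      *-cancelʳ ((2ℚ + fromℕ e * T) * (2ℚ + z)) (0<* (0<2+ (0≤* (0≤fromℕ e) 0≤T)) (0<2+ 0≤z))
        (≤-trans (≤-trans
          (subst₂ _≤_ (lem₁ p (geometric d T) (geometric M x) (2ℚ + fromℕ e * T) (2ℚ + z)) (lem₂ p D (fromℕ M))
            (*-monoˡ p 0≤p (*-mono (0≤* (0≤geometric d T≤1) (<⇒≤ (0<2+ (0≤* (0≤fromℕ e) 0≤T))))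
              (0≤* 0≤2 (0≤fromℕ M)) (geometric-padé e 0≤T T≤1) (geometric-padé m 0≤x x≤1))))
          (*-monoˡ 4ℚ 0≤4 y≤1+b))
          main)
      where
      0≤b : 0ℚ ≤ b
      0≤b = <⇒≤ 0<b
      0≤2 : 0ℚ ≤ 2ℚ
      0≤2 = nonNegative⁻¹ 2ℚ
      0≤4 : 0ℚ ≤ 4ℚ
      0≤4 = nonNegative⁻¹ 4ℚ
      0<2+ : ∀ {a} → 0ℚ ≤ a → 0ℚ < 2ℚ + a
      0<2+ 0≤a = <-≤-trans (positive⁻¹ 2ℚ) (slack _ 0≤a refl)
      1≤D : 1ℚ ≤ D
      1≤D = ≤-trans (slack 1ℚ 0≤1 refl) 2≤D
      0≤D : 0ℚ ≤ D
      0≤D = ≤-trans 0≤1 1≤D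
      DT≤4b : D * T ≤ 4ℚ * b
      DT≤4b = subst (_≤ 4ℚ * b) (sym DT≡) (subst (2ℚ * b * (1ℚ + 16ℚ * b) ≤_) (lem b)
        (*-monoˡ (2ℚ * b) (0≤* 0≤2 0≤b) (+-monoʳ-≤ 1ℚ 16b≤1)))
        where
        lem : ∀ b → 2ℚ * b * 2ℚ ≡ 4ℚ * b
        lem = solve-∀ ℚ-ring
      2DT≤1 : 2ℚ * (D * T) ≤ 1ℚ
      2DT≤1 = ≤-trans (*-monoˡ 2ℚ 0≤2 DT≤4b) (≤-trans (slack (4ℚ * 2ℚ * b) (0≤* (nonNegative⁻¹ (4ℚ * 2ℚ)) 0≤b) (lem b)) 16b≤1)
        where
        lem : ∀ b → 2ℚ * (4ℚ * b) + 4ℚ * 2ℚ * b ≡ 16ℚ * b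
        lem = solve-∀ ℚ-ring
      0≤DT : 0ℚ ≤ D * T
      0≤DT = 0≤* 0≤D 0≤T
      DT≤1 : D * T ≤ 1ℚ
      DT≤1 = ≤-trans (slack (D * T) 0≤DT (lem (D * T))) 2DT≤1
        where
        lem : ∀ a → a + a ≡ 2ℚ * a
        lem = solve-∀ ℚ-ring
      2T≤DT : 2ℚ * T ≤ D * T
      2T≤DT = *-monoʳ T 0≤T 2≤D
      T≤1 : T ≤ 1ℚ
      T≤1 = ≤-trans (≤-trans (slack T 0≤T (lem T)) 2T≤DT) DT≤1
        where
        lem : ∀ a → a + a ≡ 2ℚ * a
        lem = solve-∀ ℚ-ring
      0≤s : 0ℚ ≤ s
      0≤s = 0≤atLeastOne d 0≤T T≤1
      0≤x : 0ℚ ≤ x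
      0≤x = 0≤* 0≤p 0≤s
      x≤1 : x ≤ 1ℚ
      x≤1 = *-mono 0≤p 0≤1 p≤1 (atLeastOne≤1 d T≤1)
      0≤z : 0ℚ ≤ z
      0≤z = 0≤* (0≤fromℕ m) 0≤x

      lem₁ : ∀ p g h u v → p * (g * u * (h * v)) ≡ p * g * h * (u * v)
      lem₁ = solve-∀ ℚ-ring
      lem₂ : ∀ p D M → p * (2ℚ * D * (2ℚ * M)) ≡ 4ℚ * (D * M * p)
      lem₂ = solve-∀ ℚ-ring

      -- With y = D T, Bernoulli gives s ≥ y/(1 + y), and y/(1 + y) ≥ y(1 - y).
      s-lower : D * T * (1ℚ - D * T) ≤ s
      s-lower = slack (s * (D * T) * (D * T) + (1ℚ - r * (1ℚ + D * T)) * (1ℚ - D * T))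
        (0≤+ (0≤* (0≤* 0≤s 0≤DT) 0≤DT) (0≤* (≤⇒0≤- (bernoulli d 0≤T T≤1)) (≤⇒0≤- DT≤1)))
        (lem (D * T) r)
        where
        r : ℚ
        r = (1ℚ - T) ^ d
        lem : ∀ y r → y * (1ℚ - y) + ((1ℚ - r) * y * y + (1ℚ - r * (1ℚ + y)) * (1ℚ - y)) ≡ 1ℚ - r
        lem = solve-∀ ℚ-ring

      -- The Padé bound for exponent M involves m = M - 1. The lost D p is at most the fraction T of
      -- D M p, because M T ≥ 1.
      mp-lower : 1ℚ - T ≤ D * (fromℕ m * p)
      mp-lower = slack ((D * fromℕ M * p - 1ℚ) * (1ℚ - T) + D * p * (fromℕ M * T - 1ℚ))
        (0≤+ (0≤* (≤⇒0≤- 1≤y) (≤⇒0≤- T≤1)) (0≤* (0≤* 0≤D 0≤p) (≤⇒0≤- 1≤MT)))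
        (trans (cong (λ k → 1ℚ - T + ((D * k * p - 1ℚ) * (1ℚ - T) + D * p * (k * T - 1ℚ))) (fromℕ-suc m))
          (lem D (fromℕ m) p T))
        where
        lem : ∀ D k p T → 1ℚ - T + ((D * (1ℚ + k) * p - 1ℚ) * (1ℚ - T) + D * p * ((1ℚ + k) * T - 1ℚ)) ≡ D * (k * p)
        lem = solve-∀ ℚ-ring

      z-lower : (1ℚ - T) * (T * (1ℚ - D * T)) ≤ z
      z-lower = *-cancelʳ D (<-≤-trans 0<1 1≤D) (subst₂ _≤_ (lem T D) (lem′ D (fromℕ m) p s)
        (*-mono (≤⇒0≤- T≤1) 0≤s mp-lower s-lower))
        where
        lem : ∀ T D → (1ℚ - T) * (D * T * (1ℚ - D * T)) ≡ (1ℚ - T) * (T * (1ℚ - D * T)) * D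
        lem = solve-∀ ℚ-ring
        lem′ : ∀ D k p s → D * (k * p) * s ≡ k * (p * s) * D
        lem′ = solve-∀ ℚ-ring

      z-lower′ : T - 2ℚ * D * (T * T) ≤ z
      z-lower′ = ≤-trans (slack (T * T * (D - 1ℚ) + D * T * T * T)
          (0≤+ (0≤* (0≤* 0≤T 0≤T) (≤⇒0≤- 1≤D)) (0≤* (0≤* (0≤* 0≤D 0≤T) 0≤T) 0≤T)) (lem T D))
        z-lower
        where
        lem : ∀ T D → T - 2ℚ * D * (T * T) + (T * T * (D - 1ℚ) + D * T * T * T) ≡ (1ℚ - T) * (T * (1ℚ - D * T))
        lem = solve-∀ ℚ-ring

      product-lower : 4ℚ + 2ℚ * (D * T) - 4ℚ * (D * T) * T ≤ (2ℚ + fromℕ e * T) * (2ℚ + z)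
      product-lower = ≤-trans
        (subst (λ k → 4ℚ + 2ℚ * (k * T) - 4ℚ * (k * T) * T ≤ (2ℚ + fromℕ e * T) * (2ℚ + (T - 2ℚ * k * (T * T))))
          (sym (fromℕ-suc e))
          (slack (fromℕ e * (T * T) * (1ℚ - 2ℚ * ((1ℚ + fromℕ e) * T)))
            (0≤* (0≤* (0≤fromℕ e) (0≤* 0≤T 0≤T)) (≤⇒0≤- (subst (λ k → 2ℚ * (k * T) ≤ 1ℚ) (fromℕ-suc e) 2DT≤1)))
            (lem T (fromℕ e))))
        (*-monoˡ (2ℚ + fromℕ e * T) (<⇒≤ (0<2+ (0≤* (0≤fromℕ e) 0≤T))) (+-monoʳ-≤ 2ℚ z-lower′))
        where
        lem : ∀ T e → 4ℚ + 2ℚ * ((1ℚ + e) * T) - 4ℚ * ((1ℚ + e) * T) * T + e * (T * T) * (1ℚ - 2ℚ * ((1ℚ + e) * T))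
                    ≡ (2ℚ + e * T) * (2ℚ + (T - 2ℚ * (1ℚ + e) * (T * T)))
        lem = solve-∀ ℚ-ring

      0≤κ : 0ℚ ≤ κ
      0≤κ = ≤⇒0≤- (*-mono 0≤T 0≤1 T≤1 T≤1)

      4T≤8b : 4ℚ * T ≤ 4ℚ * 2ℚ * b
      4T≤8b = subst₂ _≤_ (lem T) (lem′ b) (*-monoˡ 2ℚ 0≤2 (≤-trans 2T≤DT DT≤4b))
        where
        lem : ∀ T → 2ℚ * (2ℚ * T) ≡ 4ℚ * T
        lem = solve-∀ ℚ-ring
        lem′ : ∀ b → 2ℚ * (4ℚ * b) ≡ 4ℚ * 2ℚ * b
        lem′ = solve-∀ ℚ-ring

      -- The origin of the 16 in T: (1 + 16b)(1 - 8b) = 1 + 8b(1 - 16b), which is at least 1 when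
      -- 16b ≤ 1.
      2b≤ : 2ℚ * b ≤ D * T * (1ℚ - 4ℚ * T)
      2b≤ = subst (λ y → 2ℚ * b ≤ y * (1ℚ - 4ℚ * T)) (sym DT≡)
        (≤-trans (slack (2ℚ * b * (4ℚ * 2ℚ * b * (1ℚ - 16ℚ * b)))
            (0≤* (0≤* 0≤2 0≤b) (0≤* (0≤* (nonNegative⁻¹ (4ℚ * 2ℚ)) 0≤b) (≤⇒0≤- 16b≤1))) (lem b))
          (*-monoˡ (2ℚ * b * (1ℚ + 16ℚ * b)) (0≤* (0≤* 0≤2 0≤b) (0≤+ 0≤1 (0≤* (nonNegative⁻¹ 16ℚ) 0≤b)))
            (1-antitone 4T≤8b)))
        where
        lem : ∀ b → 2ℚ * b + 2ℚ * b * (4ℚ * 2ℚ * b * (1ℚ - 16ℚ * b)) ≡ 2ℚ * b * (1ℚ + 16ℚ * b) * (1ℚ - 4ℚ * 2ℚ * b)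
        lem = solve-∀ ℚ-ring

      main : 4ℚ * (1ℚ + b) ≤ κ * ((2ℚ + fromℕ e * T) * (2ℚ + z))
      main = ≤-trans
        (slack (2ℚ * (D * T * (1ℚ - 4ℚ * T) - 2ℚ * b)
                + (2ℚ * (T * (D * T - 2ℚ * T)) + 2ℚ * (D * T) * T * (1ℚ - T) + 4ℚ * (D * T) * (T * T * T)))
          (0≤+ (0≤* 0≤2 (≤⇒0≤- 2b≤))
            (0≤+ (0≤+ (0≤* 0≤2 (0≤* 0≤T (≤⇒0≤- 2T≤DT))) (0≤* (0≤* (0≤* 0≤2 0≤DT) 0≤T) (≤⇒0≤- T≤1)))
              (0≤* (0≤* 0≤4 0≤DT) (0≤* (0≤* 0≤T 0≤T) 0≤T))))
          (lem b T (D * T)))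
        (*-monoˡ κ 0≤κ product-lower)
        where
        lem : ∀ b T y → 4ℚ * (1ℚ + b) + (2ℚ * (y * (1ℚ - 4ℚ * T) - 2ℚ * b)
                + (2ℚ * (T * (y - 2ℚ * T)) + 2ℚ * y * T * (1ℚ - T) + 4ℚ * y * (T * T * T)))
              ≡ (1ℚ - T * T) * (4ℚ + 2ℚ * y - 4ℚ * y * T)
        lem = solve-∀ ℚ-ring

-- Lists of vertices and pairs, and the expected number of tuples of disjoint events.

module Exploration where

  open import Data.Bool using (Bool; true; false; T; not; _∧_)
  open import Data.Fin using (Fin; zero; suc; toℕ)
  import Data.Fin.Properties as Finₚ
  open import Data.Fin.Subset using (Subset; inside; outside; _∈_; _⊆_; ∣_∣; ⁅_⁆; _∪_; ⊥)
  open import Data.Fin.Subset.Properties using (⊥⊆; x∈⁅x⁆; x∈⁅y⁆⇒x≡y; p⊆p∪q; q⊆p∪q; x∈p∪q⁻; ∉⊥; _∈?_)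
  open import Data.List using (List; []; _∷_; _++_; map; length; allFin; filter)
  open import Data.List.Membership.Propositional renaming (_∈_ to _∈ˡ_)
  open import Data.List.Membership.Propositional.Properties using (∈-map⁺; ∈-++⁺ˡ; ∈-++⁺ʳ; ∈-allFin; ∈-filter⁺; ∈-filter⁻)
  open import Data.List.Properties using (length-map; length-++)
  open import Data.List.Relation.Unary.Any using (here; there)
  open import Data.Nat as ℕ using (ℕ; zero; suc; _∸_; z≤n; s≤s)
  import Data.Nat.Properties as ℕₚ
  open import Data.Product using (_×_; _,_; proj₂; ∃-syntax)
  open import Data.Rational using (ℚ; 0ℚ; 1ℚ; _+_; _*_; _-_; -_; _≤_; _⊔_)
  open import Data.Rational.Properties
  open import Data.Sum using (_⊎_; inj₁; inj₂; [_,_]; [_,_]′)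
  open import Data.Vec using ([]; _∷_; here; there; _[_]≔_)
  open import Function using (_∘_; Equivalence)
  open import Relation.Binary.PropositionalEquality using (_≡_; _≢_; refl; sym; trans; cong; subst; subst₂)
  open import Relation.Nullary using (¬_; contradiction)
  open import Tactic.RingSolver using (solve-∀)

  open Rationals
  open RandomSubsets
  open Survival
  open Equivalence using (to; from)

  elements : ∀ {n} → Subset n → List (Fin n)
  elements []            = []
  elements (inside  ∷ S) = zero ∷ map suc (elements S)
  elements (outside ∷ S) = map suc (elements S)

  length-elements : ∀ {n} (S : Subset n) → length (elements S) ≡ ∣ S ∣
  length-elements []            = refl
  length-elements (inside  ∷ S) = cong suc (trans (length-map suc (elements S)) (length-elements S))
  length-elements (outside ∷ S) = trans (length-map suc (elements S)) (length-elements S)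

  ∈-elements : ∀ {n} {x : Fin n} {S} → x ∈ S → x ∈ˡ elements S
  ∈-elements {x = zero}  {inside ∷ S}  _           = here refl
  ∈-elements {x = suc x} {inside ∷ S}  (there x∈S) = there (∈-map⁺ suc (∈-elements x∈S))
  ∈-elements {x = suc x} {outside ∷ S} (there x∈S) = ∈-map⁺ suc (∈-elements x∈S)

  infixl 6 _without_
  _without_ : ∀ {n} → Subset n → Fin n → Subset n
  S without x = S [ x ]≔ outside

  ∣without∣ : ∀ {n} {S : Subset n} {x} → x ∈ S → ∣ S ∣ ≡ suc ∣ S without x ∣
  ∣without∣ {S = inside  ∷ S} here        = refl
  ∣without∣ {S = inside  ∷ S} (there x∈S) = cong suc (∣without∣ x∈S)
  ∣without∣ {S = outside ∷ S} (there x∈S) = ∣without∣ x∈S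

  ∈-without : ∀ {n} {S : Subset n} {x y} → y ∈ S → x ≢ y → y ∈ S without x
  ∈-without {x = zero}  here        x≢y = contradiction refl x≢y
  ∈-without {x = suc x} here        x≢y = here
  ∈-without {x = zero}  (there y∈S) x≢y = there y∈S
  ∈-without {x = suc x} (there y∈S) x≢y = there (∈-without y∈S (x≢y ∘ cong suc))

  pairs : ∀ {X : Set} → List X → List (X × X)
  pairs []       = []
  pairs (x ∷ xs) = map (x ,_) xs ++ pairs xs

  length-pairs : ∀ {X : Set} (x : X) xs →
                 2ℚ * fromℕ (length (pairs (x ∷ xs))) ≡ fromℕ (length (x ∷ xs)) * fromℕ (length xs)
  length-pairs x []       = refl
  length-pairs x (y ∷ ys) = trans (cong (λ k → 2ℚ * fromℕ k)
      (trans (length-++ (map (x ,_) (y ∷ ys))) (cong (ℕ._+ length (pairs (y ∷ ys))) (length-map (x ,_) (y ∷ ys)))))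
    (trans (cong (2ℚ *_) (fromℕ-+ (suc ℓ) (length (pairs (y ∷ ys)))))
    (trans (*-distribˡ-+ 2ℚ (fromℕ (suc ℓ)) (fromℕ (length (pairs (y ∷ ys)))))
    (trans (cong (2ℚ * fromℕ (suc ℓ) +_) (length-pairs y ys))
    (trans (lem (fromℕ (suc ℓ)) (fromℕ ℓ))
      (cong (_* fromℕ (suc ℓ)) (sym (trans (fromℕ-suc (suc ℓ)) (cong (1ℚ +_) (fromℕ-suc ℓ)))))
      ))))
    where
    ℓ : ℕ
    ℓ = length ys
    lem : ∀ a b → 2ℚ * a + a * b ≡ (1ℚ + (1ℚ + b)) * a
    lem = solve-∀ ℚ-ring

  ∈-pairs : ∀ {X : Set} {xs : List X} {v w} → v ∈ˡ xs → w ∈ˡ xs → v ≢ w → (v , w) ∈ˡ pairs xs ⊎ (w , v) ∈ˡ pairs xs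
  ∈-pairs (here refl) (here refl) v≢w = contradiction refl v≢w
  ∈-pairs (here refl) (there w∈)  v≢w = inj₁ (∈-++⁺ˡ (∈-map⁺ _ w∈))
  ∈-pairs (there v∈)  (here refl) v≢w = inj₂ (∈-++⁺ˡ (∈-map⁺ _ v∈))
  ∈-pairs (there v∈)  (there w∈)  v≢w = [ inj₁ ∘ ∈-++⁺ʳ _ , inj₂ ∘ ∈-++⁺ʳ _ ] (∈-pairs v∈ w∈ v≢w)

  span : ∀ {N} → (ℕ → Fin N) → ℕ → Subset N
  span f zero    = ⊥
  span f (suc k) = ⁅ f 0 ⁆ ∪ span (f ∘ suc) k

  ∈-span⁻ : ∀ {N} (f : ℕ → Fin N) k {i} → i ∈ span f k → ∃[ t ] t ℕ.< k × i ≡ f t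
  ∈-span⁻ f zero    i∈ = contradiction i∈ ∉⊥
  ∈-span⁻ f (suc k) i∈ with x∈p∪q⁻ ⁅ f 0 ⁆ (span (f ∘ suc) k) i∈
  ... | inj₁ i∈₀ = 0 , s≤s z≤n , x∈⁅y⁆⇒x≡y (f 0) i∈₀
  ... | inj₂ i∈₁ with t , t<k , eq ← ∈-span⁻ (f ∘ suc) k i∈₁ = suc t , s≤s t<k , eq

  -- The number of ways to choose edges e₁, …, e_j such that C e₁, …, C e_j and A occur disjointly.
  tuples : ∀ {N} → (Fin N → Event N) → ℕ → Event N → Subset N → ℚ
  tuples C zero    A S = 𝟙 (A S)
  tuples C (suc j) A S = sum (λ e → tuples C j (C e □ A) S)

  0≤tuples : ∀ {N} (C : Fin N → Event N) j A S → 0ℚ ≤ tuples C j A S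
  0≤tuples C zero    A S = 0≤𝟙 (A S)
  0≤tuples C (suc j) A S = 0≤sum λ e → 0≤tuples C j (C e □ A) S

  -- `A` stays arbitrary so that the induction can absorb `C e` into it. Each absorption costs one
  -- use of BK, and summing over the N choices of e contributes the factor `fromℕ N * c`.
  E-tuples : ∀ {N p c} {C : Fin N → Event N} → 0ℚ ≤ p → p + p ≤ 1ℚ → (∀ e → Monotone (C e)) → 0ℚ ≤ c →
             (∀ e → P p (C e) ≤ c) → ∀ j {A} → Monotone A →
             E p (tuples C j A) ≤ P p A * (fromℕ N * c) ^ j
  E-tuples {p = p} 0≤p 2p≤1 mC 0≤c C≤c zero {A} mA = ≤-reflexive (sym (*-identityʳ (P p A)))
  E-tuples {N} {p} {c} {C} 0≤p 2p≤1 mC 0≤c C≤c (suc j) {A} mA = subst₂ _≤_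
    (sym (E-sum p (λ e → tuples C j (C e □ A))))
    (trans (sum-const N (c * P p A * μ ^ j)) (lem (fromℕ N) c (P p A) (μ ^ j)))
    (sum-mono λ e → ≤-trans (E-tuples 0≤p 2p≤1 mC 0≤c C≤c j (□-monotone (mC e) mA))
      (*-monoʳ (μ ^ j) (0≤^ j (0≤* (0≤fromℕ N) 0≤c))
        (≤-trans (bk 0≤p p≤1 2p≤1 (mC e) mA) (*-monoʳ (P p A) (0≤P 0≤p p≤1 A) (C≤c e)))))
    where
    μ : ℚ
    μ = fromℕ N * c
    p≤1 : p ≤ 1ℚ
    p≤1 = ≤-trans (slack p 0≤p refl) 2p≤1
    lem : ∀ N c a m → N * (c * a * m) ≡ a * (N * c * m)
    lem = solve-∀ ℚ-ring

  -- Counting positions that avoid given intervals.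

  within : ℕ → ℕ → ℕ → Bool
  within zero     zero    i       = false
  within zero     (suc w) zero    = true
  within zero     (suc w) (suc i) = within zero w i
  within (suc lo) w       zero    = false
  within (suc lo) w       (suc i) = within lo w i

  within⁺ : ∀ lo w {i} → lo ℕ.≤ i → i ℕ.< lo ℕ.+ w → T (within lo w i)
  within⁺ zero     (suc w) {zero}  _          _         = _
  within⁺ zero     (suc w) {suc i} _          (s≤s i<w) = within⁺ zero w z≤n i<w
  within⁺ (suc lo) w       {suc i} (s≤s lo≤i) (s≤s i<)  = within⁺ lo w lo≤i i<

  count-within : ∀ ℓ lo w → sum {ℓ} (λ i → 𝟙 (within lo w (toℕ i))) ≤ fromℕ w
  count-within zero    lo       w       = 0≤fromℕ w
  count-within (suc ℓ) zero     zero    = ≤-reflexive (trans (sum-const (suc ℓ) 0ℚ) (*-zeroʳ (fromℕ (suc ℓ))))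
  count-within (suc ℓ) zero     (suc w) = subst (sum {suc ℓ} (λ i → 𝟙 (within zero (suc w) (toℕ i))) ≤_)
    (sym (fromℕ-suc w)) (+-monoʳ-≤ 1ℚ (count-within ℓ zero w))
  count-within (suc ℓ) (suc lo) w       = subst (_≤ fromℕ w)
    (sym (+-identityˡ (sum {ℓ} (λ i → 𝟙 (within lo w (toℕ i)))))) (count-within ℓ lo w)

  avoids : List (ℕ × ℕ) → ℕ → Bool
  avoids []              i = true
  avoids ((lo , w) ∷ is) i = not (within lo w i) ∧ avoids is i

  totalWidth : List (ℕ × ℕ) → ℕ
  totalWidth []              = 0
  totalWidth ((_ , w) ∷ is) = w ℕ.+ totalWidth is

  count-avoids : ∀ ℓ is → fromℕ ℓ ≤ sum {ℓ} (λ i → 𝟙 (avoids is (toℕ i))) + fromℕ (totalWidth is)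
  count-avoids ℓ [] = ≤-reflexive (sym (trans (+-identityʳ (sum {ℓ} (λ _ → 1ℚ))) (trans (sum-const ℓ 1ℚ) (*-identityʳ (fromℕ ℓ)))))
  count-avoids ℓ ((lo , w) ∷ is) = ≤-trans (count-avoids ℓ is) (≤-trans
    (+-monoˡ-≤ (fromℕ (totalWidth is)) (≤-trans
      (sum-mono {ℓ} {f = λ i → 𝟙 (avoids is (toℕ i))} {g = λ i → 𝟙 (avoids ((lo , w) ∷ is) (toℕ i)) + 𝟙 (within lo w (toℕ i))}
        λ i → split (within lo w (toℕ i)) (avoids is (toℕ i)))
      (≤-trans (≤-reflexive (∑-distrib-+ {ℓ} (λ i → 𝟙 (avoids ((lo , w) ∷ is) (toℕ i))) (λ i → 𝟙 (within lo w (toℕ i)))))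
        (+-monoʳ-≤ s (count-within ℓ lo w)))))
    (≤-reflexive (trans (+-assoc s (fromℕ w) (fromℕ (totalWidth is))) (cong (s +_) (sym (fromℕ-+ w (totalWidth is)))))))
    where
    s : ℚ
    s = sum {ℓ} (λ i → 𝟙 (avoids ((lo , w) ∷ is) (toℕ i)))
    split : ∀ a b → 𝟙 b ≤ 𝟙 (not a ∧ b) + 𝟙 a
    split true  true  = ≤-refl
    split true  false = 0≤1
    split false true  = ≤-refl
    split false false = ≤-refl

  -- Walks and centres in a uniform hypergraph, and their probabilities.

  module _ {n N d : ℕ} (edge : Fin N → Subset n) (uniform : ∀ e → ∣ edge e ∣ ≡ suc d) where

    incident : Fin n → List (Fin N)
    incident v = filter (λ e → v ∈? edge e) (allFin N)

    -- Some walk of k pairwise distinct edges leaves v.  It need not be a loose path: this suffices for an upper bound.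
    walk : ℕ → Fin n → Event N
    walk zero    v = λ _ → true
    walk (suc k) v = ⋃ (incident v) λ e → has e □ ⋃ (elements (edge e without v)) (walk k)

    centre : ℕ → Fin N → Event N
    centre k e = ⋃ (pairs (elements (edge e))) λ (v , w) → has e □ walk k v □ walk k w

    walk-monotone : ∀ k v → Monotone (walk k v)
    walk-monotone zero    v = true-monotone
    walk-monotone (suc k) v = ⋃-monotone (incident v) λ e →
      □-monotone (has-monotone e) (⋃-monotone (elements (edge e without v)) (walk-monotone k))

    centre-monotone : ∀ k e → Monotone (centre k e)
    centre-monotone k e = ⋃-monotone (pairs (elements (edge e))) λ (v , w) →
      □-monotone (has-monotone e) (□-monotone (walk-monotone k v) (walk-monotone k w))

    module _ {M : ℕ} (degree : ∀ v → length (incident v) ℕ.≤ M) {p : ℚ} (0≤p : 0ℚ ≤ p) (2p≤1 : p + p ≤ 1ℚ) where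

      private
        p≤1 : p ≤ 1ℚ
        p≤1 = ≤-trans (slack p 0≤p refl) 2p≤1

      P-walk-suc : ∀ k {u} → 0ℚ ≤ u → u ≤ 1ℚ → (∀ v → P p (walk k v) ≤ u) → ∀ v → P p (walk (suc k) v) ≤ step M d p u
      P-walk-suc k {u} 0≤u u≤1 walk≤u v = ≤-trans
        (P-⋃ 0≤p p≤1 (incident v) α≤1
          (λ e → □-monotone (has-monotone e) (⋃-monotone (elements (edge e without v)) (walk-monotone k)))
          λ {e} e∈ → edge-bound e (proj₂ (∈-filter⁻ (λ e → v ∈? edge e) {xs = allFin N} e∈)))
        (1-antitone (^-antitone-exponent (≤⇒0≤- α≤1) (subst (1ℚ - α ≤_) (+-identityʳ 1ℚ) (1-antitone 0≤α)) (degree v)))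
        where
        α : ℚ
        α = p * atLeastOne d u
        0≤α : 0ℚ ≤ α
        0≤α = 0≤* 0≤p (0≤atLeastOne d 0≤u u≤1)
        α≤1 : α ≤ 1ℚ
        α≤1 = *-mono 0≤p 0≤1 p≤1 (atLeastOne≤1 d u≤1)
        edge-bound : ∀ e → v ∈ edge e → P p (has e □ ⋃ (elements (edge e without v)) (walk k)) ≤ α
        edge-bound e v∈e = ≤-trans
          (bk 0≤p p≤1 2p≤1 (has-monotone e) (⋃-monotone (elements (edge e without v)) (walk-monotone k)))
          (subst (λ x → x * P p (⋃ (elements (edge e without v)) (walk k)) ≤ α) (sym (P-has p e))
            (*-monoˡ p 0≤p (subst (λ m → P p (⋃ (elements (edge e without v)) (walk k)) ≤ 1ℚ - (1ℚ - u) ^ m)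
              (trans (length-elements (edge e without v)) (ℕₚ.suc-injective (trans (sym (∣without∣ v∈e)) (uniform e))))
              (P-⋃ 0≤p p≤1 (elements (edge e without v)) u≤1 (walk-monotone k) (λ {w} _ → walk≤u w)))))

      -- The bound `T ⊔ κ ^ k` never falls below T, so `step-contracts` always applies to it and
      -- multiplies it by κ. The part κ T is then rounded back up to T, and the other part becomes
      -- the next power of κ.
      P-walk : ∀ {T κ} → 0ℚ ≤ T → T ≤ 1ℚ → 0ℚ ≤ κ → κ ≤ 1ℚ → p * geometric d T * geometric M (p * atLeastOne d T) ≤ κ →
               ∀ k v → P p (walk k v) ≤ T ⊔ κ ^ k
      P-walk {T} 0≤T T≤1 0≤κ κ≤1 at-T zero v = ≤-trans (P≤1 0≤p p≤1 (walk 0 v)) (p≤q⊔p T 1ℚ)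
      P-walk {T} {κ} 0≤T T≤1 0≤κ κ≤1 at-T (suc k) v = ≤-trans
        (P-walk-suc k (≤-trans 0≤T T≤u) u≤1 (P-walk 0≤T T≤1 0≤κ κ≤1 at-T k) v)
        (≤-trans (step-contracts {M} {d} 0≤p p≤1 0≤T T≤u u≤1 at-T)
          (subst (_≤ T ⊔ κ ^ suc k) (sym (*-distribˡ-⊔-nonNeg κ {{Data.Rational.nonNegative 0≤κ}} T (κ ^ k)))
            (⊔-monoˡ-≤ (κ ^ suc k) (subst (κ * T ≤_) (*-identityˡ T) (*-monoʳ T 0≤T κ≤1)))))
        where
        T≤u : T ≤ T ⊔ κ ^ k
        T≤u = p≤p⊔q T (κ ^ k)
        u≤1 : T ⊔ κ ^ k ≤ 1ℚ
        u≤1 = ⊔-lub T≤1 (^-≤1 k 0≤κ κ≤1)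

      -- A plain union bound over the pairs suffices here, since it already gives the right leading
      -- term. Doubling both sides keeps the binomial coefficient C(d+1, 2) free of division.
      P-centre : ∀ k {u} → 0ℚ ≤ u → (∀ v → P p (walk k v) ≤ u) → ∀ e →
                 2ℚ * P p (centre k e) ≤ fromℕ (suc d) * fromℕ d * (p * (u * u))
      P-centre k {u} 0≤u walk≤u e = subst (2ℚ * P p (centre k e) ≤_) eq
        (*-monoˡ 2ℚ (nonNegative⁻¹ 2ℚ)
          (union-bound 0≤p p≤1 (pairs (elements (edge e))) (λ (v , w) → has e □ walk k v □ walk k w)
            λ (v , w) → ≤-trans
              (bk 0≤p p≤1 2p≤1 (has-monotone e) (□-monotone (walk-monotone k v) (walk-monotone k w)))
              (subst (λ x → x * P p (walk k v □ walk k w) ≤ p * (u * u)) (sym (P-has p e))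
                (*-monoˡ p 0≤p (≤-trans (bk 0≤p p≤1 2p≤1 (walk-monotone k v) (walk-monotone k w))
                  (*-mono (0≤P 0≤p p≤1 (walk k v)) 0≤u (walk≤u v) (walk≤u w)))))))
        where
        2*pairs : ∀ (xs : List (Fin n)) → length xs ≡ suc d → 2ℚ * fromℕ (length (pairs xs)) ≡ fromℕ (suc d) * fromℕ d
        2*pairs (x ∷ xs) refl = length-pairs x xs
        c : ℚ
        c = p * (u * u)
        eq : 2ℚ * (fromℕ (length (pairs (elements (edge e)))) * c) ≡ fromℕ (suc d) * fromℕ d * c
        eq = trans (sym (*-assoc 2ℚ (fromℕ (length (pairs (elements (edge e))))) c))
          (cong (_* c) (2*pairs (elements (edge e)) (trans (length-elements (edge e)) (uniform e))))

    -- The walk is asserted on the set of its own edges instead of the whole hypergraph: disjoint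
    -- occurrence of several walks is checked on exactly these sets.
    walk-intro : ∀ k (x : ℕ → Fin n) (f : ℕ → Fin N) →
                 (∀ t → t ℕ.< k → x t ∈ edge (f t) × x (suc t) ∈ edge (f t) × x t ≢ x (suc t)) →
                 (∀ s t → s ℕ.< k → t ℕ.< k → f s ≡ f t → s ≡ t) →
                 T (walk k (x 0) (span f k))
    walk-intro zero    x f steps inj = _
    walk-intro (suc k) x f steps inj with x₀∈ , x₁∈ , x₀≢x₁ ← steps 0 (s≤s z≤n) =
      ∈⇒⋃ (λ e → has e □ ⋃ (elements (edge e without x 0)) (walk k))
        (∈-filter⁺ (λ e → x 0 ∈? edge e) (∈-allFin (f 0)) x₀∈) (span f (suc k))
        (□-intro (has-monotone (f 0)) (⋃-monotone (elements (edge (f 0) without x 0)) (walk-monotone k))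
          (∈⇒has (x∈⁅x⁆ (f 0)))
          (∈⇒⋃ (walk k) (∈-elements (∈-without x₁∈ x₀≢x₁)) (span (f ∘ suc) k)
            (walk-intro k (x ∘ suc) (f ∘ suc) (λ t t<k → steps (suc t) (s≤s t<k))
              λ s t s<k t<k eq → ℕₚ.suc-injective (inj (suc s) (suc t) (s≤s s<k) (s≤s t<k) eq)))
          disjoint
          (p⊆p∪q (span (f ∘ suc) k)) (q⊆p∪q ⁅ f 0 ⁆ (span (f ∘ suc) k)))
      where
      disjoint : ∀ {i} → i ∈ ⁅ f 0 ⁆ → ¬ i ∈ span (f ∘ suc) k
      disjoint i∈₀ i∈₁ with t , t<k , eq ← ∈-span⁻ (f ∘ suc) k i∈₁
        with () ← inj 0 (suc t) (s≤s z≤n) (s≤s t<k) (trans (sym (x∈⁅y⁆⇒x≡y (f 0) i∈₀)) eq)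

    -- All that the argument retains of a loose path: distinct links, consecutive ones sharing a
    -- node. Nodes and links are total functions on ℕ, arbitrary beyond the end, so that positions
    -- can be shifted without casts.
    record Trail (ℓ : ℕ) (H : Subset N) : Set where
      field
        node    : ℕ → Fin n
        link    : ℕ → Fin N
        present : ∀ i → i ℕ.< ℓ → link i ∈ H
        source  : ∀ i → i ℕ.< ℓ → node i ∈ edge (link i)
        target  : ∀ i → i ℕ.< ℓ → node (suc i) ∈ edge (link i)
        moves   : ∀ i → i ℕ.< ℓ → node i ≢ node (suc i)
        simple  : ∀ i j → i ℕ.< ℓ → j ℕ.< ℓ → link i ≡ link j → i ≡ j

    -- Disjoint windows along a trail and the lower bound on tuples of centres.

    module _ {ℓ : ℕ} {H : Subset N} (trail : Trail ℓ H) (k : ℕ) where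

      open Trail trail

      private
        -- Records where on the trail the edges of a set lie. As links are distinct, disjointness of
        -- edge sets reduces to incompatibility of conditions on positions.
        Along : (ℕ → Set) → Subset N → Set
        Along Q S = ∀ {e} → e ∈ S → ∃[ j ] j ℕ.< ℓ × e ≡ link j × Q j

        along-disjoint : ∀ {Q Q′ S S′} → (∀ j → Q j → ¬ Q′ j) → Along Q S → Along Q′ S′ → ∀ {e} → e ∈ S → ¬ e ∈ S′
        along-disjoint {Q′ = Q′} Q#Q′ S-along S′-along e∈S e∈S′
          with i , i<ℓ , e≡i , Qi ← S-along e∈S | j , j<ℓ , e≡j , Q′j ← S′-along e∈S′ =
          Q#Q′ i Qi (subst Q′ (simple j i j<ℓ i<ℓ (trans (sym e≡j) e≡i)) Q′j)

        along-∪ : ∀ {Q Q₁ Q₂ S₁ S₂} → (∀ j → Q₁ j → Q j) → (∀ j → Q₂ j → Q j) →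
                  Along Q₁ S₁ → Along Q₂ S₂ → Along Q (S₁ ∪ S₂)
        along-∪ {S₁ = S₁} {S₂} f g S₁-along S₂-along e∈ with x∈p∪q⁻ S₁ S₂ e∈
        ... | inj₁ e∈₁ with j , j<ℓ , eq , q ← S₁-along e∈₁ = j , j<ℓ , eq , f j q
        ... | inj₂ e∈₂ with j , j<ℓ , eq , q ← S₂-along e∈₂ = j , j<ℓ , eq , g j q

        pred-∸ : ∀ {i t} → t ℕ.< i → i ∸ t ≡ suc (i ∸ suc t)
        pred-∸ {suc i} {t} (s≤s t≤i) = ℕₚ.+-∸-assoc 1 t≤i

      Near : ℕ → ℕ → Set
      Near i j = i ℕ.≤ j ℕ.+ k × j ℕ.≤ i ℕ.+ k

      module _ (i : ℕ) (k≤i : k ℕ.≤ i) (i+k<ℓ : i ℕ.+ k ℕ.< ℓ) where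

        private
          before after : Subset N
          before = span (λ t → link (i ∸ suc t)) k
          -- Written `t + suc i` because `suc t + suc i` then reduces to the successor of that
          -- position, which is the form of `target` and `moves`.
          after  = span (λ t → link (t ℕ.+ suc i)) k

          i<ℓ : i ℕ.< ℓ
          i<ℓ = ℕₚ.≤-<-trans (ℕₚ.m≤m+n i k) i+k<ℓ

          before< : ∀ {t} → t ℕ.< k → i ∸ suc t ℕ.< ℓ
          before< {t} _ = ℕₚ.≤-<-trans (ℕₚ.m∸n≤m i (suc t)) i<ℓ

          after< : ∀ {t} → t ℕ.< k → t ℕ.+ suc i ℕ.< ℓ
          after< {t} t<k = ℕₚ.≤-<-trans
            (subst (ℕ._≤ i ℕ.+ k) (trans (ℕₚ.+-comm i (suc t)) (sym (ℕₚ.+-suc t i))) (ℕₚ.+-monoʳ-≤ i t<k)) i+k<ℓ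

          self-along : Along (_≡ i) ⁅ link i ⁆
          self-along e∈ = i , i<ℓ , x∈⁅y⁆⇒x≡y (link i) e∈ , refl

          before-along : Along (λ j → j ℕ.< i × i ℕ.≤ j ℕ.+ k) before
          before-along e∈ with t , t<k , eq ← ∈-span⁻ (λ t → link (i ∸ suc t)) k e∈ =
            i ∸ suc t , before< t<k , eq ,
            ℕₚ.≤-trans (ℕₚ.≤-reflexive (sym (pred-∸ (ℕₚ.<-≤-trans t<k k≤i)))) (ℕₚ.m∸n≤m i t) ,
            subst (ℕ._≤ i ∸ suc t ℕ.+ k) (ℕₚ.m∸n+n≡m (ℕₚ.≤-trans t<k k≤i)) (ℕₚ.+-monoʳ-≤ (i ∸ suc t) t<k)

          after-along : Along (λ j → i ℕ.< j × j ℕ.≤ i ℕ.+ k) after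
          after-along e∈ with t , t<k , eq ← ∈-span⁻ (λ t → link (t ℕ.+ suc i)) k e∈ =
            t ℕ.+ suc i , after< t<k , eq , ℕₚ.m≤n+m (suc i) t ,
            subst (ℕ._≤ i ℕ.+ k) (trans (ℕₚ.+-comm i (suc t)) (sym (ℕₚ.+-suc t i))) (ℕₚ.+-monoʳ-≤ i t<k)

          walk-before : T (walk k (node i) before)
          walk-before = walk-intro k (λ t → node (i ∸ t)) (λ t → link (i ∸ suc t))
            (λ t t<k →
              let i∸t≡ = pred-∸ (ℕₚ.<-≤-trans t<k k≤i) in
              subst (λ j → node j ∈ edge (link (i ∸ suc t))) (sym i∸t≡) (target (i ∸ suc t) (before< t<k)) ,
              source (i ∸ suc t) (before< t<k) ,
              λ eq → moves (i ∸ suc t) (before< t<k) (trans (sym eq) (cong node i∸t≡)))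
            λ s t s<k t<k eq → ℕₚ.suc-injective (ℕₚ.∸-cancelˡ-≡ (ℕₚ.≤-trans s<k k≤i) (ℕₚ.≤-trans t<k k≤i)
              (simple _ _ (before< s<k) (before< t<k) eq))

          walk-after : T (walk k (node (suc i)) after)
          walk-after = walk-intro k (λ t → node (t ℕ.+ suc i)) (λ t → link (t ℕ.+ suc i))
            (λ t t<k → source _ (after< t<k) , target _ (after< t<k) , moves _ (after< t<k))
            λ s t s<k t<k eq → ℕₚ.+-cancelʳ-≡ (suc i) s t (simple _ _ (after< s<k) (after< t<k) eq)

          before#after : ∀ {e} → e ∈ before → ¬ e ∈ after
          before#after = along-disjoint (λ _ (j<i , _) (i<j , _) → ℕₚ.<-asym j<i i<j) before-along after-along

          sides-along : Along (λ j → j ≢ i × Near i j) (before ∪ after)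
          sides-along = along-∪
            (λ j (j<i , near) → ℕₚ.<⇒≢ j<i , near , ℕₚ.≤-trans (ℕₚ.<⇒≤ j<i) (ℕₚ.m≤m+n i k))
            (λ j (i<j , near) → ℕₚ.<⇒≢ i<j ∘ sym , ℕₚ.≤-trans (ℕₚ.<⇒≤ i<j) (ℕₚ.m≤m+n j k) , near)
            before-along after-along

        window : Subset N
        window = ⁅ link i ⁆ ∪ (before ∪ after)

        window-along : Along (Near i) window
        window-along = along-∪ (λ { j refl → ℕₚ.m≤m+n j k , ℕₚ.m≤m+n j k }) (λ j → proj₂) self-along sides-along

        window⊆ : window ⊆ H
        window⊆ e∈ with j , j<ℓ , refl , _ ← window-along e∈ = present j j<ℓ

        centre-window : T (centre k (link i) window)
        -- `pairs` contains the two vertices in only one order, and which one is unknown; hence the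
        -- box of the two walks is prepared in both orders.
        centre-window = [ via before□after , via after□before ]′
          (∈-pairs (∈-elements (source i i<ℓ)) (∈-elements (target i i<ℓ)) (moves i i<ℓ))
          where
          before□after : T ((walk k (node i) □ walk k (node (suc i))) (before ∪ after))
          before□after = □-intro (walk-monotone k (node i)) (walk-monotone k (node (suc i)))
            walk-before walk-after before#after (p⊆p∪q after) (q⊆p∪q before after)
          after□before : T ((walk k (node (suc i)) □ walk k (node i)) (before ∪ after))
          after□before = □-intro (walk-monotone k (node (suc i))) (walk-monotone k (node i))
            walk-after walk-before (λ e∈ e∈′ → before#after e∈′ e∈) (q⊆p∪q before after) (p⊆p∪q after)
          via : ∀ {v w} → T ((walk k v □ walk k w) (before ∪ after)) → (v , w) ∈ˡ pairs (elements (edge (link i))) →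
                T (centre k (link i) window)
          via {v} {w} walks v,w∈ = ∈⇒⋃ (λ (v , w) → has (link i) □ walk k v □ walk k w) v,w∈ window
            (□-intro (has-monotone (link i)) (□-monotone (walk-monotone k v) (walk-monotone k w))
              (∈⇒has (x∈⁅x⁆ (link i))) walks
              (along-disjoint (λ j j≡i (j≢i , _) → j≢i j≡i) self-along sides-along)
              (p⊆p∪q (before ∪ after)) (q⊆p∪q ⁅ link i ⁆ (before ∪ after)))

      private
        2k 4k+1 : ℕ
        2k = k ℕ.+ k
        4k+1 = suc (2k ℕ.+ 2k)

        -- The first and last k positions lack room for a walk of k links on one side. Windows have
        -- radius k, so a new one misses that of a used position a when their centres are more than
        -- 2k apart; this excludes 4k + 1 positions. Truncated subtraction near the start only
        -- shifts the interval to the right, and it still covers all of them.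
        forbidden : List ℕ → List (ℕ × ℕ)
        forbidden is = (0 , k) ∷ (ℓ ∸ k , k) ∷ map (λ a → a ∸ 2k , 4k+1) is

        totalWidth-forbidden : ∀ is → totalWidth (forbidden is) ≡ 2k ℕ.+ length is ℕ.* 4k+1
        totalWidth-forbidden is = trans (sym (ℕₚ.+-assoc k k _)) (cong (2k ℕ.+_) (go is))
          where
          go : ∀ is → totalWidth (map (λ a → a ∸ 2k , 4k+1) is) ≡ length is ℕ.* 4k+1
          go []       = refl
          go (_ ∷ is) = cong (4k+1 ℕ.+_) (go is)

        outside-interval : ∀ lo w {is i} → T (avoids ((lo , w) ∷ is) i) → ¬ (lo ℕ.≤ i × i ℕ.< lo ℕ.+ w)
        outside-interval lo w {is} {i} h (lo≤i , i<) with within lo w i | within⁺ lo w lo≤i i<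
        ... | true | _ = h

        avoids-tail : ∀ lo w is {i} → T (avoids ((lo , w) ∷ is) i) → T (avoids is i)
        avoids-tail lo w is {i} h with within lo w i
        ... | false = h

        avoids-far : ∀ {is a i} → a ∈ˡ is → T (avoids (map (λ a → a ∸ 2k , 4k+1) is) i) →
                     i ℕ.≤ a ℕ.+ 2k → ¬ a ℕ.≤ i ℕ.+ 2k
        avoids-far {a ∷ is} {i = i} (here refl) h i≤ a≤ = outside-interval (a ∸ 2k) 4k+1 {map (λ a → a ∸ 2k , 4k+1) is} h
          (ℕₚ.m≤n+o⇒m∸n≤o a 2k (subst (a ℕ.≤_) (ℕₚ.+-comm i 2k) a≤) , ℕₚ.≤-<-trans i≤ (subst (a ℕ.+ 2k ℕ.<_) (sym (ℕₚ.+-suc (a ∸ 2k) (2k ℕ.+ 2k)))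
            (s≤s (subst (a ℕ.+ 2k ℕ.≤_) (ℕₚ.+-assoc (a ∸ 2k) 2k 2k) (ℕₚ.+-monoˡ-≤ 2k (subst (a ℕ.≤_) (ℕₚ.+-comm 2k (a ∸ 2k)) (ℕₚ.m≤n+m∸n a 2k)))))))
        avoids-far {a ∷ is} (there b∈) h = avoids-far b∈ (avoids-tail (a ∸ 2k) 4k+1 (map (λ a → a ∸ 2k , 4k+1) is) h)

        avoids⇒window : ∀ {is i} → i ℕ.< ℓ → T (avoids (forbidden is) i) →
                        k ℕ.≤ i × i ℕ.+ k ℕ.< ℓ × T (avoids (map (λ a → a ∸ 2k , 4k+1) is) i)
        avoids⇒window {is} {i} i<ℓ h =
          ℕₚ.≮⇒≥ (λ i<k → outside-interval 0 k {(ℓ ∸ k , k) ∷ rest} h (z≤n , i<k)) ,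
          ℕₚ.≰⇒> (λ ℓ≤i+k → outside-interval (ℓ ∸ k) k {rest} h′
            (ℕₚ.m≤n+o⇒m∸n≤o ℓ k (subst (ℓ ℕ.≤_) (ℕₚ.+-comm i k) ℓ≤i+k) ,
             ℕₚ.<-≤-trans i<ℓ (subst (ℓ ℕ.≤_) (ℕₚ.+-comm k (ℓ ∸ k)) (ℕₚ.m≤n+m∸n ℓ k)))) ,
          avoids-tail (ℓ ∸ k) k rest h′
          where
          rest : List (ℕ × ℕ)
          rest = map (λ a → a ∸ 2k , 4k+1) is
          h′ : T (avoids ((ℓ ∸ k , k) ∷ rest) i)
          h′ = avoids-tail 0 k ((ℓ ∸ k , k) ∷ rest) h

        lost : ℕ → ℕ
        lost j = 2k ℕ.+ j ℕ.* 4k+1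

        -- The loss is measured at the final number m of positions instead of the current one, so
        -- that every choice contributes the same factor and the product is a pure power, comparable
        -- with `X ^ j`.
        count-allowed : ∀ is {m} → length is ℕ.≤ m →
                        fromℕ (ℓ ∸ lost m) ≤ sum {ℓ} (λ i → 𝟙 (avoids (forbidden is) (toℕ i)))
        count-allowed is {m} is≤m with ℕₚ.≤-total ℓ (lost m)
        ... | inj₁ ℓ≤ = subst (λ x → fromℕ x ≤ s) (sym (ℕₚ.m≤n⇒m∸n≡0 ℓ≤)) (0≤sum {ℓ} λ i → 0≤𝟙 (avoids (forbidden is) (toℕ i)))
          where
          s : ℚ
          s = sum {ℓ} (λ i → 𝟙 (avoids (forbidden is) (toℕ i)))
        ... | inj₂ ≤ℓ = 0≤-⇒≤ (subst (0ℚ ≤_) (lem (fromℕ (lost m)) s (fromℕ (ℓ ∸ lost m)))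
            (≤⇒0≤- (subst (_≤ s + fromℕ (lost m)) (trans (cong fromℕ (sym (ℕₚ.m∸n+n≡m ≤ℓ))) (fromℕ-+ (ℓ ∸ lost m) (lost m)))
              (≤-trans (count-avoids ℓ (forbidden is)) (+-monoʳ-≤ s (fromℕ-mono
                (subst (ℕ._≤ lost m) (sym (totalWidth-forbidden is)) (ℕₚ.+-monoʳ-≤ 2k (ℕₚ.*-monoˡ-≤ 4k+1 is≤m)))))))))
          where
          s : ℚ
          s = sum {ℓ} (λ i → 𝟙 (avoids (forbidden is) (toℕ i)))
          lem : ∀ b s a → s + b - (a + b) ≡ s - a
          lem = solve-∀ ℚ-ring

        -- Given windows around the positions is already used by A, each further centre has at least
        -- ℓ ∸ lost m choices whose window is disjoint from all of them.
        tuples-lower′ : ∀ j is {m} → length is ℕ.+ j ≡ m → ∀ {A U} → Monotone A → T (A U) → U ⊆ H →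
          (∀ {e} → e ∈ U → ∃[ a ] a ∈ˡ is × ∃[ j ] j ℕ.< ℓ × e ≡ link j × Near a j) →
          fromℕ (ℓ ∸ lost m) ^ j ≤ tuples (centre k) j A H
        tuples-lower′ zero is _ {A} mA AU U⊆H _ = 1≤𝟙 (A H) (mA U⊆H AU)
          where
          1≤𝟙 : ∀ b → T b → 1ℚ ≤ 𝟙 b
          1≤𝟙 true _ = ≤-refl
        tuples-lower′ (suc j) is {m} refl {A} {U} mA AU U⊆H U-near = ≤-trans
          (*-monoʳ (c ^ j) (0≤^ j (0≤fromℕ (ℓ ∸ lost m))) (count-allowed is (ℕₚ.m≤m+n (length is) (suc j))))
          (≤-trans
            (≤-reflexive (trans (*-comm (sum {ℓ} (λ i → 𝟙 (avoids (forbidden is) (toℕ i)))) (c ^ j))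
              (*-distribˡ-sum {ℓ} (c ^ j) (λ i → 𝟙 (avoids (forbidden is) (toℕ i))))))
            (≤-trans
              (sum-mono {ℓ} {f = λ i → c ^ j * 𝟙 (avoids (forbidden is) (toℕ i))} λ i → choice i _ refl)
              -- Distinct positions carry distinct links, so the sum over positions is part of the
              -- sum over all edges; the remaining terms are nonnegative.
              (sum-injective-≤ (λ i → link (toℕ i))
                (λ a b eq → Finₚ.toℕ-injective (simple (toℕ a) (toℕ b) (Finₚ.toℕ<n a) (Finₚ.toℕ<n b) eq))
                (λ e → tuples (centre k) j (centre k e □ A) H) (λ e → 0≤tuples (centre k) j (centre k e □ A) H))))
          where
          c : ℚ
          c = fromℕ (ℓ ∸ lost m)
          choice : ∀ (i : Fin ℓ) b → avoids (forbidden is) (toℕ i) ≡ b →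
                   c ^ j * 𝟙 b ≤ tuples (centre k) j (centre k (link (toℕ i)) □ A) H
          choice i false _ = subst (_≤ tuples (centre k) j (centre k (link (toℕ i)) □ A) H) (sym (*-zeroʳ (c ^ j)))
            (0≤tuples (centre k) j (centre k (link (toℕ i)) □ A) H)
          choice i true avoid≡ with k≤i , i+k<ℓ , far ← avoids⇒window {is} (Finₚ.toℕ<n i) (subst T (sym avoid≡) _) =
            subst (_≤ tuples (centre k) j (centre k (link (toℕ i)) □ A) H) (sym (*-identityʳ (c ^ j)))
              (tuples-lower′ j (toℕ i ∷ is) (sym (ℕₚ.+-suc (length is) j))
                (□-monotone (centre-monotone k (link (toℕ i))) mA)
                (□-intro (centre-monotone k (link (toℕ i))) mA (centre-window (toℕ i) k≤i i+k<ℓ) AU disjoint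
                  (p⊆p∪q U) (q⊆p∪q w U))
                (λ e∈ → [ window⊆ (toℕ i) k≤i i+k<ℓ , U⊆H ] (x∈p∪q⁻ w U e∈))
                λ e∈ → [ (λ e∈w → toℕ i , here refl , window-along (toℕ i) k≤i i+k<ℓ e∈w)
                       , (λ e∈U → let a , a∈ , rest = U-near e∈U in a , there a∈ , rest) ] (x∈p∪q⁻ w U e∈))
            where
            w : Subset N
            w = window (toℕ i) k≤i i+k<ℓ
            disjoint : ∀ {e} → e ∈ w → ¬ e ∈ U
            disjoint e∈w e∈U
              with x , x<ℓ , refl , i≤x+k , x≤i+k ← window-along (toℕ i) k≤i i+k<ℓ e∈w
                 | a , a∈ , y , y<ℓ , x≡y , a≤y+k , y≤a+k ← U-near e∈U
              with refl ← simple x y x<ℓ y<ℓ x≡y =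
              avoids-far a∈ far
                (ℕₚ.≤-trans i≤x+k (subst (x ℕ.+ k ℕ.≤_) (ℕₚ.+-assoc a k k) (ℕₚ.+-monoˡ-≤ k y≤a+k)))
                (ℕₚ.≤-trans a≤y+k (subst (x ℕ.+ k ℕ.≤_) (ℕₚ.+-assoc (toℕ i) k k) (ℕₚ.+-monoˡ-≤ k x≤i+k)))

      tuples-lower : ∀ j → fromℕ (ℓ ∸ (k ℕ.+ k ℕ.+ j ℕ.* suc (k ℕ.+ k ℕ.+ (k ℕ.+ k)))) ^ j ≤
                           tuples (centre k) j (λ _ → true) H
      tuples-lower j = tuples-lower′ j [] refl true-monotone _ ⊥⊆ λ e∈ → contradiction e∈ ∉⊥

-- Counting r-subsets, evaluating `Pr`, and reading a loose path as a trail.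

module LooseHypergraphs where

  open import Data.Bool using (Bool; true; false; _∧_; if_then_else_)
  open import Data.Bool.Properties using (∧-identityʳ; ∧-zeroʳ)
  open import Data.Fin using (Fin; zero; suc; toℕ; fromℕ<)
  import Data.Fin.Properties as Finₚ
  open import Data.Fin.Subset using (Subset; inside; outside; _∈_; ∣_∣)
  open import Data.Fin.Subset.Properties using (_∈?_)
  open import Data.List using (List; []; _∷_; _++_; map; length; allFin; filter; lookup; foldr)
  open import Data.List.Membership.Propositional.Properties using (∈-filter⁻; ∈-lookup)
  open import Data.List.Properties using (filter-++; length-++; map-tabulate; tabulate-lookup; map-++)
  open import Data.Nat as ℕ using (ℕ; zero; suc; z≤n; s≤s)
  open import Data.Nat.Combinatorics using (_C_; nCn≡1; nCk+nC[k+1]≡[n+1]C[k+1])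
  import Data.Nat.Properties as ℕₚ
  import Data.Nat.Tactic.RingSolver as ℕ-Solver
  open import Data.Product using (_,_; proj₁; proj₂)
  open import Data.Rational using (ℚ; 1ℚ; _+_; _*_; _-_)
  open import Data.Rational.Properties
  open import Data.Vec using ([]; _∷_)
  open import Function using (_∘_; Equivalence; id)
  open import Relation.Binary using (tri<; tri≈; tri>)
  open import Relation.Binary.PropositionalEquality using (_≡_; _≢_; refl; sym; trans; cong; cong₂; subst; subst₂)
  open import Relation.Nullary using (does; contradiction)
  open import Relation.Nullary.Decidable using (_×-dec_)
  open import Relation.Unary using (Decidable)
  open import Tactic.RingSolver using (solve-∀)

  open import Defs
  open Rationals
  open RandomSubsets
  open Exploration
  open Equivalence using (to; from)

  length-filter-map : ∀ {X Y : Set} {Q : Y → Set} (Q? : Decidable Q) (f : X → Y) xs →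
                      length (filter Q? (map f xs)) ≡ length (filter (Q? ∘ f) xs)
  length-filter-map Q? f []       = refl
  length-filter-map Q? f (x ∷ xs) with does (Q? (f x))
  ... | true  = cong suc (length-filter-map Q? f xs)
  ... | false = length-filter-map Q? f xs

  length-filter-filter : ∀ {X : Set} {Q R : X → Set} (Q? : Decidable Q) (R? : Decidable R) xs →
                         length (filter Q? (filter R? xs)) ≡ length (filter (λ x → R? x ×-dec Q? x) xs)
  length-filter-filter Q? R? []       = refl
  length-filter-filter Q? R? (x ∷ xs) with does (R? x)
  ... | false = length-filter-filter Q? R? xs
  ... | true  with does (Q? x)
  ...   | true  = cong suc (length-filter-filter Q? R? xs)
  ...   | false = length-filter-filter Q? R? xs

  -- Counting one coordinate at a time turns the number of sets of a given size, and the degree of a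
  -- vertex, into Pascal's rule.
  tally : ∀ n → (Subset n → Bool) → ℕ
  tally zero    q = if q [] then 1 else 0
  tally (suc n) q = tally n (q ∘ (inside ∷_)) ℕ.+ tally n (q ∘ (outside ∷_))

  tally-false : ∀ n → tally n (λ _ → false) ≡ 0
  tally-false zero    = refl
  tally-false (suc n) = cong₂ ℕ._+_ (tally-false n) (tally-false n)

  tally-cong : ∀ n {q q′ : Subset n → Bool} → (∀ S → q S ≡ q′ S) → tally n q ≡ tally n q′
  tally-cong zero    q≡q′ = cong (if_then 1 else 0) (q≡q′ [])
  tally-cong (suc n) q≡q′ = cong₂ ℕ._+_ (tally-cong n (q≡q′ ∘ (inside ∷_))) (tally-cong n (q≡q′ ∘ (outside ∷_)))

  length-filter-allSubsets : ∀ n {Q : Subset n → Set} (Q? : Decidable Q) →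
                             length (filter Q? (allSubsets n)) ≡ tally n (does ∘ Q?)
  length-filter-allSubsets zero Q? with does (Q? [])
  ... | true  = refl
  ... | false = refl
  length-filter-allSubsets (suc n) Q? =
    trans (cong length (filter-++ Q? (map (inside ∷_) (allSubsets n)) (map (outside ∷_) (allSubsets n))))
    (trans (length-++ (filter Q? (map (inside ∷_) (allSubsets n))))
      (cong₂ ℕ._+_ (half inside) (half outside)))
    where
    half : ∀ x → length (filter Q? (map (x ∷_) (allSubsets n))) ≡ tally n (does ∘ Q? ∘ (x ∷_))
    half x = trans (length-filter-map Q? (x ∷_) (allSubsets n)) (length-filter-allSubsets n (Q? ∘ (x ∷_)))

  tally-size : ∀ n r → tally n (λ S → does (∣ S ∣ ℕ.≟ r)) ≡ n C r
  tally-size zero    zero    = refl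
  tally-size zero    (suc r) = refl
  tally-size (suc n) zero    = cong₂ ℕ._+_ (tally-false n) (tally-size n zero)
  tally-size (suc n) (suc r) = trans (cong₂ ℕ._+_ (tally-size n r) (tally-size n (suc r))) (nCk+nC[k+1]≡[n+1]C[k+1] n r)

  tally-degree : ∀ n r (v : Fin (suc n)) →
                 tally (suc n) (λ S → does (∣ S ∣ ℕ.≟ suc r) ∧ does (v ∈? S)) ≡ n C r
  tally-degree n r zero = trans
    (cong₂ ℕ._+_
      (trans (tally-cong n λ S → ∧-identityʳ (does (∣ S ∣ ℕ.≟ r))) (tally-size n r))
      (trans (tally-cong n λ S → ∧-zeroʳ (does (∣ S ∣ ℕ.≟ suc r))) (tally-false n)))
    (ℕₚ.+-identityʳ (n C r))
  tally-degree (suc n) zero (suc v) = cong₂ ℕ._+_ (none (suc n) v) (tally-degree n zero v)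
    where
    none : ∀ n (v : Fin n) → tally n (λ S → does (∣ S ∣ ℕ.≟ 0) ∧ does (v ∈? S)) ≡ 0
    none (suc n) zero    = cong₂ ℕ._+_ (tally-false n)
      (trans (tally-cong n λ S → ∧-zeroʳ (does (∣ S ∣ ℕ.≟ 0))) (tally-false n))
    none (suc n) (suc v) = cong₂ ℕ._+_ (tally-false n) (none n v)
  tally-degree (suc n) (suc r) (suc v) =
    trans (cong₂ ℕ._+_ (tally-degree n r v) (tally-degree n (suc r) v)) (nCk+nC[k+1]≡[n+1]C[k+1] n r)

  -- Double counting of vertex-edge incidences in the complete uniform hypergraph; it expresses the
  -- number of possible edges through the degree.
  absorption : ∀ n k → suc k ℕ.* (suc n C suc k) ≡ suc n ℕ.* (n C k)
  absorption zero    zero    = refl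
  absorption zero    (suc k) = ℕₚ.*-zeroʳ (suc (suc k))
  absorption (suc n) k = trans (cong (suc k ℕ.*_) (sym (nCk+nC[k+1]≡[n+1]C[k+1] (suc n) k)))
    (trans (ℕₚ.*-distribˡ-+ (suc k) (suc n C k) (suc n C suc k))
    (trans (cong (suc k ℕ.* (suc n C k) ℕ.+_) (absorption n k)) (rest k)))
    where
    rest : ∀ k → suc k ℕ.* (suc n C k) ℕ.+ suc n ℕ.* (n C k) ≡ suc (suc n) ℕ.* (suc n C k)
    rest zero    = lem n
      where
      lem : ∀ n → 1 ℕ.* 1 ℕ.+ (1 ℕ.+ n) ℕ.* 1 ≡ (2 ℕ.+ n) ℕ.* 1
      lem = ℕ-Solver.solve-∀
    rest (suc k) = trans (cong (λ x → suc n C suc k ℕ.+ x ℕ.+ suc n ℕ.* (n C suc k)) (absorption n k))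
      (trans (lem n (suc n C suc k) (n C k) (n C suc k))
        (cong (λ x → suc n C suc k ℕ.+ suc n ℕ.* x) (nCk+nC[k+1]≡[n+1]C[k+1] n k)))
      where
      lem : ∀ n c x y → c ℕ.+ (1 ℕ.+ n) ℕ.* x ℕ.+ (1 ℕ.+ n) ℕ.* y ≡ c ℕ.+ (1 ℕ.+ n) ℕ.* (x ℕ.+ y)
      lem = ℕ-Solver.solve-∀

  -- Linear growth is enough: the degree only has to exceed constants chosen before n.
  n<C : ∀ n d → 1 ℕ.≤ d → n ℕ.< (d ℕ.+ n) C d
  n<C zero    d       1≤d = subst (λ m → 0 ℕ.< m C d) (sym (ℕₚ.+-identityʳ d)) (subst (0 ℕ.<_) (sym (nCn≡1 d)) ℕₚ.≤-refl)
  n<C (suc n) (suc d) 1≤d = subst (λ m → suc n ℕ.< m C suc d) (sym (ℕₚ.+-suc (suc d) n))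
    (subst (suc n ℕ.<_) (nCk+nC[k+1]≡[n+1]C[k+1] (suc d ℕ.+ n) d)
      (ℕₚ.+-mono-≤ (0<C d) (n<C n (suc d) 1≤d)))
    where
    0<C : ∀ d → 0 ℕ.< (suc d ℕ.+ n) C d
    0<C zero    = ℕₚ.≤-refl
    0<C (suc d) = ℕₚ.≤-<-trans z≤n (subst (λ m → suc n ℕ.< m C suc d) (ℕₚ.+-suc (suc d) n) (n<C (suc n) (suc d) (s≤s z≤n)))

  module _ (r n : ℕ) where

    edgeSet : Fin (length (rSubsets r n)) → Subset n
    edgeSet = lookup (rSubsets r n)

    ∣edgeSet∣ : ∀ e → ∣ edgeSet e ∣ ≡ r
    ∣edgeSet∣ e = proj₂ (∈-filter⁻ (λ S → ∣ S ∣ ℕ.≟ r) {xs = allSubsets n} (∈-lookup e))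

    ∣rSubsets∣ : length (rSubsets r n) ≡ n C r
    ∣rSubsets∣ = trans (length-filter-allSubsets n (λ S → ∣ S ∣ ℕ.≟ r)) (tally-size n r)

  degree : ∀ r n (v : Fin (suc n)) →
           length (incident (edgeSet (suc r) (suc n)) (∣edgeSet∣ (suc r) (suc n)) v) ≡ n C r
  degree r n v = trans (sym (length-filter-map (v ∈?_) (lookup xs) (allFin (length xs))))
    (trans (cong (length ∘ filter (v ∈?_)) (trans (map-tabulate id (lookup xs)) (tabulate-lookup xs)))
    (trans (length-filter-filter (v ∈?_) (λ S → ∣ S ∣ ℕ.≟ suc r) (allSubsets (suc n)))
    (trans (length-filter-allSubsets (suc n) (λ S → (∣ S ∣ ℕ.≟ suc r) ×-dec (v ∈? S))) (tally-degree n r v))))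
    where
    xs : List (Subset (suc n))
    xs = rSubsets (suc r) (suc n)

  -- `g` is constrained only through its m-th term, which lets the induction replace it by the
  -- reweighted summand `h` on one coordinate fewer.
  E-weight : ∀ {N} p m (f : Subset N → ℚ) (g : Subset N → ℝ) →
             (∀ S → seq (g S) m ≡ seq (weight p S) m * f S) →
             seq (foldr _+ℝ_ 0ℝ (map g (allSubsets N))) m ≡ E (seq p m) f
  E-weight {zero}  p m f g g≡ = trans (+-identityʳ _) (trans (g≡ []) (*-identityˡ (f [])))
  E-weight {suc N} p m f g g≡ = trans (cong (λ xs → seq (foldr _+ℝ_ 0ℝ xs) m)
      (map-++ g (map (inside ∷_) (allSubsets N)) (map (outside ∷_) (allSubsets N))))
    (trans (seq-++ (map g (map (inside ∷_) (allSubsets N))) (map g (map (outside ∷_) (allSubsets N))))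
      (cong₂ _+_ (half inside (seq p m) λ S → refl) (half outside (1ℚ - seq p m) λ S → refl)))
    where
    seq-++ : ∀ xs ys → seq (foldr _+ℝ_ 0ℝ (xs ++ ys)) m ≡ seq (foldr _+ℝ_ 0ℝ xs) m + seq (foldr _+ℝ_ 0ℝ ys) m
    seq-++ []       ys = sym (+-identityˡ _)
    seq-++ (x ∷ xs) ys = trans (cong (seq x m +_) (seq-++ xs ys)) (sym (+-assoc (seq x m) _ _))
    half : ∀ x c → (∀ S → seq (weight p (x ∷ S)) m ≡ c * seq (weight p S) m) →
           seq (foldr _+ℝ_ 0ℝ (map g (map (x ∷_) (allSubsets N)))) m ≡ c * E (seq p m) (f ∘ (x ∷_))
    half x c w≡ = trans (scale (allSubsets N)) (cong (c *_) (E-weight p m (f ∘ (x ∷_)) h λ S → refl))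
      where
      h : Subset N → ℝ
      h S = weight p S *ℝ fromℚ (f (x ∷ S))
      scale : ∀ Ss → seq (foldr _+ℝ_ 0ℝ (map g (map (x ∷_) Ss))) m ≡ c * seq (foldr _+ℝ_ 0ℝ (map h Ss)) m
      scale []       = sym (*-zeroʳ c)
      scale (S ∷ Ss) = trans
        (cong₂ _+_ (trans (g≡ (x ∷ S)) (trans (cong (_* f (x ∷ S)) (w≡ S)) (*-assoc c _ _))) (scale Ss))
        (sym (*-distribˡ-+ c _ _))

  seq-Pr : ∀ r n p A m → seq (Pr r n p A) m ≡ P (seq p m) A
  seq-Pr r n p A m = E-weight p m (𝟙 ∘ A) (λ H → if A H then weight p H else 0ℝ) λ H → if-𝟙 H (A H)
    where
    if-𝟙 : ∀ {N} (H : Subset N) b → seq (if b then weight p H else 0ℝ) m ≡ seq (weight p H) m * 𝟙 b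
    if-𝟙 H true  = sym (*-identityʳ (seq (weight p H) m))
    if-𝟙 H false = sym (*-zeroʳ (seq (weight p H) m))

  module _ {d n ℓ′ : ℕ} {H : Hypergraph (suc d) n} (1≤d : 1 ℕ.≤ d) (path : LoosePath (suc d) n H (suc ℓ′)) where

    open LoosePath path

    private
      ℓ : ℕ
      ℓ = suc ℓ′

      -- Positions past the end are clamped to the last vertex, and edge indices likewise below; a
      -- trail of length ℓ constrains neither. Clamping edge indices requires at least one edge,
      -- hence ℓ = `suc ℓ′`.
      position : ℕ → Fin (suc (ℓ ℕ.* d))
      position j = fromℕ< (s≤s (ℕₚ.m⊓n≤n j (ℓ ℕ.* d)))

      toℕ-position : ∀ {j} → j ℕ.≤ ℓ ℕ.* d → toℕ (position j) ≡ j
      toℕ-position j≤ = trans (Finₚ.toℕ-fromℕ< _) (ℕₚ.m≤n⇒m⊓n≡m j≤)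

      edgeIndex : ℕ → Fin ℓ
      edgeIndex i = fromℕ< (s≤s (ℕₚ.m⊓n≤n i ℓ′))

      toℕ-edgeIndex : ∀ {i} → i ℕ.< ℓ → toℕ (edgeIndex i) ≡ i
      toℕ-edgeIndex (s≤s i≤ℓ′) = trans (Finₚ.toℕ-fromℕ< _) (ℕₚ.m≤n⇒m⊓n≡m i≤ℓ′)

      vertexAt : ℕ → Fin n
      vertexAt = vertex ∘ position

      linkAt : ℕ → Fin (length (rSubsets (suc d) n))
      linkAt i = proj₁ (isEdge (edgeIndex i))

      vertexAt-injective : ∀ {j k} → j ℕ.≤ ℓ ℕ.* d → k ℕ.≤ ℓ ℕ.* d → vertexAt j ≡ vertexAt k → j ≡ k
      vertexAt-injective j≤ k≤ eq =
        trans (sym (toℕ-position j≤)) (trans (cong toℕ (distinct _ _ eq)) (toℕ-position k≤))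

      vertexAt-∈ : ∀ {i j} → i ℕ.< ℓ → j ℕ.≤ ℓ ℕ.* d → i ℕ.* d ℕ.≤ j → j ℕ.< i ℕ.* d ℕ.+ suc d →
                   vertexAt j ∈ edgeSet (suc d) n (linkAt i)
      vertexAt-∈ {i} {j} i<ℓ j≤ id≤j j<id+r =
        subst (vertexAt j ∈_) (sym (proj₂ (proj₂ (isEdge (edgeIndex i))))) (from (segment (edgeIndex i) (vertexAt j))
          (position j ,
           subst₂ ℕ._≤_ (cong (ℕ._* d) (sym (toℕ-edgeIndex i<ℓ))) (sym (toℕ-position j≤)) id≤j ,
           subst₂ ℕ._<_ (sym (toℕ-position j≤)) (cong (λ i → i ℕ.* d ℕ.+ suc d) (sym (toℕ-edgeIndex i<ℓ))) j<id+r ,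
           refl))

      ∈-vertexAt : ∀ {i j} → i ℕ.< ℓ → j ℕ.≤ ℓ ℕ.* d → vertexAt j ∈ edgeSet (suc d) n (linkAt i) → i ℕ.* d ℕ.≤ j
      ∈-vertexAt {i} {j} i<ℓ j≤ j∈
        with k , lo , hi , eq ← to (segment (edgeIndex i) (vertexAt j))
                                    (subst (vertexAt j ∈_) (proj₂ (proj₂ (isEdge (edgeIndex i)))) j∈) =
        subst₂ ℕ._≤_ (cong (ℕ._* d) (toℕ-edgeIndex i<ℓ)) (trans (cong toℕ (distinct _ _ eq)) (toℕ-position j≤)) lo

      id≤ℓd : ∀ {i} → i ℕ.≤ ℓ → i ℕ.* d ℕ.≤ ℓ ℕ.* d
      id≤ℓd = ℕₚ.*-monoˡ-≤ d

      id<[1+i]d : ∀ {i j} → i ℕ.< j → i ℕ.* d ℕ.< j ℕ.* d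
      id<[1+i]d = ℕₚ.*-monoˡ-< d {{ℕ.>-nonZero 1≤d}}

      -- The vertex at position i d separates the two: it lies on link i, while link j has only
      -- vertices from position j d onwards and positions determine vertices injectively.
      link-distinct : ∀ {i j} → i ℕ.< j → j ℕ.< ℓ → linkAt i ≢ linkAt j
      link-distinct {i} {j} i<j j<ℓ eq = ℕₚ.<⇒≱ (id<[1+i]d i<j) (∈-vertexAt j<ℓ (id≤ℓd (ℕₚ.<⇒≤ i<ℓ))
        (subst (λ e → vertexAt (i ℕ.* d) ∈ edgeSet (suc d) n e) eq
          (vertexAt-∈ i<ℓ (id≤ℓd (ℕₚ.<⇒≤ i<ℓ)) ℕₚ.≤-refl (ℕₚ.m<m+n (i ℕ.* d) (s≤s z≤n)))))
        where
        i<ℓ : i ℕ.< ℓ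
        i<ℓ = ℕₚ.<-trans i<j j<ℓ

    LoosePath⇒Trail : Trail (edgeSet (suc d) n) (∣edgeSet∣ (suc d) n) ℓ H
    LoosePath⇒Trail = record
      { node    = λ i → vertexAt (i ℕ.* d)
      ; link    = linkAt
      ; present = λ i _ → proj₁ (proj₂ (isEdge (edgeIndex i)))
      ; source  = λ i i<ℓ → vertexAt-∈ i<ℓ (id≤ℓd (ℕₚ.<⇒≤ i<ℓ)) ℕₚ.≤-refl (ℕₚ.m<m+n (i ℕ.* d) (s≤s z≤n))
      ; target  = λ i i<ℓ → vertexAt-∈ i<ℓ (id≤ℓd i<ℓ) (ℕₚ.m≤n+m (i ℕ.* d) d)
          (subst (ℕ._< i ℕ.* d ℕ.+ suc d) (ℕₚ.+-comm (i ℕ.* d) d) (ℕₚ.+-monoʳ-< (i ℕ.* d) ℕₚ.≤-refl))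
      ; moves   = λ i i<ℓ eq → ℕₚ.<⇒≢ (id<[1+i]d {i} {suc i} ℕₚ.≤-refl)
          (vertexAt-injective (id≤ℓd (ℕₚ.<⇒≤ i<ℓ)) (id≤ℓd i<ℓ) eq)
      ; simple  = links-simple
      }
      where
      links-simple : ∀ i j → i ℕ.< ℓ → j ℕ.< ℓ → linkAt i ≡ linkAt j → i ≡ j
      links-simple i j i<ℓ j<ℓ eq with ℕₚ.<-cmp i j
      ... | tri< i<j _ _ = contradiction eq (link-distinct i<j j<ℓ)
      ... | tri≈ _ i≡j _ = i≡j
      ... | tri> _ _ j<i = contradiction (sym eq) (link-distinct j<i i<ℓ)

-- Existence of longest paths and cycles, and their comparison.

module Longest where

  open import Data.Fin using (Fin; zero; suc; toℕ; fromℕ; fromℕ<; inject≤; finToFun; funToFin)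
  import Data.Fin.Properties as Finₚ
  open import Data.Fin.Subset using (Subset; _∈_)
  open import Data.Fin.Subset.Properties using (_∈?_)
  open import Data.List using (lookup)
  open import Data.Nat as ℕ using (ℕ; zero; suc; z≤n; s≤s; _≤_; _<_; _+_; _*_)
  import Data.Nat.Properties as ℕₚ
  open import Data.Product using (_×_; _,_; proj₁; proj₂; ∃-syntax)
  open import Function using (_∘_; mk⇔; Equivalence)
  open import Relation.Binary.PropositionalEquality using (_≡_; _≗_; refl; sym; trans; cong; subst)
  open import Relation.Nullary using (Dec; yes; no; contradiction)
  open import Relation.Nullary.Decidable using (_×-dec_; _→-dec_; map′)

  open import Defs
  open Equivalence using (to; from)

  -- A finite search over codes of functions. Decoding a code returns the function only up to
  -- pointwise equality, so `Q` has to respect that.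
  any-function? : ∀ {m n} {Q : (Fin m → Fin n) → Set} → (∀ f → Dec (Q f)) → (∀ {f g} → f ≗ g → Q f → Q g) → Dec (∃[ f ] Q f)
  any-function? Q? resp = map′
    (λ (c , q) → finToFun c , q)
    (λ (f , q) → funToFin f , resp (sym ∘ Finₚ.finToFun-funToFin f) q)
    (Finₚ.any? (Q? ∘ finToFun))

  greatest : ∀ {Q : ℕ → Set} → (∀ ℓ → Dec (Q ℓ)) → Q 0 → ∀ B → (∀ ℓ → Q ℓ → ℓ ≤ B) → ∃[ L ] IsGreatest Q L
  greatest Q? q₀ B Q≤B with Q? B
  ... | yes q = B , q , Q≤B
  greatest Q? q₀ zero    Q≤B | no ¬q = contradiction q₀ ¬q
  greatest {Q} Q? q₀ (suc B) Q≤B | no ¬q = greatest Q? q₀ B λ ℓ q → ℕₚ.≤-pred (ℕₚ.≤∧≢⇒< (Q≤B ℓ q) λ { refl → ¬q q })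

  module _ {r n ℓ m : ℕ} (H : Hypergraph r n) where

    isSegment? : ∀ (v : Fin m → Fin n) i e → Dec (IsSegment r v i e)
    isSegment? v i e = Finₚ.all? λ x →
      let here? = Finₚ.any? λ k → (i * (r ℕ.∸ 1) ℕ.≤? toℕ k) ×-dec (toℕ k ℕ.<? i * (r ℕ.∸ 1) + r) ×-dec (v k Finₚ.≟ x)
      in map′ (λ (f , g) → mk⇔ f g) (λ f⇔g → to f⇔g , from f⇔g) (((x ∈? e) →-dec here?) ×-dec (here? →-dec (x ∈? e)))

    isSegment-resp : ∀ {v w : Fin m → Fin n} {i e} → v ≗ w → IsSegment r v i e → IsSegment r w i e
    isSegment-resp v≗w seg x = mk⇔
      (λ x∈e → let k , lo , hi , eq = to (seg x) x∈e in k , lo , hi , trans (sym (v≗w k)) eq)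
      (λ (k , lo , hi , eq) → from (seg x) (k , lo , hi , trans (v≗w k) eq))

    -- Edges are named by their index in the list of r-subsets, which makes their existence a finite
    -- search.
    Segments : (Fin m → Fin n) → Set
    Segments v = ∀ (i : Fin ℓ) → ∃[ c ] c ∈ H × IsSegment r v (toℕ i) (lookup (rSubsets r n) c)

    segments? : ∀ v → Dec (Segments v)
    segments? v = Finₚ.all? λ i → Finₚ.any? λ c → (c ∈? H) ×-dec isSegment? v (toℕ i) (lookup (rSubsets r n) c)

    segments-resp : ∀ {v w} → v ≗ w → Segments v → Segments w
    segments-resp v≗w segs i = let c , c∈H , seg = segs i in c , c∈H , isSegment-resp {i = toℕ i} v≗w seg

    segments : ∀ {v} (edge : Fin ℓ → Subset n) → (∀ i → IsEdge r n H (edge i)) →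
               (∀ i → IsSegment r v (toℕ i) (edge i)) → Segments v
    segments {v} edge isEdge segment i = let c , c∈H , eq = isEdge i in
      c , c∈H , subst (IsSegment r v (toℕ i)) (sym eq) (segment i)

  module _ {r n : ℕ} (H : Hypergraph r n) (ℓ : ℕ) where

    loosePath? : Dec (LoosePath r n H ℓ)
    loosePath? = map′
      (λ (v , inj , segs) → record
        { vertex   = v
        ; edge     = λ i → lookup (rSubsets r n) (proj₁ (segs i))
        ; distinct = inj
        ; isEdge   = λ i → proj₁ (segs i) , proj₁ (proj₂ (segs i)) , refl
        ; segment  = λ i → proj₂ (proj₂ (segs i)) })
      (λ path → let open LoosePath path in vertex , distinct , segments H edge isEdge segment)
      (any-function?
        (λ v → (Finₚ.all? λ j → Finₚ.all? λ k → (v j Finₚ.≟ v k) →-dec (j Finₚ.≟ k)) ×-dec segments? {ℓ = ℓ} H v)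
        (λ v≗w (inj , segs) →
          (λ j k eq → inj j k (trans (v≗w j) (trans eq (sym (v≗w k))))) , segments-resp H v≗w segs))

    looseCycle? : Dec (LooseCycle r n H ℓ)
    looseCycle? = map′
      (λ (v , cl , inj , segs) → record
        { vertex   = v
        ; edge     = λ i → lookup (rSubsets r n) (proj₁ (segs i))
        ; closed   = cl
        ; distinct = inj
        ; isEdge   = λ i → proj₁ (segs i) , proj₁ (proj₂ (segs i)) , refl
        ; segment  = λ i → proj₂ (proj₂ (segs i)) })
      (λ cycle → let open LooseCycle cycle in vertex , closed , distinct , segments H edge isEdge segment)
      (any-function?
        (λ v → (v (fromℕ (ℓ * (r ℕ.∸ 1))) Finₚ.≟ v zero) ×-dec
          (Finₚ.all? λ j → Finₚ.all? λ k → (toℕ j ℕ.<? ℓ * (r ℕ.∸ 1)) →-dec (toℕ k ℕ.<? ℓ * (r ℕ.∸ 1)) →-dec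
            (v j Finₚ.≟ v k) →-dec (j Finₚ.≟ k)) ×-dec segments? {ℓ = ℓ} H v)
        (λ v≗w (cl , inj , segs) → trans (sym (v≗w _)) (trans cl (v≗w zero)) ,
          (λ j k j< k< eq → inj j k j< k< (trans (v≗w j) (trans eq (sym (v≗w k))))) , segments-resp H v≗w segs))

  module _ {d n : ℕ} {H : Hypergraph (suc d) n} (1≤d : 1 ≤ d) where

    loosePath-< : ∀ {ℓ} → LoosePath (suc d) n H ℓ → ℓ < n
    loosePath-< {ℓ} path = ℕₚ.≤-trans (s≤s (ℕₚ.m≤m*n ℓ d {{ℕ.>-nonZero 1≤d}})) (Finₚ.injective⇒≤ (λ {j} {k} → distinct j k))
      where open LoosePath path

    -- The remaining path stops at position ℓ d, strictly before the closing position (ℓ + 1) d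
    -- because d ≥ 1, so it contains only vertices that the cycle keeps distinct.
    dropEdge : ∀ {ℓ} → LooseCycle (suc d) n H (suc ℓ) → LoosePath (suc d) n H ℓ
    dropEdge {ℓ} cycle = record
      { vertex   = vertex ∘ embed
      ; edge     = edge ∘ widen
      ; distinct = λ j k eq → Finₚ.inject≤-injective fits fits j k (distinct (embed j) (embed k) (embed< j) (embed< k) eq)
      ; isEdge   = isEdge ∘ widen
      ; segment  = segment′
      }
      where
      open LooseCycle cycle
      fits : suc (ℓ * d) ≤ suc (suc ℓ * d)
      fits = s≤s (ℕₚ.m≤n+m (ℓ * d) d)
      embed : Fin (suc (ℓ * d)) → Fin (suc (suc ℓ * d))
      embed j = inject≤ j fits
      embed< : ∀ j → toℕ (embed j) < suc ℓ * d
      embed< j = subst (_< suc ℓ * d) (sym (Finₚ.toℕ-inject≤ j fits))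
        (ℕₚ.<-≤-trans (Finₚ.toℕ<n j) (ℕₚ.+-monoˡ-≤ (ℓ * d) 1≤d))
      widen : Fin ℓ → Fin (suc ℓ)
      widen i = inject≤ i (ℕₚ.n≤1+n ℓ)
      toℕ-widen : ∀ i → toℕ (widen i) ≡ toℕ i
      toℕ-widen i = Finₚ.toℕ-inject≤ i (ℕₚ.n≤1+n ℓ)
      segment′ : ∀ i → IsSegment (suc d) (vertex ∘ embed) (toℕ i) (edge (widen i))
      segment′ i x = mk⇔
        (λ x∈e → let k , lo , hi , eq = to (seg x) x∈e
                     k< = ℕₚ.<-≤-trans hi (subst (_≤ suc (ℓ * d)) (sym (ℕₚ.+-suc (toℕ i * d) d))
                       (s≤s (subst (_≤ ℓ * d) (ℕₚ.+-comm d (toℕ i * d)) (ℕₚ.*-monoˡ-≤ d (Finₚ.toℕ<n i)))))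
                     k≡ = Finₚ.toℕ-fromℕ< k<
                 in fromℕ< k< , subst (toℕ i * d ≤_) (sym k≡) lo , subst (_< toℕ i * d + suc d) (sym k≡) hi ,
                    trans (cong vertex (Finₚ.toℕ-injective (trans (Finₚ.toℕ-inject≤ (fromℕ< k<) fits) k≡))) eq)
        (λ (k , lo , hi , eq) → from (seg x) (embed k ,
          subst (toℕ i * d ≤_) (sym (Finₚ.toℕ-inject≤ k fits)) lo ,
          subst (_< toℕ i * d + suc d) (sym (Finₚ.toℕ-inject≤ k fits)) hi , eq))
        where
        seg : IsSegment (suc d) vertex (toℕ i) (edge (widen i))
        seg = subst (λ j → IsSegment (suc d) vertex j (edge (widen i))) (toℕ-widen i) (segment (widen i))

  module _ {d n′ : ℕ} (H : Hypergraph (suc d) (suc n′)) (1≤d : 1 ≤ d) where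

    longestPath : ∃[ L ] IsGreatest (LoosePath (suc d) (suc n′) H) L
    longestPath = greatest (loosePath? H)
      (record { vertex = λ _ → zero ; edge = λ () ; distinct = λ { zero zero _ → refl } ; isEdge = λ () ; segment = λ () })
      (suc n′) λ ℓ → ℕₚ.<⇒≤ ∘ loosePath-< 1≤d

    cycle≤path+1 : ∀ {L} → IsGreatest (LoosePath (suc d) (suc n′) H) L →
                   ∀ ℓ → LooseCycle (suc d) (suc n′) H ℓ → ℓ ≤ L + 1
    cycle≤path+1 _ zero _ = z≤n
    cycle≤path+1 {L} (_ , path≤L) (suc ℓ) cycle = subst (suc ℓ ≤_) (ℕₚ.+-comm 1 L) (s≤s (path≤L ℓ (dropEdge 1≤d cycle)))

    longestCycle : ∃[ L ] IsGreatest (LooseCycle (suc d) (suc n′) H) L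
    longestCycle = greatest (looseCycle? H)
      (record { vertex = λ _ → zero ; edge = λ () ; closed = refl
              ; distinct = λ { zero zero _ _ _ → refl } ; isEdge = λ () ; segment = λ () })
      (proj₁ longestPath + 1) (cycle≤path+1 (proj₂ longestPath))

-- Markov's inequality for tuples of centres.

module Tail where

  open import Data.Bool using (true; T)
  open import Data.Fin.Subset using (Subset)
  open import Data.List using (length)
  open import Data.Nat as ℕ using (ℕ; zero; suc; _∸_; s≤s)
  open import Data.Nat.Combinatorics using (_C_)
  import Data.Nat.Properties as ℕₚ
  open import Data.Rational using (ℚ; 0ℚ; 1ℚ; ½; _+_; _*_; _-_; -_; _≤_; _<_; _<?_)
  open import Data.Rational.Properties
  open import Function using (_∘_)
  open import Relation.Binary.PropositionalEquality using (_≡_; refl; sym; trans; cong; subst; subst₂)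
  open import Relation.Nullary using (¬_; yes; no)
  open import Relation.Nullary.Decidable using (⌊_⌋; toWitness)
  open import Tactic.RingSolver using (solve-∀)

  open import Defs using (Hypergraph; LoosePath; rSubsets)
  open Rationals
  open RandomSubsets
  open Survival
  open Exploration
  open LooseHypergraphs

  -- A Boolean event that does not mention p, so that one witness serves all terms of the Cauchy
  -- sequence of p.
  below : ∀ {N} → (Subset N → ℚ) → ℚ → Event N
  below f Y S = ⌊ f S <? Y ⌋

  markov : ∀ {N p δ Y} {f : Subset N → ℚ} → 0ℚ ≤ p → p ≤ 1ℚ → (∀ S → 0ℚ ≤ f S) → 0ℚ < Y →
           E p f ≤ δ * Y → 1ℚ - δ ≤ P p (below f Y)
  markov {N} {p} {δ} {Y} {f} 0≤p p≤1 0≤f 0<Y Ef≤ = *-cancelʳ Y 0<Y (≤-trans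
    (≤-trans (≤-reflexive (lem δ Y)) (+-monoʳ-≤ Y (neg-antimono-≤ Ef≤)))
    (0≤-⇒≤ (subst (0ℚ ≤_) (lem′ Y (P p A) (E p f)) (≤⇒0≤- (subst₂ _≤_ (E-const {N} p Y)
      (trans (E-+ p (λ S → Y * 𝟙 (A S)) f) (cong (_+ E p f) (E-* p Y (𝟙 ∘ A))))
      (E-mono 0≤p p≤1 pointwise))))))
    where
    A : Event N
    A = below f Y
    pointwise : ∀ S → Y ≤ Y * 𝟙 (A S) + f S
    pointwise S with f S <? Y
    ... | yes _   = slack (f S) (0≤f S) (cong (_+ f S) (sym (*-identityʳ Y)))
    ... | no fS≮Y = subst (Y ≤_) (sym (trans (cong (_+ f S) (*-zeroʳ Y)) (+-identityˡ (f S)))) (≮⇒≥ fS≮Y)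
    lem : ∀ δ Y → (1ℚ - δ) * Y ≡ Y - δ * Y
    lem = solve-∀ ℚ-ring
    lem′ : ∀ Y a e → Y * a + e - Y ≡ a * Y - (Y - e)
    lem′ = solve-∀ ℚ-ring

  -- With r = 1/d: an upper bound (2b/d)(1 + 16b) for the survival probability 2b/d + O(b²) ...
  level : ℚ → ℚ → ℚ
  level b r = 2ℚ * b * (1ℚ + 16ℚ * b) * r

  -- ... and an upper bound (2b²/d²)(1 + 64b) for the fraction of path edges per vertex.
  density : ℚ → ℚ → ℚ
  density b r = 2ℚ * (b * b) * (1ℚ + 4ℚ * 16ℚ * b) * (r * r)

  0≤level : ∀ {b r} → 0ℚ ≤ b → 0ℚ ≤ r → 0ℚ ≤ level b r
  0≤level 0≤b 0≤r = 0≤* (0≤* (0≤* (nonNegative⁻¹ 2ℚ) 0≤b) (0≤+ 0≤1 (0≤* (nonNegative⁻¹ 16ℚ) 0≤b))) 0≤r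

  0<level : ∀ {b r} → 0ℚ < b → 0ℚ < r → 0ℚ < level b r
  0<level 0<b 0<r = 0<* (0<* (0<* (positive⁻¹ 2ℚ) 0<b)
    (<-≤-trans 0<1 (slack _ (0≤* (nonNegative⁻¹ 16ℚ) (<⇒≤ 0<b)) refl))) 0<r

  0<density : ∀ {b r} → 0ℚ < b → 0ℚ < r → 0ℚ < density b r
  0<density 0<b 0<r = 0<* (0<* (0<* (positive⁻¹ 2ℚ) (0<* 0<b 0<b))
    (<-≤-trans 0<1 (slack _ (0≤* (nonNegative⁻¹ (4ℚ * 16ℚ)) (<⇒≤ 0<b)) refl))) (0<* 0<r 0<r)

  *-level : ∀ D b r → D * r ≡ 1ℚ → D * level b r ≡ 2ℚ * b * (1ℚ + 16ℚ * b)
  *-level D b r Dr≡1 = trans (lem D (2ℚ * b * (1ℚ + 16ℚ * b)) r)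
    (trans (cong (2ℚ * b * (1ℚ + 16ℚ * b) *_) Dr≡1) (*-identityʳ _))
    where
    lem : ∀ D z r → D * (z * r) ≡ z * (D * r)
    lem = solve-∀ ℚ-ring

  level≤1 : ∀ {D b r} → 0ℚ ≤ b → 16ℚ * b ≤ 1ℚ → 0ℚ ≤ r → 2ℚ ≤ D → D * r ≡ 1ℚ → level b r ≤ 1ℚ
  level≤1 {D} {b} {r} 0≤b 16b≤1 0≤r 2≤D Dr≡1 =
    ≤-trans (slack t 0≤t (lem t)) (≤-trans (*-monoʳ t 0≤t 2≤D) (subst (_≤ 1ℚ) (sym (*-level D b r Dr≡1))
      (≤-trans (*-monoˡ (2ℚ * b) (0≤* (nonNegative⁻¹ 2ℚ) 0≤b) (+-monoʳ-≤ 1ℚ 16b≤1))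
        (≤-trans (slack (4ℚ * (2ℚ + 1ℚ) * b) (0≤* (nonNegative⁻¹ (4ℚ * (2ℚ + 1ℚ))) 0≤b) (lem′ b)) 16b≤1))))
    where
    t : ℚ
    t = level b r
    0≤t : 0ℚ ≤ t
    0≤t = 0≤level 0≤b 0≤r
    lem : ∀ t → t + t ≡ 2ℚ * t
    lem = solve-∀ ℚ-ring
    lem′ : ∀ b → 2ℚ * b * (1ℚ + 1ℚ) + 4ℚ * (2ℚ + 1ℚ) * b ≡ 16ℚ * b
    lem′ = solve-∀ ℚ-ring

  module _ (d n′ k j : ℕ) where

    private
      n M : ℕ
      n = suc n′
      M = n′ C d
      D : ℚ
      D = fromℕ d

    tupleCount : Hypergraph (suc d) n → ℚ
    tupleCount = tuples (centre (edgeSet (suc d) n) (∣edgeSet∣ (suc d) n) k) j (λ _ → true)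

    lost : ℕ
    lost = k ℕ.+ k ℕ.+ j ℕ.* suc (k ℕ.+ k ℕ.+ (k ℕ.+ k))

    0≤tupleCount : ∀ H → 0ℚ ≤ tupleCount H
    0≤tupleCount = 0≤tuples (centre (edgeSet (suc d) n) (∣edgeSet∣ (suc d) n) k) j (λ _ → true)

    -- By `tuples-lower` the path alone produces (ℓ - lost)^j tuples, whereas the event allows fewer
    -- than X^j. A path without edges yields no trail and is treated separately.
    path-short : ∀ {H ℓ X} → 1 ℕ.≤ d → 0ℚ ≤ X → T (below tupleCount (X ^ j) H) → LoosePath (suc d) n H ℓ →
                 fromℕ ℓ ≤ X + fromℕ lost
    path-short {ℓ = zero} 1≤d 0≤X _ _ = 0≤+ 0≤X (0≤fromℕ lost)
    path-short {H} {ℓ@(suc _)} {X} 1≤d 0≤X few path = ≤-trans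
      (subst (fromℕ ℓ ≤_) (fromℕ-+ (ℓ ∸ lost) lost)
        (fromℕ-mono (subst (ℓ ℕ.≤_) (ℕₚ.+-comm lost (ℓ ∸ lost)) (ℕₚ.m≤n+m∸n ℓ lost))))
      (+-monoˡ-≤ (fromℕ lost) (≮⇒≥ λ X<ℓ → <⇒≱ (toWitness few) (≤-trans (^-mono j 0≤X (<⇒≤ X<ℓ))
        (tuples-lower (edgeSet (suc d) n) (∣edgeSet∣ (suc d) n) (LoosePath⇒Trail 1≤d path) k j))))
      where
      <⇒≱ : ∀ {a b} → a < b → ¬ b ≤ a
      <⇒≱ a<b b≤a = <-irrefl refl (<-≤-trans a<b b≤a)

    module _ {p b r δ : ℚ} (2≤d : 2 ℕ.≤ d) (2≤M : 2 ℕ.≤ M) (0<b : 0ℚ < b) (16b≤1 : 16ℚ * b ≤ 1ℚ)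
             (0≤r : 0ℚ ≤ r) (Dr≡1 : D * r ≡ 1ℚ)
             (0≤p : 0ℚ ≤ p) (1≤y : 1ℚ ≤ D * fromℕ M * p) (y≤1+b : D * fromℕ M * p ≤ 1ℚ + b) where

      -- The expected count is at most (N c)^j ≤ ((1 - b) X)^j, and (1 - b)^j ≤ δ, so Markov applies
      -- at `X ^ j`. The choice of k brings the walk bound `t ⊔ κ ^ k` down to t.
      few-tuples : 1ℚ ≤ fromℕ M * level b r → (1ℚ - level b r * level b r) ^ k ≤ level b r → (1ℚ - b) ^ j ≤ δ →
                   0ℚ < density b r * fromℕ n → 1ℚ - δ ≤ P p (below tupleCount ((density b r * fromℕ n) ^ j))
      few-tuples 1≤Mt κ^k≤t ρ^j≤δ 0<X = markov {δ = δ} 0≤p p≤1 0≤tupleCount (0<^ j)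
        (≤-trans (E-tuples 0≤p 2p≤1 (centre-monotone (edgeSet (suc d) n) (∣edgeSet∣ (suc d) n) k) 0≤c centre≤c j true-monotone)
          (subst (_≤ δ * X ^ j) (sym (trans (cong (_* (fromℕ N * c) ^ j) (E-const {N} p 1ℚ)) (*-identityˡ _)))
            (≤-trans (^-mono j (0≤* (0≤fromℕ N) 0≤c) Nc≤ρX)
              (subst (_≤ δ * X ^ j) (sym (^-distrib-* (1ℚ - b) X j))
                (*-monoʳ (X ^ j) (<⇒≤ (0<^ j)) ρ^j≤δ)))))
        where
        N : ℕ
        N = length (rSubsets (suc d) n)
        t κ X c : ℚ
        t = level b r
        κ = 1ℚ - t * t
        X = density b r * fromℕ n
        c = fromℕ (suc d) * D * (p * (t * t)) * ½
        0≤2 : 0ℚ ≤ 2ℚ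
        0≤2 = nonNegative⁻¹ 2ℚ
        0≤b : 0ℚ ≤ b
        0≤b = <⇒≤ 0<b
        0<^ : ∀ j → 0ℚ < X ^ j
        0<^ zero    = 0<1
        0<^ (suc j) = 0<* 0<X (0<^ j)
        0≤D : 0ℚ ≤ D
        0≤D = 0≤fromℕ d
        0≤t : 0ℚ ≤ t
        0≤t = 0≤level 0≤b 0≤r
        b≤1 : b ≤ 1ℚ
        b≤1 = ≤-trans (slack ((16ℚ - 1ℚ) * b) (0≤* (nonNegative⁻¹ (16ℚ - 1ℚ)) 0≤b) (lem b)) 16b≤1
          where
          lem : ∀ b → b + (16ℚ - 1ℚ) * b ≡ 16ℚ * b
          lem = solve-∀ ℚ-ring
        2≤D : 2ℚ ≤ D
        2≤D = fromℕ-mono 2≤d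
        2≤fromℕM : 2ℚ ≤ fromℕ M
        2≤fromℕM = fromℕ-mono 2≤M
        2p≤1 : p + p ≤ 1ℚ
        -- 4p ≤ D M p ≤ 1 + b ≤ 2, using d ≥ 2 and M ≥ 2; this supplies the hypothesis of `bk`.
        2p≤1 = *-cancelʳ 2ℚ (positive⁻¹ 2ℚ) (≤-trans
          (subst (_≤ D * fromℕ M * p) (lem p) (*-monoʳ p 0≤p (*-mono 0≤2 (0≤fromℕ M) 2≤D 2≤fromℕM)))
          (≤-trans y≤1+b (+-monoʳ-≤ 1ℚ b≤1)))
          where
          lem : ∀ p → 2ℚ * 2ℚ * p ≡ (p + p) * 2ℚ
          lem = solve-∀ ℚ-ring
        p≤1 : p ≤ 1ℚ
        p≤1 = ≤-trans (slack p 0≤p refl) 2p≤1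
        Dt≡ : D * t ≡ 2ℚ * b * (1ℚ + 16ℚ * b)
        Dt≡ = *-level D b r Dr≡1
        t≤1 : t ≤ 1ℚ
        t≤1 = level≤1 0≤b 16b≤1 0≤r 2≤D Dr≡1
        0≤κ : 0ℚ ≤ κ
        0≤κ = ≤⇒0≤- (*-mono 0≤t 0≤1 t≤1 t≤1)
        κ≤1 : κ ≤ 1ℚ
        κ≤1 = subst (κ ≤_) (+-identityʳ 1ℚ) (1-antitone (0≤* 0≤t 0≤t))
        at-t : ∀ {e m} → d ≡ suc e → M ≡ suc m → p * geometric d t * geometric M (p * atLeastOne d t) ≤ κ
        at-t {e} {m} d≡ M≡ = subst₂ (λ d M → p * geometric d t * geometric M (p * atLeastOne d t) ≤ κ) (sym d≡) (sym M≡)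
          (critical {m} {e} 0≤p p≤1 0<b 16b≤1 (subst (λ d → 2ℚ ≤ fromℕ d) d≡ 2≤D)
            (subst (λ d → fromℕ d * t ≡ 2ℚ * b * (1ℚ + 16ℚ * b)) d≡ Dt≡) 0≤t
            (subst (λ M → 1ℚ ≤ fromℕ M * t) M≡ 1≤Mt)
            (subst₂ (λ d M → 1ℚ ≤ fromℕ d * fromℕ M * p) d≡ M≡ 1≤y)
            (subst₂ (λ d M → fromℕ d * fromℕ M * p ≤ 1ℚ + b) d≡ M≡ y≤1+b))
        suc-pred : ∀ {m} → 2 ℕ.≤ m → m ≡ suc (ℕ.pred m)
        suc-pred (s≤s _) = refl
        walk≤t : ∀ v → P p (walk (edgeSet (suc d) n) (∣edgeSet∣ (suc d) n) k v) ≤ t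
        walk≤t v = subst (P p (walk (edgeSet (suc d) n) (∣edgeSet∣ (suc d) n) k v) ≤_) (p≥q⇒p⊔q≡p κ^k≤t)
          (P-walk (edgeSet (suc d) n) (∣edgeSet∣ (suc d) n) (λ v → ℕₚ.≤-reflexive (degree d n′ v)) 0≤p 2p≤1
            0≤t t≤1 0≤κ κ≤1 (at-t (suc-pred 2≤d) (suc-pred 2≤M)) k v)
        0≤c : 0ℚ ≤ c
        0≤c = 0≤* (0≤* (0≤* (0≤fromℕ (suc d)) 0≤D) (0≤* 0≤p (0≤* 0≤t 0≤t))) (nonNegative⁻¹ ½)
        centre≤c : ∀ e → P p (centre (edgeSet (suc d) n) (∣edgeSet∣ (suc d) n) k e) ≤ c
        centre≤c e = subst (_≤ c) (lem (P p (centre (edgeSet (suc d) n) (∣edgeSet∣ (suc d) n) k e)))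
          (*-monoʳ ½ (nonNegative⁻¹ ½) (P-centre (edgeSet (suc d) n) (∣edgeSet∣ (suc d) n)
            (λ v → ℕₚ.≤-reflexive (degree d n′ v)) 0≤p 2p≤1 k 0≤t walk≤t e))
          where
          lem : ∀ x → 2ℚ * x * ½ ≡ x
          lem = solve-∀ ℚ-ring
        N*[1+d] : fromℕ (suc d) * fromℕ N ≡ fromℕ n * fromℕ M
        N*[1+d] = trans (sym (fromℕ-* (suc d) N)) (trans (cong fromℕ
          (trans (cong (suc d ℕ.*_) (∣rSubsets∣ (suc d) n)) (absorption n′ d))) (fromℕ-* n M))
        q : ℚ
        q = fromℕ n * ((b * b) * (r * r))
        0≤q : 0ℚ ≤ q
        0≤q = 0≤* (0≤fromℕ n) (0≤* (0≤* 0≤b 0≤b) (0≤* 0≤r 0≤r))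
        -- The origin of the 64 in `density`. As N c = t² n (D M p)/2, the claim compares (1 +
        -- 16b)²(1 + b) with (1 - b)(1 + 64b). The latter exceeds the former by b(30 - 352b -
        -- 256b²), which is at least 7b when 16b ≤ 1.
        Nc≤ρX : fromℕ N * c ≤ (1ℚ - b) * X
        Nc≤ρX = subst (_≤ (1ℚ - b) * X)
          (trans (cong (λ x → x * (D * p) * (t * t) * ½) (sym N*[1+d])) (lem₁ (fromℕ (suc d)) (fromℕ N) D p t))
          (subst (_≤ (1ℚ - b) * X) (lem₂ (fromℕ n) (fromℕ M) D p t)
            (≤-trans (*-monoˡ (½ * (t * t * fromℕ n)) (0≤* (nonNegative⁻¹ ½) (0≤* (0≤* 0≤t 0≤t) (0≤fromℕ n))) y≤1+b)
              (slack (2ℚ * q * b * ((16ℚ + 4ℚ + 4ℚ + 4ℚ + 2ℚ) - (16ℚ * 16ℚ + 16ℚ * 4ℚ + 16ℚ * 2ℚ) * b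
                      - 16ℚ * 16ℚ * (b * b)))
                (0≤* (0≤* (0≤* 0≤2 0≤q) 0≤b) bracket) (lem₃ (fromℕ n) b r))))
          where
          lem₁ : ∀ s N D p t → s * N * (D * p) * (t * t) * ½ ≡ N * (s * D * (p * (t * t)) * ½)
          lem₁ = solve-∀ ℚ-ring
          lem₂ : ∀ n M D p t → ½ * (t * t * n) * (D * M * p) ≡ n * M * (D * p) * (t * t) * ½
          lem₂ = solve-∀ ℚ-ring
          lem₃ : ∀ n b r →
            ½ * (2ℚ * b * (1ℚ + 16ℚ * b) * r * (2ℚ * b * (1ℚ + 16ℚ * b) * r) * n) * (1ℚ + b)
            + 2ℚ * (n * ((b * b) * (r * r))) * b *
              ((16ℚ + 4ℚ + 4ℚ + 4ℚ + 2ℚ) - (16ℚ * 16ℚ + 16ℚ * 4ℚ + 16ℚ * 2ℚ) * b - 16ℚ * 16ℚ * (b * b))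
            ≡ (1ℚ - b) * (2ℚ * (b * b) * (1ℚ + 4ℚ * 16ℚ * b) * (r * r) * n)
          lem₃ = solve-∀ ℚ-ring
          bracket : 0ℚ ≤ (16ℚ + 4ℚ + 4ℚ + 4ℚ + 2ℚ) - (16ℚ * 16ℚ + 16ℚ * 4ℚ + 16ℚ * 2ℚ) * b - 16ℚ * 16ℚ * (b * b)
          bracket = subst (0ℚ ≤_) (lem b) (0≤+ (0≤+ (nonNegative⁻¹ (4ℚ + 2ℚ + 1ℚ))
              (0≤* (nonNegative⁻¹ (16ℚ + 4ℚ + 2ℚ)) (≤⇒0≤- 16b≤1)))
            (0≤* (0≤+ 0≤1 (0≤* (nonNegative⁻¹ 16ℚ) 0≤b)) (≤⇒0≤- 16b≤1)))
            where
            lem : ∀ b → 4ℚ + 2ℚ + 1ℚ + (16ℚ + 4ℚ + 2ℚ) * (1ℚ - 16ℚ * b) + (1ℚ + 16ℚ * b) * (1ℚ - 16ℚ * b)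
                  ≡ (16ℚ + 4ℚ + 4ℚ + 4ℚ + 2ℚ) - (16ℚ * 16ℚ + 16ℚ * 4ℚ + 16ℚ * 2ℚ) * b - 16ℚ * 16ℚ * (b * b)
            lem = solve-∀ ℚ-ring

-- Enclosing ε by rationals, choosing the constants, and the two ranges of ε.

module Assembly where
  open import Data.Bool using (true; T)
  open import Data.List using (length)
  import Data.Integer as ℤ
  import Data.Integer.Properties as ℤₚ
  open import Data.Nat as ℕ using (ℕ; zero; suc; _∸_; z≤n; s≤s)
  open import Data.Nat.Combinatorics using (_C_)
  import Data.Nat.Properties as ℕₚ
  open import Data.Product using (_×_; _,_; proj₁; proj₂; ∃-syntax)
  open import Data.Rational using (ℚ; 0ℚ; 1ℚ; ½; _+_; _*_; _-_; -_; _≤_; _<_; _⊓_; _≤?_; _/_; ∣_∣)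
  import Data.Sum
  open import Data.Rational.Properties
  import Data.Rational.Unnormalised as ℚᵘ
  import Data.Rational.Unnormalised.Properties as ℚᵘₚ
  open import Function using (_∘_)
  open import Relation.Binary.PropositionalEquality using (_≡_; refl; sym; trans; cong; subst; subst₂)
  open import Relation.Nullary using (¬_; Dec; yes; no)
  open import Tactic.RingSolver using (solve-∀)

  open import Defs
  open Rationals
  open RandomSubsets
  open Survival
  open LooseHypergraphs
  open Longest
  open Tail

  recip-inverse : ∀ k m → 1 ℕ.≤ k → fromℕ k * seq (recip k) m ≡ 1ℚ
  recip-inverse (suc k) m _ = toℚᵘ-injective
    (ℚᵘₚ.≃-trans (toℚᵘ-homo-* (fromℕ (suc k)) (ℤ.+ 1 / suc k))
      (ℚᵘₚ.≃-trans (ℚᵘₚ.*-cong (toℚᵘ-fromℚᵘ (ℚᵘ.mkℚᵘ (ℤ.+ suc k) 0)) (toℚᵘ-fromℚᵘ (ℚᵘ.mkℚᵘ (ℤ.+ 1) k)))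
        (ℚᵘ.*≡* (trans (ℤₚ.*-identityʳ (ℤ.+ suc k ℤ.* ℤ.+ 1))
          (trans (ℤₚ.*-identityʳ (ℤ.+ suc k)) (trans (cong (ℤ.+_ ∘ suc) (sym (ℕₚ.+-identityʳ k)))
            (sym (ℤₚ.*-identityˡ (ℤ.+ suc (k ℕ.+ 0))))))))))

  -- Chosen for the range 16b > 1: there b ≤ a + a² forces 32a ≥ 1, so K₀ a³ ≥ 1 and the bound is at
  -- least n. In the other range `density-gap` needs K₀ ≥ 1 + 2·515.
  32ℚ K₀ : ℚ
  32ℚ = 16ℚ + 16ℚ
  K₀ = 32ℚ * 32ℚ * 32ℚ

  -- Rational bounds a ≤ ε ≤ b, tight enough for b² = ε² + O(ε³).
  record Bracket (ε : ℝ) : Set where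
    field
      a b   : ℚ
      0<a   : 0ℚ < a
      a≤b   : a ≤ b
      b≤a+a² : b ≤ a + a * a
      start : ℕ
      lower : ∀ m → start ℕ.≤ m → a ≤ seq ε m
      upper : ∀ m → start ℕ.≤ m → seq ε m ≤ b

  bracket : ∀ ε → 0ℝ <ℝ ε → Bracket ε
  bracket ε (q₀ , 0<q₀ , N₀ , q₀≤ε) = record
    { a = a ; b = b ; 0<a = <-≤-trans 0<q/2 q/2≤a
    ; a≤b = slack (θ + θ) (0≤+ (<⇒≤ 0<θ) (<⇒≤ 0<θ)) (lem₁ e θ)
    ; b≤a+a² = b≤a+a²
    ; start = N
    ; lower = λ m N≤m → 0≤-⇒≤ (subst (0ℚ ≤_) (lem₂ θ e (seq ε m)) (≤⇒0≤- (≤-trans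
        (p≤∣p∣ (e - seq ε m)) (close N m ℕₚ.≤-refl N≤m))))
    ; upper = λ m N≤m → 0≤-⇒≤ (subst (0ℚ ≤_) (lem₃ θ e (seq ε m)) (≤⇒0≤- (≤-trans
        (p≤∣p∣ (seq ε m - e)) (close m N N≤m ℕₚ.≤-refl))))
    }
    where
    q θ e a b ρ : ℚ
    q = q₀ ⊓ 1ℚ
    ρ = ½ * ½ * ½ * ½
    -- With q ≤ 1 and e ≥ q this gives a ≥ q/2, hence b - a = 2θ = q²/8 ≤ q²/4 ≤ a².
    θ = q * q * ρ
    0<q : 0ℚ < q
    0<q = ⊓-glb-< 0<q₀ 0<1
      where
      ⊓-glb-< : ∀ {x y} → 0ℚ < x → 0ℚ < y → 0ℚ < x ⊓ y
      ⊓-glb-< {x} {y} 0<x 0<y with ≤-total x y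
      ... | Data.Sum.inj₁ x≤y = subst (0ℚ <_) (sym (p≤q⇒p⊓q≡p x≤y)) 0<x
      ... | Data.Sum.inj₂ y≤x = subst (0ℚ <_) (sym (p≥q⇒p⊓q≡q y≤x)) 0<y
    0≤q : 0ℚ ≤ q
    0≤q = <⇒≤ 0<q
    0<θ : 0ℚ < θ
    0<θ = 0<* (0<* 0<q 0<q) (positive⁻¹ ρ)
    N₁ N : ℕ
    N₁ = proj₁ (cauchy ε θ 0<θ)
    N = N₀ ℕ.⊔ N₁
    close : ∀ m m′ → N ℕ.≤ m → N ℕ.≤ m′ → ∣ seq ε m - seq ε m′ ∣ ≤ θ
    close m m′ N≤m N≤m′ = proj₂ (cauchy ε θ 0<θ) m m′
      (ℕₚ.m⊔n≤o⇒n≤o N₀ N₁ N≤m) (ℕₚ.m⊔n≤o⇒n≤o N₀ N₁ N≤m′)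
    e = seq ε N
    a = e - θ
    b = e + θ
    p≤∣p∣ : ∀ p → p ≤ ∣ p ∣
    p≤∣p∣ p with ≤-total 0ℚ p
    ... | Data.Sum.inj₁ 0≤p = ≤-reflexive (sym (0≤p⇒∣p∣≡p 0≤p))
    ... | Data.Sum.inj₂ p≤0 = ≤-trans p≤0 (0≤∣p∣ p)
    q≤e : q ≤ e
    q≤e = ≤-trans (p⊓q≤p q₀ 1ℚ) (subst (_≤ e) (+-identityˡ q₀) (q₀≤ε N (ℕₚ.m≤m⊔n N₀ N₁)))
    q≤1 : q ≤ 1ℚ
    q≤1 = p⊓q≤q q₀ 1ℚ
    0<q/2 : 0ℚ < ½ * q
    0<q/2 = 0<* (positive⁻¹ ½) 0<q
    lem₁ : ∀ e θ → e - θ + (θ + θ) ≡ e + θ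
    lem₁ = solve-∀ ℚ-ring
    lem₂ : ∀ θ e x → θ - (e - x) ≡ x - (e - θ)
    lem₂ = solve-∀ ℚ-ring
    lem₃ : ∀ θ e x → θ - (x - e) ≡ e + θ - x
    lem₃ = solve-∀ ℚ-ring
    q/2≤a : ½ * q ≤ a
    q/2≤a = 0≤-⇒≤ (subst (0ℚ ≤_) (lem e q) (0≤+ (≤⇒0≤- q≤e)
      (0≤+ (0≤* (0≤* 0≤q (≤⇒0≤- q≤1)) (nonNegative⁻¹ ρ)) (0≤* 0≤q (nonNegative⁻¹ (½ - ρ))))))
      where
      lem : ∀ e q → e - q + (q * (1ℚ - q) * (½ * ½ * ½ * ½) + q * (½ - ½ * ½ * ½ * ½)) ≡ e - q * q * (½ * ½ * ½ * ½) - ½ * q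
      lem = solve-∀ ℚ-ring
    b≤a+a² : b ≤ a + a * a
    b≤a+a² = ≤-trans (slack (q * q * (½ * ½ * ½)) (0≤* (0≤* 0≤q 0≤q) (nonNegative⁻¹ (½ * ½ * ½))) (lem e q))
      (+-monoʳ-≤ a (*-mono (<⇒≤ 0<q/2) (≤-trans (<⇒≤ 0<q/2) q/2≤a) q/2≤a q/2≤a))
      where
      lem : ∀ e q → e + q * q * (½ * ½ * ½ * ½) + q * q * (½ * ½ * ½) ≡ e - q * q * (½ * ½ * ½ * ½) + ½ * q * (½ * q)
      lem = solve-∀ ℚ-ring

  -- Substituting a + a² for b and using a ≤ 1 collects all higher powers into 515 a³, where 515 = 3
  -- + 64·8. The additional a³ on the left is the reserve for the constant number of lost positions.
  density-gap : ∀ {a b r} → 0ℚ < a → a ≤ b → b ≤ a + a * a → 16ℚ * b ≤ 1ℚ → 0ℚ ≤ r → r ≤ 1ℚ →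
                density b r + a * a * a ≤ 2ℚ * (a * a) * (r * r) + K₀ * (a * a * a)
  density-gap {a} {b} {r} 0<a a≤b b≤ 16b≤1 0≤r r≤1 = ≤-trans
    (+-monoˡ-≤ (a * a * a) (≤-trans
      (subst₂ _≤_ (lem₁ b (r * r)) (lem₁ c (r * r))
        (*-monoʳ (2ℚ * (r * r)) (0≤* 0≤2 (0≤* 0≤r 0≤r))
          (*-mono (0≤* 0≤b 0≤b) (0≤+ 0≤1 (0≤* 0≤64 0≤c)) (*-mono 0≤b 0≤c b≤ b≤) (+-monoʳ-≤ 1ℚ (*-monoˡ 64ℚ 0≤64 b≤)))))
      (slack (2ℚ * (r * r) * (a * a * a * (1ℚ - a) * (1ℚ + 64ℚ * (4ℚ + 2ℚ + 1ℚ + 4ℚ * a + a * a))))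
        (0≤* (0≤* 0≤2 (0≤* 0≤r 0≤r)) (0≤* (0≤* 0≤a³ (≤⇒0≤- a≤1))
          (0≤+ 0≤1 (0≤* 0≤64 (0≤+ (0≤+ (nonNegative⁻¹ (4ℚ + 2ℚ + 1ℚ)) (0≤* (nonNegative⁻¹ 4ℚ) 0≤a)) (0≤* 0≤a 0≤a))))))
        (lem₂ 64ℚ a (r * r)))))
    (slack (a * a * a * ((K₀ - 1ℚ - 2ℚ * 515ℚ) + 2ℚ * 515ℚ * (1ℚ - r * r)))
      (0≤* 0≤a³ (0≤+ (nonNegative⁻¹ (K₀ - 1ℚ - 2ℚ * 515ℚ))
        (0≤* (nonNegative⁻¹ (2ℚ * 515ℚ)) (≤⇒0≤- (*-mono 0≤r 0≤1 r≤1 r≤1)))))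
      (lem₃ K₀ 515ℚ a (r * r)))
    where
    64ℚ 515ℚ c : ℚ
    64ℚ = 4ℚ * 16ℚ
    515ℚ = 2ℚ + 1ℚ + 64ℚ * (4ℚ + 4ℚ)
    c = a + a * a
    0≤2 : 0ℚ ≤ 2ℚ
    0≤2 = nonNegative⁻¹ 2ℚ
    0≤64 : 0ℚ ≤ 64ℚ
    0≤64 = nonNegative⁻¹ 64ℚ
    0≤a : 0ℚ ≤ a
    0≤a = <⇒≤ 0<a
    0≤b : 0ℚ ≤ b
    0≤b = ≤-trans 0≤a a≤b
    0≤c : 0ℚ ≤ c
    0≤c = 0≤+ 0≤a (0≤* 0≤a 0≤a)
    0≤a³ : 0ℚ ≤ a * a * a
    0≤a³ = 0≤* (0≤* 0≤a 0≤a) 0≤a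
    a≤1 : a ≤ 1ℚ
    a≤1 = ≤-trans a≤b (≤-trans (slack ((16ℚ - 1ℚ) * b) (0≤* (nonNegative⁻¹ (16ℚ - 1ℚ)) 0≤b) (lem b)) 16b≤1)
      where
      lem : ∀ b → b + (16ℚ - 1ℚ) * b ≡ 16ℚ * b
      lem = solve-∀ ℚ-ring
    lem₁ : ∀ b s → b * b * (1ℚ + 4ℚ * 16ℚ * b) * (2ℚ * s) ≡ 2ℚ * (b * b) * (1ℚ + 4ℚ * 16ℚ * b) * s
    lem₁ = solve-∀ ℚ-ring
    lem₂ : ∀ w a s → 2ℚ * ((a + a * a) * (a + a * a)) * (1ℚ + w * (a + a * a)) * s
                     + 2ℚ * s * (a * a * a * (1ℚ - a) * (1ℚ + w * (4ℚ + 2ℚ + 1ℚ + 4ℚ * a + a * a)))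
                     ≡ 2ℚ * s * (a * a + (2ℚ + 1ℚ + w * (4ℚ + 4ℚ)) * (a * a * a))
    lem₂ = solve-∀ ℚ-ring
    lem₃ : ∀ K F a s → 2ℚ * s * (a * a + F * (a * a * a)) + a * a * a
                       + a * a * a * ((K - 1ℚ - 2ℚ * F) + 2ℚ * F * (1ℚ - s))
                       ≡ 2ℚ * (a * a) * s + K * (a * a * a)
    lem₃ = solve-∀ ℚ-ring

  cube-large : ∀ {a b} → 0ℚ < a → b ≤ a + a * a → ¬ 16ℚ * b ≤ 1ℚ → 1ℚ ≤ K₀ * (a * a * a)
  cube-large {a} {b} 0<a b≤ 16b≰1 = subst (1ℚ ≤_) (lem 32ℚ a)
    (*-mono 0≤1 0≤32a (*-mono 0≤1 0≤32a 1≤32a 1≤32a) 1≤32a)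
    where
    0≤a : 0ℚ ≤ a
    0≤a = <⇒≤ 0<a
    0≤32a : 0ℚ ≤ 32ℚ * a
    0≤32a = 0≤* (nonNegative⁻¹ 32ℚ) 0≤a
    lem : ∀ c a → c * a * (c * a) * (c * a) ≡ c * c * c * (a * a * a)
    lem = solve-∀ ℚ-ring
    1≤32a : 1ℚ ≤ 32ℚ * a
    1≤32a = ≮⇒≥ λ 32a<1 → 16b≰1 (≤-trans (*-monoˡ 16ℚ (nonNegative⁻¹ 16ℚ) b≤)
      (≤-trans (slack (16ℚ * (a * (1ℚ - a))) (0≤* (nonNegative⁻¹ 16ℚ) (0≤* 0≤a (≤⇒0≤- (a≤1 (<⇒≤ 32a<1))))) (lem₂ a))
        (<⇒≤ 32a<1)))
      where
      lem₁ : ∀ a → a + (32ℚ - 1ℚ) * a ≡ 32ℚ * a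
      lem₁ = solve-∀ ℚ-ring
      a≤1 : 32ℚ * a ≤ 1ℚ → a ≤ 1ℚ
      a≤1 = ≤-trans (slack ((32ℚ - 1ℚ) * a) (0≤* (nonNegative⁻¹ (32ℚ - 1ℚ)) 0≤a) (lem₁ a))
      lem₂ : ∀ a → 16ℚ * (a + a * a) + 16ℚ * (a * (1ℚ - a)) ≡ 32ℚ * a
      lem₂ = solve-∀ ℚ-ring

  module _ {d : ℕ} (2≤d : 2 ℕ.≤ d) where

    private
      1≤d : 1 ℕ.≤ d
      1≤d = ℕₚ.≤-trans (s≤s z≤n) 2≤d

      D r : ℚ
      D = fromℕ d
      r = seq (recip d) 0

      2≤D : 2ℚ ≤ D
      2≤D = fromℕ-mono 2≤d

      Dr≡1 : D * r ≡ 1ℚ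
      Dr≡1 = recip-inverse d 0 1≤d

      0≤recip : ∀ k m → 0ℚ ≤ seq (recip k) m
      0≤recip zero    m = ≤-refl
      0≤recip (suc k) m = <⇒≤ (positive⁻¹ (ℤ.+ 1 / suc k) {{normalize-pos 1 (suc k)}})

      0≤r : 0ℚ ≤ r
      0≤r = 0≤recip d 0

      0<r : 0ℚ < r
      0<r = ≰⇒> λ r≤0 → <-irrefl refl (<-≤-trans 0<1 (subst₂ _≤_ Dr≡1 (*-zeroʳ D) (*-monoˡ D (0≤fromℕ d) r≤0)))

      r≤1 : r ≤ 1ℚ
      r≤1 = subst₂ _≤_ (*-identityˡ r) Dr≡1 (*-monoʳ r 0≤r (fromℕ-mono 1≤d))

      recip-d² : ∀ m → seq (recip (d ℕ.^ 2)) m ≡ r * r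
      recip-d² m = begin
        s                                 ≡⟨ lem₁ s ⟩
        s * 1ℚ * 1ℚ                       ≡⟨ cong (λ x → s * x * x) (sym Dr≡1) ⟩
        s * (D * r) * (D * r)             ≡⟨ lem₂ s D r ⟩
        D * D * s * (r * r)               ≡⟨ cong (λ x → x * s * (r * r)) (sym (trans (fromℕ-* d (d ℕ.* 1)) (cong (λ x → D * fromℕ x) (ℕₚ.*-identityʳ d)))) ⟩
        fromℕ (d ℕ.^ 2) * s * (r * r)     ≡⟨ cong (_* (r * r)) (recip-inverse (d ℕ.^ 2) m (ℕₚ.*-mono-≤ 1≤d (ℕₚ.*-mono-≤ 1≤d (s≤s (z≤n {0}))))) ⟩
        1ℚ * (r * r)                      ≡⟨ *-identityˡ (r * r) ⟩
        r * r                             ∎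
        where
        open Relation.Binary.PropositionalEquality.≡-Reasoning
        s : ℚ
        s = seq (recip (d ℕ.^ 2)) m
        lem₁ : ∀ s → s ≡ s * 1ℚ * 1ℚ
        lem₁ = solve-∀ ℚ-ring
        lem₂ : ∀ s D r → s * (D * r) * (D * r) ≡ D * D * s * (r * r)
        lem₂ = solve-∀ ℚ-ring

    Good : ℝ → ∀ n → Hypergraph (suc d) n → Set
    Good c n H = ∃[ L-C ] ∃[ L-P ]
      IsGreatest (LooseCycle (suc d) n H) L-C ×
      IsGreatest (LoosePath (suc d) n H) L-P ×
      (L-C ℕ.≤ L-P ℕ.+ 1) ×
      (fromℕℝ (L-P ℕ.+ 1) ≤ℝ c *ℝ fromℕℝ n)

    good : ∀ c {n′} {H : Hypergraph (suc d) (suc n′)} →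
           (∀ ℓ → LoosePath (suc d) (suc n′) H ℓ → fromℕℝ (ℓ ℕ.+ 1) ≤ℝ c *ℝ fromℕℝ (suc n′)) → Good c (suc n′) H
    good c {H = H} bound =
      let L-P , gP = longestPath H 1≤d
          L-C , gC = longestCycle H 1≤d
      in L-C , L-P , gC , gP , cycle≤path+1 H 1≤d gP L-C (proj₁ gC) , bound L-P (proj₁ gP)

    module _ (ε : ℝ) (ε-bracket : Bracket ε) where

      open Bracket ε-bracket

      private
        η c : ℝ
        η = fromℚ K₀ *ℝ ε ^ℝ 3
        c = fromℕℝ 2 *ℝ ε ^ℝ 2 *ℝ recip (d ℕ.^ 2) +ℝ η

        0≤a : 0ℚ ≤ a
        0≤a = <⇒≤ 0<a

        0<b : 0ℚ < b
        0<b = <-≤-trans 0<a a≤b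

        0≤K₀ : 0ℚ ≤ K₀
        0≤K₀ = nonNegative⁻¹ K₀

        c-lower : ∀ m → start ℕ.≤ m → 2ℚ * (a * a) * (r * r) + K₀ * (a * a * a) ≤ seq c m
        c-lower m start≤m = subst (2ℚ * (a * a) * (r * r) + K₀ * (a * a * a) ≤_)
          (trans (lem x (r * r) K₀) (cong (λ s → 2ℚ * (x * (x * 1ℚ)) * s + K₀ * (x * (x * (x * 1ℚ)))) (sym (recip-d² m))))
          (+-mono-≤
            (*-monoʳ (r * r) (0≤* 0≤r 0≤r) (*-monoˡ 2ℚ (nonNegative⁻¹ 2ℚ) aa≤xx))
            (*-monoˡ K₀ 0≤K₀ (*-mono (0≤* 0≤a 0≤a) 0≤x aa≤xx a≤x)))
          where
          x : ℚ
          x = seq ε m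
          a≤x : a ≤ x
          a≤x = lower m start≤m
          0≤x : 0ℚ ≤ x
          0≤x = ≤-trans 0≤a a≤x
          aa≤xx : a * a ≤ x * x
          aa≤xx = *-mono 0≤a 0≤x a≤x a≤x
          lem : ∀ x s K → 2ℚ * (x * x) * s + K * (x * x * x) ≡ 2ℚ * (x * (x * 1ℚ)) * s + K * (x * (x * (x * 1ℚ)))
          lem = solve-∀ ℚ-ring

        bounded-by-c : ∀ n ℓ → fromℕ (ℓ ℕ.+ 1) ≤ (2ℚ * (a * a) * (r * r) + K₀ * (a * a * a)) * fromℕ n →
                       fromℕℝ (ℓ ℕ.+ 1) ≤ℝ c *ℝ fromℕℝ n
        bounded-by-c n ℓ ℓ≤ q 0<q = start , λ m start≤m → ≤-trans
          (≤-trans ℓ≤ (*-monoʳ (fromℕ n) (0≤fromℕ n) (c-lower m start≤m)))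
          (slack q (<⇒≤ 0<q) refl)

      ∣η∣-bound : ∣ η ∣ℝ ≤ℝ fromℚ K₀ *ℝ ε ^ℝ 3
      ∣η∣-bound q 0<q = start , λ m start≤m →
        let 0≤x = ≤-trans 0≤a (lower m start≤m) in
        subst (_≤ seq η m + q) (sym (0≤p⇒∣p∣≡p (0≤* 0≤K₀ (0≤* 0≤x (0≤* 0≤x (0≤* 0≤x 0≤1))))))
          (slack q (<⇒≤ 0<q) refl)

      private
        whp-large : ¬ 16ℚ * b ≤ 1ℚ → WithHighProbability (suc d) (edgeProbability (suc d) ε) (Good c)
        -- Every hypergraph with n ≥ 1 is good here: a loose path satisfies ℓ + 1 ≤ n ≤ K₀ a³ n. The
        -- sure event is therefore the witness; n ≥ 1 provides the single-vertex path and cycle.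
        whp-large 16b≰1 δ (q₀ , 0<q₀ , N₀ , q₀≤δ) = 1 , λ { (suc n′) _ →
          (λ _ → true) , (λ H _ → good c λ ℓ path → bounded-by-c (suc n′) ℓ (short n′ ℓ path)) ,
          λ q 0<q → N₀ , λ m N₀≤m → subst (λ x → 1ℚ - seq δ m ≤ x + q)
            (sym (trans (seq-Pr (suc d) (suc n′) (edgeProbability (suc d) ε (suc n′)) (λ _ → true) m)
              (E-const {length (rSubsets (suc d) (suc n′))} (seq (edgeProbability (suc d) ε (suc n′)) m) 1ℚ)))
            (≤-trans (subst (1ℚ - seq δ m ≤_) (+-identityʳ 1ℚ)
                (1-antitone (≤-trans (<⇒≤ 0<q₀) (subst (_≤ seq δ m) (+-identityˡ q₀) (q₀≤δ m N₀≤m)))))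
              (slack q (<⇒≤ 0<q) refl)) }
          where
          short : ∀ n′ ℓ {H} → LoosePath (suc d) (suc n′) H ℓ →
                  fromℕ (ℓ ℕ.+ 1) ≤ (2ℚ * (a * a) * (r * r) + K₀ * (a * a * a)) * fromℕ (suc n′)
          short n′ ℓ path = ≤-trans
            (fromℕ-mono (subst (ℕ._≤ suc n′) (ℕₚ.+-comm 1 ℓ) (loosePath-< 1≤d path)))
            (subst (_≤ (2ℚ * (a * a) * (r * r) + K₀ * (a * a * a)) * fromℕ (suc n′)) (*-identityˡ (fromℕ (suc n′)))
              (*-monoʳ (fromℕ (suc n′)) (0≤fromℕ (suc n′)) (≤-trans (cube-large 0<a b≤a+a² 16b≰1)
                (subst (K₀ * (a * a * a) ≤_) (+-comm (K₀ * (a * a * a)) (2ℚ * (a * a) * (r * r)))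
                  (slack _ (0≤* (0≤* (nonNegative⁻¹ 2ℚ) (0≤* 0≤a 0≤a)) (0≤* 0≤r 0≤r)) refl)))))

        -- All constants precede n: k makes walks long enough, j beats δ, m₁ ensures M t ≥ 1, and m₂
        -- makes a³ n cover the lost positions; the successor of `lost` accounts for the 1 in
        -- `L-P + 1`. The summand 2 in the threshold secures M ≥ 2.
        large-n : ∀ δ q₀ N₀ → (∀ m → N₀ ℕ.≤ m → 0ℚ + q₀ ≤ seq δ m) → 16ℚ * b ≤ 1ℚ → ∀ k j m₁ m₂ →
                  (1ℚ - level b r * level b r) ^ k ≤ level b r → (1ℚ - b) ^ j ≤ q₀ →
                  1ℚ ≤ fromℕ m₁ * level b r → fromℕ (suc (lost d 0 k j)) ≤ fromℕ m₂ * (a * a * a) →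
                  ∀ n → suc (d ℕ.+ (m₁ ℕ.+ 2 ℕ.+ m₂)) ℕ.≤ n →
                  PrAtLeast (suc d) n (edgeProbability (suc d) ε n) (Good c n) (1ℝ -ℝ δ)
        large-n δ q₀ N₀ q₀≤δ 16b≤1 k j m₁ m₂ κ^k≤t ρ^j≤q₀ 1≤m₁t lost≤m₂a³ (suc n′) (s≤s d+x₀≤n′) =
          A , (λ H few → good c λ ℓ path → bounded-by-c n ℓ (short ℓ H few path)) , likely
          where
          t : ℚ
          t = level b r
          0<t : 0ℚ < t
          0<t = 0<level 0<b 0<r
          x₀ : ℕ
          x₀ = m₁ ℕ.+ 2 ℕ.+ m₂
          n M : ℕ
          n = suc n′
          M = n′ C d
          p : ℝ
          p = edgeProbability (suc d) ε n
          X : ℚ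
          X = density b r * fromℕ n
          0<X : 0ℚ < X
          0<X = 0<* (0<density 0<b 0<r) (<-≤-trans 0<1 (fromℕ-mono {1} {n} (s≤s z≤n)))
          A : Hypergraph (suc d) n → _
          A = below (tupleCount d n′ k j) (X ^ j)
          x₀≤M : x₀ ℕ.≤ M
          x₀≤M = ℕₚ.≤-trans (ℕₚ.m+n≤o⇒m≤o∸n x₀ (subst (ℕ._≤ n′) (ℕₚ.+-comm d x₀) d+x₀≤n′)) (ℕₚ.<⇒≤ (subst (λ m → n′ ∸ d ℕ.< m C d)
            (ℕₚ.m+[n∸m]≡n (ℕₚ.m+n≤o⇒m≤o d d+x₀≤n′)) (n<C (n′ ∸ d) d 1≤d)))
          2≤M : 2 ℕ.≤ M
          2≤M = ℕₚ.≤-trans (ℕₚ.≤-trans (ℕₚ.m≤n+m 2 m₁) (ℕₚ.m≤m+n (m₁ ℕ.+ 2) m₂)) x₀≤M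
          m₂≤n : m₂ ℕ.≤ n
          m₂≤n = ℕₚ.≤-trans (ℕₚ.m≤n+m m₂ (m₁ ℕ.+ 2)) (ℕₚ.≤-trans (ℕₚ.m≤n+m x₀ d)
            (ℕₚ.≤-trans d+x₀≤n′ (ℕₚ.n≤1+n n′)))
          1≤Mt : 1ℚ ≤ fromℕ M * t
          1≤Mt = ≤-trans 1≤m₁t (*-monoʳ t (<⇒≤ 0<t) (fromℕ-mono
            (ℕₚ.≤-trans (ℕₚ.≤-trans (ℕₚ.m≤m+n m₁ 2) (ℕₚ.m≤m+n (m₁ ℕ.+ 2) m₂)) x₀≤M)))
          short : ∀ ℓ H → T (A H) → LoosePath (suc d) n H ℓ →
                  fromℕ (ℓ ℕ.+ 1) ≤ (2ℚ * (a * a) * (r * r) + K₀ * (a * a * a)) * fromℕ n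
          short ℓ H few path = ≤-trans
            (subst₂ _≤_ (sym (fromℕ-+ ℓ 1)) (trans (lem X (fromℕ (lost d 0 k j))) (cong (X +_) (sym (fromℕ-suc (lost d 0 k j)))))
              (+-monoˡ-≤ 1ℚ (path-short d n′ k j 1≤d (<⇒≤ 0<X) few path)))
            (≤-trans (+-monoʳ-≤ X (≤-trans lost≤m₂a³
                (*-monoʳ (a * a * a) (0≤* (0≤* 0≤a 0≤a) 0≤a) (fromℕ-mono m₂≤n))))
              (subst (_≤ (2ℚ * (a * a) * (r * r) + K₀ * (a * a * a)) * fromℕ n) (lem′ (density b r) (fromℕ n) (a * a * a))
                (*-monoʳ (fromℕ n) (0≤fromℕ n) (density-gap 0<a a≤b b≤a+a² 16b≤1 0≤r r≤1))))
            where
            lem : ∀ x l → x + l + 1ℚ ≡ x + (1ℚ + l)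
            lem = solve-∀ ℚ-ring
            lem′ : ∀ s n z → (s + z) * n ≡ s * n + n * z
            lem′ = solve-∀ ℚ-ring
          dM≥1 : 1 ℕ.≤ d ℕ.* M
          dM≥1 = ℕₚ.*-mono-≤ 1≤d (ℕₚ.≤-trans (s≤s z≤n) 2≤M)
          y≡ : ∀ m → D * fromℕ M * seq p m ≡ 1ℚ + seq ε m
          y≡ m = trans (lem D (fromℕ M) (1ℚ + seq ε m) (seq (recip (d ℕ.* M)) m))
            (trans (cong ((1ℚ + seq ε m) *_) (trans (cong (_* seq (recip (d ℕ.* M)) m) (sym (fromℕ-* d M)))
              (recip-inverse (d ℕ.* M) m dM≥1))) (*-identityʳ (1ℚ + seq ε m)))
            where
            lem : ∀ D M e R → D * M * (e * R) ≡ e * (D * M * R)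
            lem = solve-∀ ℚ-ring
          likely : 1ℝ -ℝ δ ≤ℝ Pr (suc d) n p A
          -- `A` is fixed while m varies: the m-th terms of p and ε enter only through 1 ≤ D M p = 1
          -- + ε ≤ 1 + b, valid from `start` on.
          likely q 0<q = start ℕ.⊔ N₀ , λ m late≤m →
            let start≤m = ℕₚ.m⊔n≤o⇒m≤o start N₀ late≤m
                0≤ε = ≤-trans 0≤a (lower m start≤m)
            in subst (λ x → 1ℚ - seq δ m ≤ x + q) (sym (seq-Pr (suc d) n p A m))
              (≤-trans (1-antitone (subst (_≤ seq δ m) (+-identityˡ q₀) (q₀≤δ m (ℕₚ.m⊔n≤o⇒n≤o start N₀ late≤m))))
                (≤-trans (few-tuples d n′ k j 2≤d 2≤M 0<b 16b≤1 0≤r Dr≡1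
                    (0≤* (0≤+ 0≤1 0≤ε) (0≤recip (d ℕ.* M) m))
                    (subst (1ℚ ≤_) (sym (y≡ m)) (slack (seq ε m) 0≤ε refl))
                    (subst (_≤ 1ℚ + b) (sym (y≡ m)) (+-monoʳ-≤ 1ℚ (upper m start≤m)))
                    1≤Mt
                    κ^k≤t
                    ρ^j≤q₀ 0<X)
                  (slack q (<⇒≤ 0<q) refl)))

        whp-small : 16ℚ * b ≤ 1ℚ → WithHighProbability (suc d) (edgeProbability (suc d) ε) (Good c)
        whp-small 16b≤1 δ (q₀ , 0<q₀ , N₀ , q₀≤δ) =
          choose (^-small (0<* 0<t 0<t) t²≤1 0<t) (^-small 0<b b≤1 0<q₀) (archimedean 1ℚ 0<t)
          where
          t : ℚ
          t = level b r
          0<t : 0ℚ < t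
          0<t = 0<level 0<b 0<r
          t²≤1 : t * t ≤ 1ℚ
          t²≤1 = *-mono (<⇒≤ 0<t) 0≤1 t≤1 t≤1
            where
            t≤1 : t ≤ 1ℚ
            t≤1 = level≤1 (<⇒≤ 0<b) 16b≤1 0≤r 2≤D Dr≡1
          b≤1 : b ≤ 1ℚ
          b≤1 = ≤-trans (slack ((16ℚ - 1ℚ) * b) (0≤* (nonNegative⁻¹ (16ℚ - 1ℚ)) (<⇒≤ 0<b)) (lem b)) 16b≤1
            where
            lem : ∀ b → b + (16ℚ - 1ℚ) * b ≡ 16ℚ * b
            lem = solve-∀ ℚ-ring
          choose : ∃[ k ] (1ℚ - t * t) ^ k ≤ t → ∃[ j ] (1ℚ - b) ^ j ≤ q₀ → ∃[ m₁ ] 1ℚ ≤ fromℕ m₁ * t →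
                   ∃[ n₀ ] ∀ n → n₀ ℕ.≤ n → PrAtLeast (suc d) n (edgeProbability (suc d) ε n) (Good c n) (1ℝ -ℝ δ)
          choose (k , κ^k≤t) (j , ρ^j≤q₀) (m₁ , 1≤m₁t) =
            choose-m₂ (archimedean (fromℕ (suc (lost d 0 k j))) (0<* (0<* 0<a 0<a) 0<a))
            where
            choose-m₂ : ∃[ m₂ ] fromℕ (suc (lost d 0 k j)) ≤ fromℕ m₂ * (a * a * a) →
                        ∃[ n₀ ] ∀ n → n₀ ℕ.≤ n → PrAtLeast (suc d) n (edgeProbability (suc d) ε n) (Good c n) (1ℝ -ℝ δ)
            choose-m₂ (m₂ , lost≤m₂a³) = suc (d ℕ.+ (m₁ ℕ.+ 2 ℕ.+ m₂)) ,
              large-n δ q₀ N₀ q₀≤δ 16b≤1 k j m₁ m₂ κ^k≤t ρ^j≤q₀ 1≤m₁t lost≤m₂a³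

      whp : WithHighProbability (suc d) (edgeProbability (suc d) ε) (Good c)
      whp = by-size (16ℚ * b ≤? 1ℚ)
        where
        by-size : Dec (16ℚ * b ≤ 1ℚ) → WithHighProbability (suc d) (edgeProbability (suc d) ε) (Good c)
        by-size (yes 16b≤1) = whp-small 16b≤1
        by-size (no  16b≰1) = whp-large 16b≰1

open import Defs
open import Data.Nat using (ℕ; _+_; _∸_; _^_; _≤_)
open import Data.Product using (Σ; _×_)

open import Data.Nat using (suc; s≤s)
open import Data.Product using (_,_)
open Assembly

corollary1p8 : (r : ℕ) → 3 ≤ r →
    Σ ℝ λ K → (ε : ℝ) → 0ℝ <ℝ ε →
    Σ ℝ λ η → (∣ η ∣ℝ ≤ℝ K *ℝ ε ^ℝ 3) ×
    WithHighProbability r (edgeProbability r ε) (λ n H →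
    Σ ℕ λ L-C → Σ ℕ λ L-P →
    IsGreatest (LooseCycle r n H) L-C ×
    IsGreatest (LoosePath r n H) L-P ×
    (L-C ≤ L-P + 1) ×
    (fromℕℝ (L-P + 1) ≤ℝ (fromℕℝ 2 *ℝ ε ^ℝ 2 *ℝ recip ((r ∸ 1) ^ 2) +ℝ η) *ℝ fromℕℝ n))
corollary1p8 (suc d) (s≤s 2≤d) = fromℚ K₀ , λ ε 0<ε →
  fromℚ K₀ *ℝ ε ^ℝ 3 , ∣η∣-bound 2≤d ε (bracket ε 0<ε) , whp 2≤d ε (bracket ε 0<ε)
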